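{- There are absolute constants such that the following holds. Let $r\ge2$ and let $t$ be a tree of size $n\ge2$ in which $\sigma$ different node labels occur, each of rank at most $r$. Then there is a TSLP $\mathcal G$ in Chomsky normal form with $\mathrm{val}(\mathcal G)=t$, \[|\mathcal G|\in O\Big(\frac{n\cdot\log(\sigma+r)\cdot r\cdot\log r}{\log n}\Big),\qquad \mathrm{depth}(\mathcal G)\in O(r\log n),\] and every nonterminal of $\mathcal G$ has rank at most $r+1$. Moreover, such a $\mathcal G$ can be computed from $t$ in time $O(r\cdot n\cdot\log n)$.
   Context: Trees: finite rooted ordered trees whose nodes are labelled by ranked symbols (terminals and nonterminals, each with a rank) or by parameters $x_1,x_2,\dots$ (leaves only); a node labelled by a symbol of rank $k$ has exactly $k$ ordered children. The size $|t|$ is the number of nodes not labelled by a parameter. A valid pattern of rank $n$ is a tree in which each of $x_1,\dots,x_n$ occurs exactly once, no other parameter occurs, and $x_1,\dots,x_n$ appear in this order in depth-first left-to-right order. A tree straight-line program (TSLP) $\mathcal G$ has finitely many nonterminals, a start nonterminal $S$ of rank $0$, and for each nonterminal $A$ of rank $n$ exactly one rule $A(x_1,\dots,x_n)\to t$ with $t$ a valid pattern of rank $n$ over terminals, nonterminals and $x_1,\dots,x_n$, such that the relation "$B$ occurs in the right-hand side of $A$" is acyclic. Each nonterminal $A$ derives a unique valid pattern $\mathrm{val}_{\mathcal G}(A)$ over terminals and parameters by repeatedly replacing nonterminals by their right-hand sides (substituting arguments for parameters); $\mathrm{val}(\mathcal G)=\mathrm{val}_{\mathcal G}(S)$. The size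 $|\mathcal G|$ is the sum of the sizes of all right-hand sides (parameters not counted). $\mathcal G$ is in Chomsky normal form if every rule has the form $A(x_1,\dots,x_n)\to B(x_1,\dots,x_{i-1},C(x_i,\dots,x_k),x_{k+1},\dots,x_n)$ with $B,C$ nonterminals, or $A(x_1,\dots,x_n)\to f(x_1,\dots,x_n)$ with $f$ a terminal of rank $n$. The derivation tree of such $\mathcal G$ has root labelled $S$; a node labelled $A$ with a rule of the first form has children labelled $B$ (left) and $C$ (right), with the second form a single leaf child labelled $f$; $\mathrm{depth}(\mathcal G)$ is the depth of the derivation tree. Time is measured in the RAM model with unit-cost operations on $O(\log n)$-bit numbers. -}

module Defs where

open import Data.Bool using (if_then_else_)
open import Data.Fin using (Fin; toℕ)
import Data.Fin.Properties as Fin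
open import Data.List using (List; []; _∷_; _++_; length; lookup; concatMap; sum; deduplicate; allFin)
import Data.List as List
open import Data.List.Membership.Propositional using (_∈_)
open import Data.Nat using (ℕ; zero; suc; _+_; _*_; _∸_; _/_; _^_; _≤_; _<_; _≡ᵇ_; _⊔_)
open import Data.Nat.Logarithm using (⌊log₂_⌋)
open import Data.Product using (Σ; ∃; _×_; _,_)
open import Data.Sum using (_⊎_; inj₁; inj₂; [_,_]′)
import Data.Sum.Properties as Sum
open import Data.Vec using (Vec; []; _∷_; tabulate; _[_]≔_)
import Data.Vec as Vec
open import Relation.Binary.Construct.Closure.ReflexiveTransitive using (Star)
open import Relation.Binary.Construct.Closure.Transitive using (TransClosure)
open import Relation.Binary.Definitions using (DecidableEquality)
open import Relation.Binary.PropositionalEquality using (_≡_; _≢_; sym; subst)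
open import Relation.Nullary using (¬_)

------------------------------------------------------------------------
-- Trees

record RankedAlphabet : Set₁ where
  field
    Symbol : Set
    rank   : Symbol → ℕ
    _≟_    : DecidableEquality Symbol

open RankedAlphabet public using (Symbol; rank)

-- Trees over the alphabet F whose parameters are drawn from X.
data Term (F : RankedAlphabet) (X : Set) : Set where
  param : X → Term F X
  node  : (s : Symbol F) → Vec (Term F X) (rank F s) → Term F X

Tree : RankedAlphabet → Set
Tree F = Term F (Fin 0)

module _ {F : RankedAlphabet} {X : Set} where

  -- Labels of the non-parameter nodes, in depth-first left-to-right order.
  labels  : Term F X → List (Symbol F)
  labels* : ∀ {k} → Vec (Term F X) k → List (Symbol F)
  labels (param x)   = []
  labels (node s ts) = s ∷ labels* ts
  labels* []       = []
  labels* (t ∷ ts) = labels t ++ labels* ts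

  -- Labels of the parameter nodes, in depth-first left-to-right order.
  params  : Term F X → List X
  params* : ∀ {k} → Vec (Term F X) k → List X
  params (param x)   = x ∷ []
  params (node s ts) = params* ts
  params* []       = []
  params* (t ∷ ts) = params t ++ params* ts

  size : Term F X → ℕ
  size t = length (labels t)

  #labels : Term F X → ℕ
  #labels t = length (deduplicate (RankedAlphabet._≟_ F) (labels t))

  module _ {Y : Set} where

    infixl 8 _⟪_⟫ _⟪_⟫*

    -- Simultaneous substitution of trees for parameters.
    _⟪_⟫  : Term F X → (X → Term F Y) → Term F Y
    _⟪_⟫* : ∀ {k} → Vec (Term F X) k → (X → Term F Y) → Vec (Term F Y) k
    param x   ⟪ θ ⟫ = θ x
    node s ts ⟪ θ ⟫ = node s (ts ⟪ θ ⟫*)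
    []       ⟪ θ ⟫* = []
    (t ∷ ts) ⟪ θ ⟫* = t ⟪ θ ⟫ ∷ ts ⟪ θ ⟫*

-- The parameters x₁,…,xₙ are the elements of Fin n (so x₁ is zero); each
-- has to occur exactly once, in increasing order.
ValidPattern : ∀ {F n} → Term F (Fin n) → Set
ValidPattern {n = n} t = params t ≡ allFin n

------------------------------------------------------------------------
-- Tree straight-line programs

-- The alphabet F of terminals extended by m nonterminals of given ranks.
infixl 6 _⊕_
_⊕_ : (F : RankedAlphabet) {m : ℕ} → (Fin m → ℕ) → RankedAlphabet
_⊕_ F {m} nrank = record
  { Symbol = Symbol F ⊎ Fin m
  ; rank   = [ rank F , nrank ]′
  ; _≟_    = Sum.≡-dec (RankedAlphabet._≟_ F) Fin._≟_
  }

record TSLP (F : RankedAlphabet) : Set where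
  field
    #nonterminals : ℕ

  Nonterminal : Set
  Nonterminal = Fin #nonterminals

  field
    nrank      : Nonterminal → ℕ
    start      : Nonterminal
    start-rank : nrank start ≡ 0

  -- Trees over terminals, nonterminals and parameters from X.
  Mixed : Set → Set
  Mixed X = Term (F ⊕ nrank) X

  field
    rhs       : (A : Nonterminal) → Mixed (Fin (nrank A))
    rhs-valid : ∀ A → ValidPattern (rhs A)

  OccursInRhsOf : Nonterminal → Nonterminal → Set
  OccursInRhsOf B A = inj₂ B ∈ labels (rhs A)

  field
    acyclic : ∀ A → ¬ TransClosure OccursInRhsOf A A

module _ {F : RankedAlphabet} (G : TSLP F) where
  open TSLP G

  grammarSize : ℕ
  grammarSize = sum (List.map (λ A → size (rhs A)) (allFin #nonterminals))

  module _ {X : Set} where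

    terminalTerm  : Term F X → Mixed X
    terminalTerm* : ∀ {k} → Vec (Term F X) k → Vec (Mixed X) k
    terminalTerm (param x)   = param x
    terminalTerm (node f ts) = node (inj₁ f) (terminalTerm* ts)
    terminalTerm* []       = []
    terminalTerm* (t ∷ ts) = terminalTerm t ∷ terminalTerm* ts

    -- One rewriting step: some occurrence of a nonterminal is replaced by
    -- its right-hand side, with the arguments substituted for parameters.
    data Step : Mixed X → Mixed X → Set where
      replace : ∀ A ts → Step (node (inj₂ A) ts) (rhs A ⟪ Vec.lookup ts ⟫)
      inside  : ∀ s ts i {u} → Step (Vec.lookup ts i) u →
                Step (node s ts) (node s (ts [ i ]≔ u))

  -- val_G(A) = v: the nonterminal-free v is derived from A(x₁,…,xₙ).
  -- Rewriting with an acyclic set of rules, one per nonterminal, is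
  -- terminating and confluent, so v is unique.
  ValueOf : (A : Nonterminal) → Term F (Fin (nrank A)) → Set
  ValueOf A v = Star Step (node (inj₂ A) (tabulate param)) (terminalTerm v)

  -- val(G) = t.
  Produces : Tree F → Set
  Produces t = ValueOf start (subst (λ n → Term F (Fin n)) (sym start-rank) t)

  -- The two forms of right-hand sides in Chomsky normal form.  The only
  -- requirement on the variables here is to be at the right places; their
  -- order x₁,…,xₙ is enforced by rhs-valid.  In a binary rule, C stands at
  -- position i among the arguments of B (counted from zero).
  data NormalForm {X : Set} (t : Mixed X) : Set where
    terminal : ∀ f (xs : Vec X (rank F f)) →
               t ≡ node (inj₁ f) (Vec.map param xs) →
               NormalForm t
    binary   : ∀ B (i : Fin (nrank B)) C
               (ts : Vec (Mixed X) (nrank B)) (ys : Vec X (nrank C)) →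
               t ≡ node (inj₂ B) ts →
               Vec.lookup ts i ≡ node (inj₂ C) (Vec.map param ys) →
               (∀ j → j ≢ i → ∃ λ x → Vec.lookup ts j ≡ param x) →
               NormalForm t

  ChomskyNormalForm : Set
  ChomskyNormalForm = ∀ A → NormalForm (rhs A)

  module _ (cnf : ChomskyNormalForm) where

    mutual
      data DerivationTree (A : Nonterminal) : Set where
        expand : Children (cnf A) → DerivationTree A

      data Children {X : Set} {t : Mixed X} : NormalForm t → Set where
        leaf   : ∀ {f xs eq} → Children (terminal f xs eq)
        branch : ∀ {B i C ts ys eq eqᵢ eqⱼ} →
                 DerivationTree B → DerivationTree C →
                 Children (binary B i C ts ys eq eqᵢ eqⱼ)

    -- Number of edges on a longest path; the child of a node with a
    -- terminal rule is a leaf labelled by that terminal.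
    mutual
      treeDepth : ∀ {A} → DerivationTree A → ℕ
      treeDepth (expand c) = suc (childrenDepth c)

      childrenDepth : ∀ {X} {t : Mixed X} {nf : NormalForm t} → Children nf → ℕ
      childrenDepth leaf         = 0
      childrenDepth (branch b c) = treeDepth b ⊔ treeDepth c

    -- Every nonterminal of an acyclic grammar has exactly one derivation
    -- tree, so this says that depth(G) ≤ d.
    Depth≤ : ℕ → Set
    Depth≤ d = Σ (DerivationTree start) λ D → treeDepth D ≤ d

-- The requirements on G for the tree t and the rank bound r, with C as the
-- constant hidden in the O-notation.  Logarithms are rounded down; this is
-- harmless since they are only taken of numbers ≥ 2, where
-- ⌊log₂ x⌋ ≤ log₂ x ≤ 2 ⌊log₂ x⌋.
record SmallGrammarFor {F : RankedAlphabet} (C r : ℕ) (t : Tree F) (G : TSLP F) : Set where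
  open TSLP G
  n = size t
  σ = #labels t
  field
    cnf         : ChomskyNormalForm G
    produces    : Produces G t
    size-bound  : grammarSize G * ⌊log₂ n ⌋ ≤ C * (n * ⌊log₂ (σ + r) ⌋ * r * ⌊log₂ r ⌋)
    depth-bound : Depth≤ G cnf (C * (r * ⌊log₂ n ⌋))
    rank-bound  : ∀ A → nrank A ≤ r + 1

------------------------------------------------------------------------
-- Random access machines

-- RAM programs over finitely many registers (those mentioned in the
-- program) and an indirectly addressed memory.  Control flow is
-- structured; such programs translate to jumps with constant overhead.

Reg : Set
Reg = ℕ

data Op : Set where
  add monus mul div : Op

infixr 4 _⨾_
data Program : Set where
  const       : Reg → ℕ → Program                  -- x ≔ c
  arith       : Reg → Op → Reg → Reg → Program     -- x ≔ y ∘ z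
  load        : Reg → Reg → Program                -- x ≔ mem[y]
  store       : Reg → Reg → Program                -- mem[x] ≔ y
  skip        : Program
  _⨾_         : Program → Program → Program
  ifLess      : Reg → Reg → Program → Program → Program
  whileLess   : Reg → Reg → Program → Program

evalOp : Op → ℕ → ℕ → ℕ
evalOp add   a b       = a + b
evalOp monus a b       = a ∸ b
evalOp mul   a b       = a * b
evalOp div   a zero    = 0
evalOp div   a (suc b) = a / suc b

_[_↦_] : (ℕ → ℕ) → ℕ → ℕ → (ℕ → ℕ)
(f [ a ↦ v ]) b = if b ≡ᵇ a then v else f b

record State : Set where
  constructor ⟨_,_⟩
  field
    reg mem : ℕ → ℕ

-- Exec W P s T s′: started in s, the program P halts in s′ after exactly T
-- unit-cost instructions and tests, where every value written to a register
-- or to memory is below W.  Addresses are register contents, hence bounded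
-- as well.
data Exec (W : ℕ) : Program → State → ℕ → State → Set where
  const : ∀ {x c ρ μ} → c < W →
          Exec W (const x c) ⟨ ρ , μ ⟩ 1 ⟨ ρ [ x ↦ c ] , μ ⟩
  arith : ∀ {x o y z ρ μ} → evalOp o (ρ y) (ρ z) < W →
          Exec W (arith x o y z) ⟨ ρ , μ ⟩ 1 ⟨ ρ [ x ↦ evalOp o (ρ y) (ρ z) ] , μ ⟩
  load  : ∀ {x y ρ μ} → μ (ρ y) < W →
          Exec W (load x y) ⟨ ρ , μ ⟩ 1 ⟨ ρ [ x ↦ μ (ρ y) ] , μ ⟩
  store : ∀ {x y ρ μ} → ρ y < W →
          Exec W (store x y) ⟨ ρ , μ ⟩ 1 ⟨ ρ , μ [ ρ x ↦ ρ y ] ⟩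
  skip  : ∀ {s} → Exec W skip s 1 s
  _⨾_   : ∀ {P Q s s′ s″ T T′} → Exec W P s T s′ → Exec W Q s′ T′ s″ →
          Exec W (P ⨾ Q) s (T + T′) s″
  if-yes : ∀ {x y P Q s s′ T} → State.reg s x < State.reg s y →
           Exec W P s T s′ → Exec W (ifLess x y P Q) s (1 + T) s′
  if-no  : ∀ {x y P Q s s′ T} → ¬ State.reg s x < State.reg s y →
           Exec W Q s T s′ → Exec W (ifLess x y P Q) s (1 + T) s′
  while-yes : ∀ {x y P s s′ s″ T T′} → State.reg s x < State.reg s y →
              Exec W P s T s′ → Exec W (whileLess x y P) s′ T′ s″ →
              Exec W (whileLess x y P) s (1 + (T + T′)) s″
  while-no  : ∀ {x y P s} → ¬ State.reg s x < State.reg s y →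
              Exec W (whileLess x y P) s 1 s

contents : List ℕ → (ℕ → ℕ)
contents []       a       = 0
contents (v ∷ vs) zero    = v
contents (v ∷ vs) (suc a) = contents vs a

initialState : List ℕ → State
initialState input = ⟨ (λ _ → 0) , contents input ⟩

-- The list is found in memory from address 0 on.
HoldsOutput : State → List ℕ → Set
HoldsOutput s out = ∀ (i : Fin (length out)) → State.mem s (toℕ i) ≡ lookup out i

ComputesWithin : (W T : ℕ) → Program → List ℕ → List ℕ → Set
ComputesWithin W T P input output =
  ∃ λ T′ → ∃ λ s → T′ ≤ T × Exec W P (initialState input) T′ s × HoldsOutput s output

------------------------------------------------------------------------
-- Trees and grammars as data of the machine

module _ {F : RankedAlphabet} (code : Symbol F → ℕ) where

  -- The size, then the numbers and ranks of the labels in depth-first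
  -- left-to-right order.
  encodeTree : Tree F → List ℕ
  encodeTree t = size t ∷ concatMap (λ f → code f ∷ rank F f ∷ []) (labels t)

  module _ (G : TSLP F) where
    open TSLP G

    encodeRule : ∀ {X} {t : Mixed X} → NormalForm G t → List ℕ
    encodeRule (terminal f _ _)         = 0 ∷ code f ∷ []
    encodeRule (binary B i C _ _ _ _ _) = 1 ∷ toℕ B ∷ toℕ i ∷ toℕ C ∷ []

    encodeGrammar : ChomskyNormalForm G → List ℕ
    encodeGrammar cnf =
      #nonterminals ∷ toℕ start ∷
      concatMap (λ A → nrank A ∷ encodeRule (cnf A)) (allFin #nonterminals)

-- A representation of the labels of t by distinct numbers of at most
-- O(log n) bits, n = size t; k is the factor hidden in this O.
record LabelCode {F : RankedAlphabet} (k : ℕ) (t : Tree F) (code : Symbol F → ℕ) : Set where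
  field
    injective : ∀ {f g} → f ∈ labels t → g ∈ labels t → code f ≡ code g → f ≡ g
    bounded   : ∀ {f} → f ∈ labels t → code f ≤ size t ^ k

-- The tree is contracted in rounds.  Its nodes are clusters, labelled by
-- nonterminals; in a round every cluster absorbs some of its children one after
-- the other, and each absorption is a rule of the form B(…C(…)…).  With N the
-- current number of clusters, n the size of the tree, R the largest rank (at
-- least 2) and K = (8 + 4R) n, a child is absorbed if it has not absorbed
-- anything itself in this round, the result has rank at most R, and both
-- weights (numbers of terminals) are below K / N.  At most N / (8 + 4R)
-- clusters are heavier than that, and then at least N / 8 clusters are absorbed:
-- there are O(log n) rounds, the depth grows by at most R in each of them, and
-- the total time is linear.  Equal rules are identified by hashing, so that
-- nonterminals correspond to different derivation trees.  Written in Polish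
-- notation, at most (σ + R + 1)^(2m) of those have at most m leaves.
-- Heavier nonterminals arise only once N < 2K / m, hence there are at most
-- 2K / m of them, and m is chosen proportional to log n / log (σ + r).
module Submission where

open import Defs
open import Data.Bool using (Bool; true; false; T; if_then_else_; _∧_)
open import Data.Empty using (⊥)
open import Data.Fin using (Fin; toℕ; fromℕ<; zero; suc)
open import Data.Fin.Properties using (toℕ-fromℕ<; toℕ-injective; toℕ<n; injective⇒≤)
open import Data.List using (List; []; _∷_; _++_; length; map; concatMap; take; drop; filter; allFin; deduplicate)
import Data.List as List
open import Data.List.Membership.Propositional using (_∈_)
open import Data.List.Membership.Propositional.Properties using (∈-deduplicate⁺; ∈-lookup)
open import Data.List.Properties using (length-++; length-map; length-take; length-drop; length-tabulate; take++drop≡id; map-++; map-∘; map-tabulate; tabulate-cong; tabulate-lookup; ++-assoc; ++-identityʳ; concatMap-++; filter-accept; filter-reject; ∷-injectiveˡ; ∷-injectiveʳ)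
open import Data.List.Relation.Unary.All using (All; []; _∷_)
import Data.List.Relation.Unary.All as All
import Data.List.Relation.Unary.All.Properties as All
open import Data.List.Relation.Unary.AllPairs using ([]; _∷_)
open import Data.List.Relation.Unary.Any using (here; there)
open import Data.List.Relation.Unary.Unique.Propositional using (Unique)
import Data.List.Relation.Unary.Unique.Propositional.Properties as Unique
open import Data.Nat
open import Data.Nat.DivMod using (m≡m%n+[m/n]*n; m%n<n; m/n*n≤m; m/n≤m; m<n⇒m%n≡m; [m+kn]%n≡m%n)
open import Data.Nat.Induction using (<-rec)
open import Data.Nat.ListAction using (sum)
open import Data.Nat.Logarithm using (⌊log₂_⌋; ⌊log₂⌋-mono-≤; ⌊log₂[2^n]⌋≡n; ⌊log₂⌊n/2⌋⌋≡⌊log₂n⌋∸1)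
open import Data.Nat.Properties
open import Data.Nat.Tactic.RingSolver using (solve-∀)
open import Data.Product using (Σ; ∃; ∃₂; _×_; _,_; proj₁; proj₂)
open import Data.Sum using (_⊎_; inj₁; inj₂)
open import Data.Unit using (⊤; tt)
open import Data.Vec using (Vec; []; _∷_; toList; fromList; lookup; tabulate; _[_]≔_)
import Data.Vec as Vec
open import Data.Vec.Properties using (toList∘fromList; toList-map)
open import Relation.Binary.Construct.Closure.ReflexiveTransitive using (Star; ε; _◅_; _◅◅_; gmap)
open import Relation.Binary.Construct.Closure.Transitive using (TransClosure; [_]; _∷_)
open import Relation.Binary.PropositionalEquality using (_≡_; _≢_; refl; sym; trans; cong; cong₂; subst; subst₂; ≢-sym)
open import Relation.Nullary using (¬_; Dec; yes; no; contradiction)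

-- The rank condition is harmless where it matters: a child of rank 0 never raises the rank, and a
-- head of rank 1 only takes over the rank of its child. So a leaf, or the only child of a unary
-- cluster, is absorbed unless it is busy or one of the two clusters is big. Leaves outnumber
-- branching nodes, hence leaves and unary nodes are more than half of the tree. A big cluster can
-- spoil up to R leaves below it and is charged 2R + 4 in all; K is chosen such that these charges
-- sum up to at most N / 2. An absorbed cluster has been idle, so its depth is that from before the
-- round: this is why the depth grows by R and not by the height of the tree. The weight limit
-- depends on N so that a single run serves every m. Two things keep all numbers polynomial in n: R
-- is the largest rank that occurs (or 2), hence at most n whatever r is, and hashing is direct
-- addressing, with three digits in base 2n as the key, in a memory that is zero at the start. The
-- tree is kept as the preorder sequence of its clusters, where an absorption just deletes one
-- position.

bit : Bool → ℕ
bit false = 0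
bit true  = 1

-- Tables of rules

module Clusters (F : RankedAlphabet) where

  data Rule : Set where
    term : Symbol F → Rule
    comp : (B i C : ℕ) → Rule

  -- A rule together with the rank, the number of terminals and the depth of
  -- what is derived from it.
  record Entry : Set where
    constructor entry
    field
      rule     : Rule
      rk wt dp : ℕ
  open Entry public

  Table : Set
  Table = List Entry

  leafEntry : Symbol F → Entry
  leafEntry f = entry (term f) (rank F f) 1 1

  -- `x` and `c` are the numbers of `e` and `d` in the table. The `∸ 1` stands for the parameter of
  -- `e` that `d` fills.
  combine : ℕ → Entry → ℕ → ℕ → Entry → Entry
  combine x e i c d = entry (comp x i c) (rk e + rk d ∸ 1) (wt e + wt d) (suc (dp e ⊔ dp d))

  data At : Table → ℕ → Entry → Set where
    here  : ∀ {T e} → At (e ∷ T) 0 e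
    there : ∀ {T a d e} → At T a e → At (d ∷ T) (suc a) e

  infix 4 _⊑_
  _⊑_ : Table → Table → Set
  T ⊑ U = ∀ {a e} → At T a e → At U a e

  At-functional : ∀ {T a d e} → At T a d → At T a e → d ≡ e
  At-functional here      here      = refl
  At-functional (there p) (there q) = At-functional p q

  At-++ : ∀ {T U} → T ⊑ T ++ U
  At-++ here      = here
  At-++ (there p) = there (At-++ p)

  At-last : ∀ T {e} → At (T ++ e ∷ []) (length T) e
  At-last []      = here
  At-last (d ∷ T) = there (At-last T)

  At-< : ∀ {T a e} → At T a e → a < length T
  At-< here      = s≤s z≤n
  At-< (there p) = s≤s (At-< p)

  At-lookup : ∀ T A → At T (toℕ A) (List.lookup T A)
  At-lookup (e ∷ T) zero    = here
  At-lookup (e ∷ T) (suc A) = there (At-lookup T A)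

  At-snoc⁻ : ∀ T {a d e} → At (T ++ d ∷ []) a e → At T a e ⊎ a ≡ length T × e ≡ d
  At-snoc⁻ []      here      = inj₂ (refl , refl)
  At-snoc⁻ (_ ∷ T) here      = inj₁ here
  At-snoc⁻ (_ ∷ T) (there p) with At-snoc⁻ T p
  ... | inj₁ q           = inj₁ (there q)
  ... | inj₂ (refl , eq) = inj₂ (refl , eq)

  Fresh : Table → Rule → Set
  Fresh T ρ = ∀ a e → At T a e → rule e ≢ ρ

  data Valid (fs : List (Symbol F)) (T : Table) : ℕ → Entry → Set where
    term : ∀ {a f} → f ∈ fs → Valid fs T a (leafEntry f)
    comp : ∀ {a x e i c d} → At T x e → At T c d → x < a → c < a → i < rk e →
           Valid fs T a (combine x e i c d)

  -- Entries refer to earlier ones only, which makes the grammar acyclic. No rule occurs twice, so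
  -- that different entries have different derivation trees; the counting of light entries rests on
  -- this.
  data OK (fs : List (Symbol F)) (R : ℕ) : Table → Set where
    []   : OK fs R []
    snoc : ∀ {T e} → OK fs R T → Valid fs T (length T) e → Fresh T (rule e) → rk e ≤ R → OK fs R (T ++ e ∷ [])

  Valid-mono : ∀ {fs T U a e} → T ⊑ U → Valid fs T a e → Valid fs U a e
  Valid-mono ⊑₀ (term f∈)          = term f∈
  Valid-mono ⊑₀ (comp p q x< c< i<) = comp (⊑₀ p) (⊑₀ q) x< c< i<

  module _ {fs : List (Symbol F)} {R : ℕ} where

    OK-valid : ∀ {T a e} → OK fs R T → At T a e → Valid fs T a e
    OK-valid (snoc {T} ok v fr r) p with At-snoc⁻ T p
    ... | inj₁ q             = Valid-mono At-++ (OK-valid ok q)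
    ... | inj₂ (refl , refl) = Valid-mono At-++ v

    OK-rank : ∀ {T a e} → OK fs R T → At T a e → rk e ≤ R
    OK-rank (snoc {T} ok v fr r) p with At-snoc⁻ T p
    ... | inj₁ q             = OK-rank ok q
    ... | inj₂ (refl , refl) = r

    OK-unique : ∀ {T a b d e} → OK fs R T → At T a d → At T b e → rule d ≡ rule e → a ≡ b
    OK-unique (snoc {T} ok v fr r) p q eq with At-snoc⁻ T p | At-snoc⁻ T q
    ... | inj₁ p′            | inj₁ q′            = OK-unique ok p′ q′ eq
    ... | inj₁ p′            | inj₂ (_ , refl)    = contradiction eq (fr _ _ p′)
    ... | inj₂ (_ , refl)    | inj₁ q′            = contradiction (sym eq) (fr _ _ q′)
    ... | inj₂ (eqa , _)     | inj₂ (eqb , _)     = trans eqa (sym eqb)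

    OK-leaf : ∀ {T a e f} → OK fs R T → At T a e → rule e ≡ term f → e ≡ leafEntry f
    OK-leaf ok p eq with OK-valid ok p
    OK-leaf ok p refl | term _ = refl

    -- Rank, weight and depth are functions of the rule. Hence an entry that is found by its rule
    -- alone is the one that would otherwise have been added.
    OK-combine : ∀ {T a x e i c d f} → OK fs R T → At T a f → rule f ≡ comp x i c → At T x e → At T c d →
                 f ≡ combine x e i c d
    OK-combine ok p refl q r with OK-valid ok p
    ... | comp q′ r′ _ _ _ with refl ← At-functional q q′ | refl ← At-functional r r′ = refl

  -- The children of a cluster are attached to its parameters.
  data Rose : Set where
    tree : ℕ → Entry → List Rose → Rose

  root : Rose → ℕ
  root (tree x e ts) = x

  rootEntry : Rose → Entry
  rootEntry (tree x e ts) = e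

  flat  : Rose → List ℕ
  flat* : List Rose → List ℕ
  flat (tree x e ts) = x ∷ flat* ts
  flat* []       = []
  flat* (t ∷ ts) = flat t ++ flat* ts

  count  : Rose → ℕ
  count* : List Rose → ℕ
  count (tree x e ts) = suc (count* ts)
  count* []       = 0
  count* (t ∷ ts) = count t + count* ts

  total  : (Entry → ℕ) → Rose → ℕ
  total* : (Entry → ℕ) → List Rose → ℕ
  total w (tree x e ts) = w e + total* w ts
  total* w []       = 0
  total* w (t ∷ ts) = total w t + total* w ts

  flat*-++ : ∀ ts us → flat* (ts ++ us) ≡ flat* ts ++ flat* us
  flat*-++ []       us = refl
  flat*-++ (t ∷ ts) us = trans (cong (flat t ++_) (flat*-++ ts us)) (sym (++-assoc (flat t) (flat* ts) (flat* us)))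

  count*-++ : ∀ ts us → count* (ts ++ us) ≡ count* ts + count* us
  count*-++ []       us = refl
  count*-++ (t ∷ ts) us = trans (cong (count t +_) (count*-++ ts us)) (sym (+-assoc (count t) _ _))

  total*-++ : ∀ w ts us → total* w (ts ++ us) ≡ total* w ts + total* w us
  total*-++ w []       us = refl
  total*-++ w (t ∷ ts) us = trans (cong (total w t +_) (total*-++ w ts us)) (sym (+-assoc (total w t) _ _))

  length-flat  : ∀ t → length (flat t) ≡ count t
  length-flat* : ∀ ts → length (flat* ts) ≡ count* ts
  length-flat (tree x e ts) = cong suc (length-flat* ts)
  length-flat* []       = refl
  length-flat* (t ∷ ts) = trans (length-++ (flat t)) (cong₂ _+_ (length-flat t) (length-flat* ts))

  data Wf (T : Table) (D : ℕ) : Rose → Set where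
    wf : ∀ {x e ts} → At T x e → length ts ≡ rk e → dp e ≤ D → All (Wf T D) ts → Wf T D (tree x e ts)

  Wf-mono  : ∀ {T U D E t} → T ⊑ U → D ≤ E → Wf T D t → Wf U E t
  Wf-mono* : ∀ {T U D E ts} → T ⊑ U → D ≤ E → All (Wf T D) ts → All (Wf U E) ts
  Wf-mono ⊑₀ D≤E (wf p l d ws) = wf (⊑₀ p) l (≤-trans d D≤E) (Wf-mono* ⊑₀ D≤E ws)
  Wf-mono* ⊑₀ D≤E []       = []
  Wf-mono* ⊑₀ D≤E (w ∷ ws) = Wf-mono ⊑₀ D≤E w ∷ Wf-mono* ⊑₀ D≤E ws

  infix 4 _⊢_⟶_ _⊢_⟶*_ _⊢_⟶**_

  -- `split` undoes an absorption. It is the rewriting step that replaces `y` by its right-hand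
  -- side, seen on cluster trees: `us`, `cs` and `vs` are the arguments left of, inside and right of
  -- the inner nonterminal.
  data _⊢_⟶_ (T : Table) : Rose → Rose → Set where
    split  : ∀ {y f x e c d} us cs vs → At T y f → rule f ≡ comp x (length us) c → At T x e → At T c d →
             length cs ≡ rk d →
             T ⊢ tree y f (us ++ cs ++ vs) ⟶ tree x e (us ++ tree c d cs ∷ vs)
    inside : ∀ {x e t u} us vs → T ⊢ t ⟶ u → T ⊢ tree x e (us ++ t ∷ vs) ⟶ tree x e (us ++ u ∷ vs)

  _⊢_⟶*_ : Table → Rose → Rose → Set
  T ⊢ t ⟶* u = Star (T ⊢_⟶_) t u

  ⟶-mono : ∀ {T U t u} → T ⊑ U → T ⊢ t ⟶ u → U ⊢ t ⟶ u
  ⟶-mono ⊑₀ (split us cs vs p eq q r l) = split us cs vs (⊑₀ p) eq (⊑₀ q) (⊑₀ r) l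
  ⟶-mono ⊑₀ (inside us vs s)            = inside us vs (⟶-mono ⊑₀ s)

  ⟶*-mono : ∀ {T U t u} → T ⊑ U → T ⊢ t ⟶* u → U ⊢ t ⟶* u
  ⟶*-mono ⊑₀ = gmap (λ t → t) (⟶-mono ⊑₀)

  data _⊢_⟶**_ (T : Table) : List Rose → List Rose → Set where
    []  : T ⊢ [] ⟶** []
    _∷_ : ∀ {t u ts us} → T ⊢ t ⟶* u → T ⊢ ts ⟶** us → T ⊢ t ∷ ts ⟶** u ∷ us

  ⟶**-mono : ∀ {T U ts us} → T ⊑ U → T ⊢ ts ⟶** us → U ⊢ ts ⟶** us
  ⟶**-mono ⊑₀ []       = []
  ⟶**-mono ⊑₀ (s ∷ ss) = ⟶*-mono ⊑₀ s ∷ ⟶**-mono ⊑₀ ss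

  ⟶-children : ∀ {T x e ts us} vs → T ⊢ ts ⟶** us → T ⊢ tree x e (vs ++ ts) ⟶* tree x e (vs ++ us)
  ⟶-children vs [] = ε
  ⟶-children {T} {x} {e} vs (_∷_ {t} {u} {ts} {us} s ss) =
    gmap (λ v → tree x e (vs ++ v ∷ ts)) (inside vs ts) s ◅◅
    subst₂ (T ⊢_⟶*_) (cong (tree x e) (++-assoc vs (u ∷ []) ts)) (cong (tree x e) (++-assoc vs (u ∷ []) us))
      (⟶-children (vs ++ u ∷ []) ss)

  -- The effect of a look-up that adds what is missing. As a relation it keeps the hash table of the
  -- machine out of the combinatorial analysis.
  data Intern (T : Table) (e : Entry) : ℕ → Table → Set where
    found : ∀ {a} → At T a e → Intern T e a T
    added : Fresh T (rule e) → Intern T e (length T) (T ++ e ∷ [])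

  Intern-⊑ : ∀ {T e a U} → Intern T e a U → T ⊑ U
  Intern-⊑ (found p) = λ q → q
  Intern-⊑ (added _) = At-++

  Intern-At : ∀ {T e a U} → Intern T e a U → At U a e
  Intern-At (found p)     = p
  Intern-At {T} (added _) = At-last T

  Intern-OK : ∀ {fs R T e a U} → OK fs R T → Valid fs T (length T) e → rk e ≤ R → Intern T e a U → OK fs R U
  Intern-OK ok v r (found p) = ok
  Intern-OK ok v r (added f) = snoc ok v f r

  heavy : ℕ → Table → ℕ
  heavy m []      = 0
  heavy m (e ∷ T) = bit (m <ᵇ wt e) + heavy m T

  heavy-snoc : ∀ m T e → heavy m (T ++ e ∷ []) ≡ heavy m T + bit (m <ᵇ wt e)
  heavy-snoc m []      e = +-identityʳ _
  heavy-snoc m (d ∷ T) e = trans (cong (bit (m <ᵇ wt d) +_) (heavy-snoc m T e)) (sym (+-assoc (bit (m <ᵇ wt d)) _ _))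

  -- Contraction of trees of clusters

  -- R bounds the ranks; clusters of weight at least K / N are big.
  module Contraction (fs : List (Symbol F)) (R N K : ℕ) where

    -- The flag tells whether the cluster has absorbed something in this round.
    record Head : Set where
      constructor head
      field
        hid   : ℕ
        hent  : Entry
        hflag : Bool
        hkids : List Rose
    open Head public

    data Refusal (e : Entry) (flag : Bool) (d : Entry) : Set where
      busy     : flag ≡ true → Refusal e flag d
      high     : suc R < rk e + rk d → Refusal e flag d
      bigHead  : K ≤ wt e * N → Refusal e flag d
      bigChild : K ≤ wt d * N → Refusal e flag d

    -- `hkids` collects the children already dealt with, so its length is the parameter position of
    -- the next child. The children of an absorbed cluster go there at once and are not offered to
    -- the head in this round.
    data Absorb : Table → Head → List (Bool × Rose) → Table → Head → ℕ → Set where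
      done   : ∀ {T h} → Absorb T h [] T h 0
      absorb : ∀ {T x e fl ts c d us rs y T₁ T₂ h a} → rk e + rk d ≤ suc R → wt e * N < K → wt d * N < K →
               Intern T (combine x e (length ts) c d) y T₁ →
               Absorb T₁ (head y (combine x e (length ts) c d) true (ts ++ us)) rs T₂ h a →
               Absorb T (head x e fl ts) ((false , tree c d us) ∷ rs) T₂ h (suc a)
      keep   : ∀ {T x e fl ts flag c d us rs T₁ h a} → Refusal e flag d →
               Absorb T (head x e fl (ts ++ tree c d us ∷ [])) rs T₁ h a →
               Absorb T (head x e fl ts) ((flag , tree c d us) ∷ rs) T₁ h a

    -- The last index is the number of absorbed clusters.
    data Contract  : Table → Rose → Table → Bool × Rose → ℕ → Set
    data Contract* : Table → List Rose → Table → List (Bool × Rose) → ℕ → Set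
    data Contract where
      contract : ∀ {T x e ts T₁ rs a T₂ h b} → Contract* T ts T₁ rs a → Absorb T₁ (head x e false []) rs T₂ h b →
                 Contract T (tree x e ts) T₂ (hflag h , tree (hid h) (hent h) (hkids h)) (a + b)
    data Contract* where
      []  : ∀ {T} → Contract* T [] T [] 0
      -- The table passes through the tail first because the machine scans the preorder from its
      -- right end.
      _∷_ : ∀ {T t ts T₁ rs a T₂ r b} → Contract T₁ t T₂ r b → Contract* T ts T₁ rs a →
            Contract* T (t ∷ ts) T₂ (r ∷ rs) (a + b)

    trees : List (Bool × Rose) → List Rose
    trees = map proj₂

    Contract*-length : ∀ {T ts T₁ rs a} → Contract* T ts T₁ rs a → length rs ≡ length ts
    Contract*-length []       = refl
    Contract*-length (c ∷ cs) = cong suc (Contract*-length cs)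

    -- `D` bounds the depths before the round and `E` those after it; `β` bounds the head at the
    -- moment, with `m` children still to come. Each of them raises `β` by at most one, since an
    -- idle child has depth at most `D ≤ β`. Starting with `β = D` and at most `R` children,
    -- `E = D + R` suffices.
    record HeadInv (T : Table) (D E β m : ℕ) (h : Head) : Set where
      field
        at     : At T (hid h) (hent h)
        arity  : length (hkids h) + m ≡ rk (hent h)
        depth  : dp (hent h) ≤ β
        D≤β    : D ≤ β
        β≤E    : β + m ≤ E
        kids   : All (Wf T E) (hkids h)
        idle   : hflag h ≡ false → dp (hent h) ≤ D

    ResultInv : Table → ℕ → ℕ → Bool × Rose → Set
    ResultInv T D E (flag , t) = Wf T E t × (flag ≡ false → dp (rootEntry t) ≤ D)

    ResultInv-mono : ∀ {T U D E rs} → T ⊑ U → All (ResultInv T D E) rs → All (ResultInv U D E) rs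
    ResultInv-mono ⊑₀ []             = []
    ResultInv-mono ⊑₀ ((w , i) ∷ ws) = (Wf-mono ⊑₀ ≤-refl w , i) ∷ ResultInv-mono ⊑₀ ws

    combined-arity : ∀ (ts us : List Rose) {k l m} → length ts + suc m ≡ k → length us ≡ l → length (ts ++ us) + m ≡ k + l ∸ 1
    combined-arity ts us {m = m} refl refl rewrite length-++ ts {us} | +-suc (length ts) m =
      rearrange (length ts) (length us) m
      where
      rearrange : ∀ a b c → a + b + c ≡ a + c + b
      rearrange = solve-∀

    HeadInv-valid : ∀ {T D E β m x e fl ts c d us} → HeadInv T D E β (suc m) (head x e fl ts) → Wf T E (tree c d us) →
                Valid fs T (length T) (combine x e (length ts) c d)
    HeadInv-valid {m = m} {ts = ts} hi (wf p _ _ _) = comp (HeadInv.at hi) p (At-< (HeadInv.at hi)) (At-< p)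
      (≤-trans (m≤m+n _ m) (≤-reflexive (trans (sym (+-suc (length ts) m)) (HeadInv.arity hi))))

    HeadInv-start : ∀ {T D x e m} → OK fs R T → At T x e → m ≡ rk e → dp e ≤ D →
                    HeadInv T D (D + R) D m (head x e false [])
    HeadInv-start {D = D} ok p l dd = record
      { at    = p
      ; arity = l
      ; depth = dd
      ; D≤β   = ≤-refl
      ; β≤E   = +-monoʳ-≤ D (≤-trans (≤-reflexive l) (OK-rank ok p))
      ; kids  = []
      ; idle  = λ _ → dd
      }

    HeadInv-absorb : ∀ {T D E β m x e fl ts c d us y T₁} → HeadInv T D E β (suc m) (head x e fl ts) →
      ResultInv T D E (false , tree c d us) → Intern T (combine x e (length ts) c d) y T₁ →
      HeadInv T₁ D E (suc β) m (head y (combine x e (length ts) c d) true (ts ++ us))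
    HeadInv-absorb {β = β} {ts = ts} {us = us} hi (wf p l _ ws , idle) int = record
      { at    = Intern-At int
      ; arity = combined-arity ts us (HeadInv.arity hi) l
      ; depth = s≤s (⊔-lub (HeadInv.depth hi) (≤-trans (idle refl) (HeadInv.D≤β hi)))
      ; D≤β   = m≤n⇒m≤1+n (HeadInv.D≤β hi)
      ; β≤E   = ≤-trans (≤-reflexive (sym (+-suc β _))) (HeadInv.β≤E hi)
      ; kids  = All.++⁺ (Wf-mono* (Intern-⊑ int) ≤-refl (HeadInv.kids hi)) (Wf-mono* (Intern-⊑ int) ≤-refl ws)
      ; idle  = λ ()
      }

    HeadInv-keep : ∀ {T D E β m x e fl ts t} → HeadInv T D E β (suc m) (head x e fl ts) → Wf T E t →
      HeadInv T D E β m (head x e fl (ts ++ t ∷ []))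
    HeadInv-keep {m = m} {ts = ts} hi w = record
      { at    = HeadInv.at hi
      ; arity = trans (cong (_+ m) (length-++ ts)) (trans (+-assoc (length ts) 1 m) (HeadInv.arity hi))
      ; depth = HeadInv.depth hi
      ; D≤β   = HeadInv.D≤β hi
      ; β≤E   = ≤-trans (+-monoʳ-≤ _ (n≤1+n _)) (HeadInv.β≤E hi)
      ; kids  = All.++⁺ (HeadInv.kids hi) (w ∷ [])
      ; idle  = HeadInv.idle hi
      }

    Absorb-inv : ∀ {T D E β h rs T′ h′ a} → OK fs R T → HeadInv T D E β (length rs) h → All (ResultInv T D E) rs →
                 Absorb T h rs T′ h′ a →
                 OK fs R T′ × T ⊑ T′ × ∃ λ β′ → HeadInv T′ D E β′ 0 h′
    Absorb-inv {β = β} ok hi [] done = ok , (λ p → p) , β , hi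
    Absorb-inv ok hi (ri ∷ ris) (absorb r _ _ int abs)
      with ok′ , ⊑₀ , rest ← Absorb-inv (Intern-OK ok (HeadInv-valid hi (proj₁ ri)) (∸-monoˡ-≤ 1 r) int)
             (HeadInv-absorb hi ri int) (ResultInv-mono (Intern-⊑ int) ris) abs
      = ok′ , (λ q → ⊑₀ (Intern-⊑ int q)) , rest
    Absorb-inv ok hi (ri ∷ ris) (keep _ abs) = Absorb-inv ok (HeadInv-keep hi (proj₁ ri)) ris abs

    Contract-inv  : ∀ {T D t T′ r a} → OK fs R T → Wf T D t → Contract T t T′ r a →
                    OK fs R T′ × T ⊑ T′ × ResultInv T′ D (D + R) r
    Contract-inv* : ∀ {T D ts T′ rs a} → OK fs R T → All (Wf T D) ts → Contract* T ts T′ rs a →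
                    OK fs R T′ × T ⊑ T′ × All (ResultInv T′ D (D + R)) rs
    Contract-inv {D = D} {t = tree x e ts} ok (wf p l dd ws) (contract {rs = rs} cs abs)
      with ok₁ , ⊑₁ , ris ← Contract-inv* ok ws cs
      with ok₂ , ⊑₂ , β , hi ← Absorb-inv ok₁ (HeadInv-start ok₁ (⊑₁ p) (trans (Contract*-length cs) l) dd) ris abs
      = ok₂ , (λ q → ⊑₂ (⊑₁ q)) ,
        wf (HeadInv.at hi) (trans (sym (+-identityʳ _)) (HeadInv.arity hi))
           (≤-trans (HeadInv.depth hi) (≤-trans (m≤m+n β 0) (HeadInv.β≤E hi))) (HeadInv.kids hi) , HeadInv.idle hi
    Contract-inv* ok [] [] = ok , (λ p → p) , []
    Contract-inv* ok (w ∷ ws) (c ∷ cs)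
      with ok₁ , ⊑₁ , ris ← Contract-inv* ok ws cs
      with ok₂ , ⊑₂ , ri ← Contract-inv ok₁ (Wf-mono ⊑₁ ≤-refl w) c
      = ok₂ , (λ q → ⊑₂ (⊑₁ q)) , ri ∷ ResultInv-mono ⊑₂ ris

-- One round of contraction: undoing it, weights, number of absorptions

module Analysis (F : RankedAlphabet) (fs : List (Symbol F)) (R N K : ℕ) where
  open Clusters F
  open Contraction fs R N K

  headTree : Head → Rose
  headTree h = tree (hid h) (hent h) (hkids h)

  Absorb-⊑ : ∀ {T h rs T′ h′ a} → Absorb T h rs T′ h′ a → T ⊑ T′
  Absorb-⊑ done                     = λ p → p
  Absorb-⊑ (absorb _ _ _ int abs) = λ p → Absorb-⊑ abs (Intern-⊑ int p)
  Absorb-⊑ (keep _ abs)           = Absorb-⊑ abs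

  results-wf : ∀ {T D E rs} → All (ResultInv T D E) rs → All (Wf T E) (trees rs)
  results-wf []             = []
  results-wf ((w , _) ∷ ws) = w ∷ results-wf ws

  Absorb-steps : ∀ {T E h rs T′ h′ a} → At T (hid h) (hent h) → All (Wf T E) (trees rs) → Absorb T h rs T′ h′ a →
                 T′ ⊢ headTree h′ ⟶* tree (hid h) (hent h) (hkids h ++ trees rs)
  Absorb-steps {h = head x e fl ts} p [] done =
    subst (λ us → _ ⊢ tree x e ts ⟶* tree x e us) (sym (++-identityʳ ts)) ε
  Absorb-steps {h = head x e fl ts} {rs = _ ∷ rs} p (wf q l _ _ ∷ ws) (absorb {d = d} {us = us} {y = y} _ _ _ int abs) =
    subst (λ vs → _ ⊢ _ ⟶* tree y _ vs) (++-assoc ts us (trees rs))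
      (Absorb-steps (Intern-At int) (Wf-mono* (Intern-⊑ int) ≤-refl ws) abs) ◅◅
    split ts us (trees rs) (Absorb-⊑ abs (Intern-At int)) refl
      (Absorb-⊑ abs (Intern-⊑ int p)) (Absorb-⊑ abs (Intern-⊑ int q)) l ◅ ε
  Absorb-steps {h = head x e fl ts} {rs = _ ∷ rs} p (w ∷ ws) (keep _ abs) =
    subst (λ vs → _ ⊢ _ ⟶* tree x e vs) (++-assoc ts (_ ∷ []) (trees rs)) (Absorb-steps p ws abs)

  Contract-steps  : ∀ {T D t T′ r a} → OK fs R T → Wf T D t → Contract T t T′ r a → T′ ⊢ proj₂ r ⟶* t
  Contract*-steps : ∀ {T D ts T′ rs a} → OK fs R T → All (Wf T D) ts → Contract* T ts T′ rs a → T′ ⊢ trees rs ⟶** ts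
  Contract-steps ok (wf p l dd ws) (contract cs abs)
    with ok₁ , ⊑₁ , ris ← Contract-inv* ok ws cs =
    Absorb-steps (⊑₁ p) (results-wf ris) abs ◅◅
    ⟶-children [] (⟶**-mono (Absorb-⊑ abs) (Contract*-steps ok ws cs))
  Contract*-steps ok [] [] = []
  Contract*-steps ok (w ∷ ws) (c ∷ cs)
    with ok₁ , ⊑₁ , ris ← Contract-inv* ok ws cs
    with ok₂ , ⊑₂ , ri ← Contract-inv ok₁ (Wf-mono ⊑₁ ≤-refl w) c =
    Contract-steps ok₁ (Wf-mono ⊑₁ ≤-refl w) c ∷ ⟶**-mono ⊑₂ (Contract*-steps ok ws cs)

  Absorb-count : ∀ {T h rs T′ h′ a} → Absorb T h rs T′ h′ a →
                 count* (hkids h′) + a ≡ count* (hkids h) + count* (trees rs)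
  Absorb-count done = refl
  Absorb-count {h = head _ _ _ ts} {rs = _ ∷ rs} {a = suc a} (absorb {us = us} _ _ _ _ abs) =
    trans (+-suc _ a) (trans (cong suc (trans (Absorb-count abs) (cong (_+ count* (trees rs)) (count*-++ ts us))))
      (rearrange (count* ts) (count* us) (count* (trees rs))))
    where
    rearrange : ∀ x y z → suc (x + y + z) ≡ x + suc (y + z)
    rearrange = solve-∀
  Absorb-count {h = head _ _ _ ts} {rs = _ ∷ rs} (keep {c = c} {d} {us} _ abs) =
    trans (Absorb-count abs) (trans (cong (_+ count* (trees rs)) (count*-++ ts (tree c d us ∷ [])))
      (rearrange (count* ts) (count* us) (count* (trees rs))))
    where
    rearrange : ∀ x y z → x + (suc y + 0) + z ≡ x + suc (y + z)
    rearrange = solve-∀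

  Contract-count  : ∀ {T t T′ r a} → Contract T t T′ r a → count (proj₂ r) + a ≡ count t
  Contract*-count : ∀ {T ts T′ rs a} → Contract* T ts T′ rs a → count* (trees rs) + a ≡ count* ts
  Contract-count (contract {rs = rs} {a} {h = h} {b} cs abs) = cong suc (trans (rearrange (count* (hkids h)) a b)
    (trans (cong (_+ a) (Absorb-count abs)) (Contract*-count cs)))
    where
    rearrange : ∀ x y z → x + (y + z) ≡ x + z + y
    rearrange = solve-∀
  Contract*-count [] = refl
  Contract*-count (_∷_ {rs = rs} {a} {r = r} {b} c cs) =
    trans (rearrange (count (proj₂ r)) (count* (trees rs)) a b) (cong₂ _+_ (Contract-count c) (Contract*-count cs))
    where
    rearrange : ∀ x y z w → x + y + (z + w) ≡ x + w + (y + z)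
    rearrange = solve-∀

  Absorb-weight : ∀ {T h rs T′ h′ a} → Absorb T h rs T′ h′ a →
                  wt (hent h′) + total* wt (hkids h′) ≡ wt (hent h) + (total* wt (hkids h) + total* wt (trees rs))
  Absorb-weight {h = h} done = cong (wt (hent h) +_) (sym (+-identityʳ _))
  Absorb-weight {h = head _ e _ ts} {rs = _ ∷ rs} (absorb {d = d} {us = us} _ _ _ _ abs) =
    trans (Absorb-weight abs) (trans (cong (λ w → wt e + wt d + (w + total* wt (trees rs))) (total*-++ wt ts us))
      (rearrange (wt e) (wt d) (total* wt ts) (total* wt us) (total* wt (trees rs))))
    where
    rearrange : ∀ x y z u v → x + y + (z + u + v) ≡ x + (z + (y + u + v))
    rearrange = solve-∀
  Absorb-weight {h = head _ e _ ts} {rs = _ ∷ rs} (keep {c = c} {d} {us} _ abs) =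
    trans (Absorb-weight abs) (trans (cong (λ w → wt e + (w + total* wt (trees rs))) (total*-++ wt ts (tree c d us ∷ [])))
      (rearrange (wt e) (wt d) (total* wt ts) (total* wt us) (total* wt (trees rs))))
    where
    rearrange : ∀ x y z u v → x + (z + (y + u + 0) + v) ≡ x + (z + (y + u + v))
    rearrange = solve-∀

  Contract-weight  : ∀ {T t T′ r a} → Contract T t T′ r a → total wt (proj₂ r) ≡ total wt t
  Contract*-weight : ∀ {T ts T′ rs a} → Contract* T ts T′ rs a → total* wt (trees rs) ≡ total* wt ts
  Contract-weight (contract {e = e} cs abs) = trans (Absorb-weight abs) (cong (wt e +_) (Contract*-weight cs))
  Contract*-weight []       = refl
  Contract*-weight (c ∷ cs) = cong₂ _+_ (Contract-weight c) (Contract*-weight cs)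

  bit≤1 : ∀ b → bit b ≤ 1
  bit≤1 false = z≤n
  bit≤1 true  = ≤-refl

  Intern-heavy : ∀ {T e a U} m → Intern T e a U → heavy m U ≤ heavy m T + bit (m <ᵇ wt e)
  Intern-heavy m (found _)         = m≤m+n _ _
  Intern-heavy {T} {e} m (added _) = ≤-reflexive (heavy-snoc m T e)

  Intern-length : ∀ {T e a U} → Intern T e a U → length U ≤ length T + 1
  Intern-length (found _)     = m≤m+n _ _
  Intern-length {T} (added _) = ≤-reflexive (length-++ T)

  module _ (μ : Table → ℕ) (μ-Intern : ∀ {T e a U} → Intern T e a U → μ U ≤ μ T + 1) where

    -- `μ` is the length of the table or the number of its heavy entries; an absorption adds at most
    -- one entry.
    Absorb-growth : ∀ {T h rs T′ h′ a} → Absorb T h rs T′ h′ a → μ T′ ≤ μ T + a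
    Absorb-growth done = m≤m+n _ _
    Absorb-growth {T} (absorb {a = a} _ _ _ int abs) = ≤-trans (Absorb-growth abs)
      (≤-trans (+-monoˡ-≤ a (μ-Intern int)) (≤-reflexive (+-assoc (μ T) 1 a)))
    Absorb-growth (keep _ abs) = Absorb-growth abs

    Contract-growth  : ∀ {T t T′ r a} → Contract T t T′ r a → μ T′ ≤ μ T + a
    Contract*-growth : ∀ {T ts T′ rs a} → Contract* T ts T′ rs a → μ T′ ≤ μ T + a
    Contract-growth {T} (contract {a = a} {b = b} cs abs) = ≤-trans (Absorb-growth abs)
      (≤-trans (+-monoˡ-≤ b (Contract*-growth cs)) (≤-reflexive (+-assoc (μ T) a b)))
    Contract*-growth []           = m≤m+n _ _
    Contract*-growth {T} (_∷_ {a = a} {b = b} c cs) = ≤-trans (Contract-growth c)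
      (≤-trans (+-monoˡ-≤ b (Contract*-growth cs)) (≤-reflexive (+-assoc (μ T) a b)))

  Contract-length : ∀ {T t T′ r a} → Contract T t T′ r a → length T′ ≤ length T + a
  Contract-length = Contract-growth length Intern-length

  Contract-heavy : ∀ {T t T′ r a} m → Contract T t T′ r a → heavy m T′ ≤ heavy m T + a
  Contract-heavy m = Contract-growth (heavy m) λ int → ≤-trans (Intern-heavy m int) (+-monoʳ-≤ _ (bit≤1 _))

  module _ (m : ℕ) (2K≤mN : 2 * K ≤ m * N) where

    -- Both weights are below `K / N`, so their sum is below `2 K / N`, which is at most `m`. Hence
    -- no heavy rule arises as long as `N` is at least `2 K / m`.
    light : ∀ {e d x i c} → wt e * N < K → wt d * N < K → bit (m <ᵇ wt (combine x e i c d)) ≡ 0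
    light {e} {d} e< d< with m <ᵇ wt e + wt d in eq
    ... | false = refl
    ... | true  = contradiction (≤-trans (*-monoˡ-≤ N (<⇒≤ (<ᵇ⇒< m (wt e + wt d) (subst T (sym eq) tt)))) (≤-reflexive (*-distribʳ-+ N (wt e) (wt d))))
                    (<⇒≱ (≤-trans (+-mono-< e< d<) (≤-trans (≤-reflexive (cong (K +_) (sym (+-identityʳ K)))) 2K≤mN)))

    Absorb-light : ∀ {T h rs T′ h′ a} → Absorb T h rs T′ h′ a → heavy m T′ ≤ heavy m T
    Absorb-light done = ≤-refl
    Absorb-light {T} {head x e _ ts} (absorb {c = c} {d = d} _ e< d< int abs) = ≤-trans (Absorb-light abs) (≤-trans (Intern-heavy m int)
      (≤-reflexive (trans (cong (heavy m T +_) (light {e} {d} {x} {length ts} {c} e< d<)) (+-identityʳ _))))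
    Absorb-light (keep _ abs) = Absorb-light abs

    Contract-light  : ∀ {T t T′ r a} → Contract T t T′ r a → heavy m T′ ≤ heavy m T
    Contract*-light : ∀ {T ts T′ rs a} → Contract* T ts T′ rs a → heavy m T′ ≤ heavy m T
    Contract-light (contract cs abs) = ≤-trans (Absorb-light abs) (Contract*-light cs)
    Contract*-light []       = ≤-refl
    Contract*-light (c ∷ cs) = ≤-trans (Contract-light c) (Contract*-light cs)

  -- Disjunctions of reasons are stated as sums of bits, to be added up over
  -- the tree.

  big : Entry → ℕ
  big e = bit (K ≤ᵇ wt e * N)

  big≡1 : ∀ {e} → K ≤ wt e * N → big e ≡ 1
  big≡1 {e} le with K ≤ᵇ wt e * N | ≤⇒≤ᵇ le
  ... | true | _ = refl

  big≡0 : ∀ {e} → wt e * N < K → big e ≡ 0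
  big≡0 {e} lt with K ≤ᵇ wt e * N in eq
  ... | false = refl
  ... | true  = contradiction lt (≤⇒≯ (≤ᵇ⇒≤ K _ (subst T (sym eq) tt)))

  big-mono : ∀ {d e} → wt d ≤ wt e → big d ≤ big e
  big-mono {d} {e} d≤e with K ≤ᵇ wt d * N in eq
  ... | false = z≤n
  ... | true  = ≤-reflexive (sym (big≡1 {e} (≤-trans (≤ᵇ⇒≤ K _ (subst T (sym eq) tt)) (*-monoˡ-≤ N d≤e))))

  -- A root of rank 0 that has absorbed nothing was already a leaf before the round.
  leafBit : Bool × Rose → ℕ
  leafBit (true  , _)          = 0
  leafBit (false , tree _ e _) = bit (rk e ≡ᵇ 0)

  tally : (Bool × Rose → ℕ) → List (Bool × Rose) → ℕ
  tally g []       = 0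
  tally g (r ∷ rs) = g r + tally g rs

  rootBig : Bool × Rose → ℕ
  rootBig (_ , t) = big (rootEntry t)

  flagBit : Bool × Rose → ℕ
  flagBit (flag , _) = bit flag

  Absorb-wt : ∀ {T h rs T′ h′ a} → Absorb T h rs T′ h′ a → wt (hent h) ≤ wt (hent h′)
  Absorb-wt done                     = ≤-refl
  Absorb-wt (absorb _ _ _ int abs) = ≤-trans (m≤m+n _ _) (Absorb-wt abs)
  Absorb-wt (keep _ abs)           = Absorb-wt abs

  Absorb-flag : ∀ {T h rs T′ h′ a} → Absorb T h rs T′ h′ a → bit (hflag h′) ≤ bit (hflag h) + a
  Absorb-flag done = m≤m+n _ _
  Absorb-flag {h = h} (absorb {a = a} _ _ _ int abs) = ≤-trans (Absorb-flag abs) (m≤n+m (suc a) (bit (hflag h)))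
  Absorb-flag (keep _ abs) = Absorb-flag abs

  -- Absorbed clusters are not big, so none of the big ones disappears below the head.
  Absorb-bigs : ∀ {T h rs T′ h′ a} → Absorb T h rs T′ h′ a →
                total* big (hkids h′) ≡ total* big (hkids h) + total* big (trees rs)
  Absorb-bigs done = sym (+-identityʳ _)
  Absorb-bigs {h = head _ _ _ ts} {rs = _ ∷ rs} (absorb {d = d} {us = us} _ _ d< _ abs) =
    trans (Absorb-bigs abs) (trans (cong (_+ total* big (trees rs)) (total*-++ big ts us))
      (trans (+-assoc (total* big ts) _ _)
        (cong (λ z → total* big ts + (z + total* big us + total* big (trees rs))) (sym (big≡0 {d} d<)))))
  Absorb-bigs {h = head _ _ _ ts} {rs = _ ∷ rs} (keep {c = c} {d} {us} _ abs) =
    trans (Absorb-bigs abs) (trans (cong (_+ total* big (trees rs)) (total*-++ big ts (tree c d us ∷ [])))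
      (rearrange (total* big ts) (big d + total* big us) (total* big (trees rs))))
    where
    rearrange : ∀ x y z → x + (y + 0) + z ≡ x + (y + z)
    rearrange = solve-∀

  leafBit≤1 : ∀ r → leafBit r ≤ 1
  leafBit≤1 (true  , _)          = z≤n
  leafBit≤1 (false , tree _ e _) = bit≤1 _

  -- With `rk d ≡ 0` the composition has smaller rank than the head, so `high` is impossible and a
  -- big cluster is to blame.
  refused-leaf : ∀ {e flag c d us B} → rk e ≤ R → Refusal e flag d → big e ≤ B →
                 leafBit (flag , tree c d us) ≤ rootBig (flag , tree c d us) + B
  refused-leaf r (busy refl) _ = z≤n
  refused-leaf {flag = true} r _ _ = z≤n
  refused-leaf {flag = false} {d = d} r (high h) _ with rk d
  ... | zero  = contradiction (≤-trans h (≤-trans (≤-reflexive (+-identityʳ _)) r)) λ le → 1+n≰n (≤-trans (n≤1+n _) le)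
  ... | suc _ = z≤n
  refused-leaf {e} {flag = false} {c} {d} {us} {B} r (bigHead h) e≤B =
    ≤-trans (leafBit≤1 (false , tree c d us)) (≤-trans (≤-trans (≤-reflexive (sym (big≡1 {e} h))) e≤B) (m≤n+m B _))
  refused-leaf {flag = false} {c} {d} {us} r (bigChild h) _ =
    ≤-trans (leafBit≤1 (false , tree c d us)) (≤-trans (≤-reflexive (sym (big≡1 {d} h))) (m≤m+n _ _))

  -- Every idle leaf is absorbed, is big, or blames the head. A big head may be blamed by all its
  -- children, hence the factor `length rs`. Blaming the final head is safe because its weight only
  -- grows.
  Absorb-leaves : ∀ {T h rs T′ h′ a} → rk (hent h) ≤ R → Absorb T h rs T′ h′ a →
                  tally leafBit rs ≤ a + tally rootBig rs + length rs * big (hent h′)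
  Absorb-leaves r done = z≤n
  Absorb-leaves {rs = rr ∷ rs} {h′ = h′} {a = suc a} r (absorb {d = d} r′ _ d< _ abs) =
    ≤-trans (+-mono-≤ (leafBit≤1 rr) (Absorb-leaves (∸-monoˡ-≤ 1 r′) abs))
      (s≤s (≤-trans (≤-trans (m≤m+n _ (big (hent h′))) (≤-reflexive (rearrange a (tally rootBig rs) (length rs * big (hent h′)) (big (hent h′)))))
        (≤-reflexive (cong (λ z → a + (z + tally rootBig rs) + (big (hent h′) + length rs * big (hent h′))) (sym (big≡0 {d} d<))))))
    where
    rearrange : ∀ x y z w → x + y + z + w ≡ x + (0 + y) + (w + z)
    rearrange = solve-∀
  Absorb-leaves {h = h} {rs = (_ , tree _ d _) ∷ rs} {h′ = h′} {a = a} r (keep ref abs) =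
    ≤-trans (+-mono-≤ (refused-leaf r ref (big-mono {hent h} {hent h′} (Absorb-wt abs))) (Absorb-leaves r abs))
      (≤-reflexive (rearrange (big d) (big (hent h′)) a (tally rootBig rs) (length rs * big (hent h′))))
    where
    rearrange : ∀ x y z u v → x + y + (z + u + v) ≡ z + (x + u) + (y + v)
    rearrange = solve-∀

  -- A head of rank at most 1 yields a composition of rank at most `rk d`, so again `high` is
  -- impossible.
  refused-child : ∀ {e flag c d us B} → rk e ≤ 1 → rk d ≤ R → Refusal e flag d → big e ≤ B →
                  1 ≤ bit flag + rootBig (flag , tree c d us) + B
  refused-child r s (busy refl) _ = s≤s z≤n
  refused-child {flag = flag} {d = d} r s (high h) _ = contradiction h (≤⇒≯ (+-mono-≤ r s))
  refused-child {e} {flag} {d = d} {B = B} r s (bigHead h) e≤B =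
    ≤-trans (≤-trans (≤-reflexive (sym (big≡1 {e} h))) e≤B) (m≤n+m B (bit flag + big d))
  refused-child {flag = flag} {d = d} {B = B} r s (bigChild h) _ =
    ≤-trans (≤-reflexive (sym (big≡1 {d} h))) (≤-trans (m≤n+m _ (bit flag)) (m≤m+n _ B))

  Absorb-unary : ∀ {T h r T′ h′ a} → rk (hent h) ≤ 1 → rk (rootEntry (proj₂ r)) ≤ R → Absorb T h (r ∷ []) T′ h′ a →
                 1 ≤ flagBit r + a + rootBig r + big (hent h′)
  Absorb-unary r s (absorb _ _ _ _ done) = s≤s z≤n
  Absorb-unary {h = h} {r = (flag , tree c d us)} {h′ = h′} r s (keep ref done) = ≤-trans
    (refused-child {c = c} {us = us} r s ref ≤-refl) (+-monoˡ-≤ (big (hent h′)) (+-monoˡ-≤ (big d) (m≤m+n (bit flag) 0)))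

  -- The origin of the constants. An absorption pays 2 for a leaf, 1 for a unary head and 1 for the
  -- flag that it sets, together 4. A big child pays 2 as a leaf and 1 as the child of a unary head.
  -- A big head pays 2 for each of at most `R` leaves and 1 for being unary. The 2 on the left is
  -- covered by `length rs` if there are two children; a single child covers one half of it and
  -- `Absorb-unary` the other.
  node-inequality : ∀ {T e x rs T′ h a} → 1 ≤ R → rk e ≤ R → length rs ≡ rk e → 1 ≤ rk e →
    All (λ r → rk (rootEntry (proj₂ r)) ≤ R) rs → Absorb T (head x e false []) rs T′ h a →
    2 * tally leafBit rs + 2 + bit (hflag h) ≤
    length rs + 4 * a + tally flagBit rs + 3 * tally rootBig rs + (2 * R + 1) * big (hent h)
  node-inequality {rs = r ∷ []} {h = h} {a} 1≤R e≤R l _ (s ∷ []) abs =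
    ≤-trans (≤-reflexive (left (leafBit r) (bit (hflag h))))
      (≤-trans (+-mono-≤ (+-mono-≤ (*-monoʳ-≤ 2 (Absorb-leaves e≤R abs)) (+-monoʳ-≤ 1 (Absorb-unary (≤-reflexive (sym l)) s abs))) (Absorb-flag abs))
        (≤-trans (≤-reflexive (middle a (rootBig r) (big (hent h)) (flagBit r)))
          (+-monoʳ-≤ (1 + 4 * a + (flagBit r + 0) + 3 * (rootBig r + 0)) (*-monoˡ-≤ (big (hent h)) (+-monoˡ-≤ 1 (*-monoʳ-≤ 2 1≤R))))))
    where
    left : ∀ x f → 2 * (x + 0) + 2 + f ≡ 2 * (x + 0) + (1 + 1) + f
    left = solve-∀
    middle : ∀ a r B f → 2 * (a + (r + 0) + 1 * B) + (1 + (f + a + r + B)) + (0 + a) ≡ 1 + 4 * a + (f + 0) + 3 * (r + 0) + 3 * B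
    middle = solve-∀
  node-inequality {rs = rs@(_ ∷ _ ∷ rs′)} {h = h} {a} 1≤R e≤R l _ _ abs =
    ≤-trans (+-mono-≤ (+-mono-≤ (*-monoʳ-≤ 2 (Absorb-leaves e≤R abs)) (s≤s (s≤s (z≤n {length rs′})))) (Absorb-flag abs))
      (≤-trans (≤-reflexive (left (length rs) a (tally rootBig rs) (big (hent h))))
        (≤-trans (+-mono-≤ (+-monoʳ-≤ (length rs + 3 * a + 2 * tally rootBig rs) (*-monoˡ-≤ (big (hent h)) (*-monoʳ-≤ 2 (≤-trans (≤-reflexive l) e≤R))))
           (z≤n {a + tally flagBit rs + tally rootBig rs + big (hent h)}))
          (≤-reflexive (right (length rs) a (tally rootBig rs) (big (hent h)) (tally flagBit rs) R))))
    where
    left : ∀ k a r B → 2 * (a + r + k * B) + k + (0 + a) ≡ k + 3 * a + 2 * r + 2 * k * B + 0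
    left = solve-∀
    right : ∀ k a r B f R → k + 3 * a + 2 * r + 2 * R * B + (a + f + r + B) ≡ k + 4 * a + f + 3 * r + (2 * R + 1) * B
    right = solve-∀
  node-inequality {e = e} {rs = []} _ _ l 1≤ _ _ = contradiction (≤-trans 1≤ (≤-reflexive (sym l))) λ ()

  result-ranks : ∀ {T D E rs} → OK fs R T → All (ResultInv T D E) rs → All (λ r → rk (rootEntry (proj₂ r)) ≤ R) rs
  result-ranks ok [] = []
  result-ranks ok ((wf p _ _ _ , _) ∷ ris) = OK-rank ok p ∷ result-ranks ok ris

  -- The inductive form of "leaves and unary nodes are more than half": a leaf carries a credit of
  -- 2, for itself and for one branching node, and 1 is left over at the root. The credit of a root
  -- that is still a leaf, `2 * leafBit r`, is paid by its parent. Flag and `3 * rootBig r` are paid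
  -- in advance, for the case that this root is refused by its parent; with `2 R + 1` for a big head
  -- this makes `2 R + 4`.
  Contract-progress : ∀ {T D t T′ r a} → 1 ≤ R → OK fs R T → Wf T D t → Contract T t T′ r a →
    count t + 1 + flagBit r + 3 * rootBig r ≤ 4 * a + (2 * R + 4) * total big (proj₂ r) + 2 * leafBit r
  Contract*-progress : ∀ {T D ts T′ rs a} → 1 ≤ R → OK fs R T → All (Wf T D) ts → Contract* T ts T′ rs a →
    count* ts + length rs + tally flagBit rs + 3 * tally rootBig rs ≤
    4 * a + (2 * R + 4) * total* big (trees rs) + 2 * tally leafBit rs
  Contract-progress {t = tree x e []} 1≤R ok (wf p l _ _) (contract [] done) rewrite sym l =
    ≤-trans (≤-reflexive (left (big e))) (≤-trans (+-monoˡ-≤ 2 (*-monoˡ-≤ (big e) {3} {2 * R + 4} (≤-trans (s≤s (s≤s (s≤s (z≤n {1})))) (m≤n+m 4 (2 * R)))))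
      (≤-reflexive (right (2 * R + 4) (big e))))
    where
    left : ∀ B → 1 + 0 + 1 + 0 + 3 * B ≡ 3 * B + 2
    left = solve-∀
    right : ∀ r B → r * B + 2 ≡ 4 * 0 + r * (B + 0) + 2
    right = solve-∀
  Contract-progress {t = tree x e (t ∷ ts)} 1≤R ok (wf p l _ ws) (contract {rs = rs} {a} {h = h} {b} cs abs)
    with ok₁ , ⊑₁ , ris ← Contract-inv* ok ws cs = ≤-trans
    (+-cancelʳ-≤ slack _ _
      (≤-trans (≤-reflexive (left (count* (t ∷ ts)) (length rs) (tally flagBit rs) (tally rootBig rs) (tally leafBit rs) (bit (hflag h)) (big (hent h))))
      (≤-trans (+-monoˡ-≤ (3 * big (hent h)) (+-mono-≤ (Contract*-progress 1≤R ok ws cs) at-node))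
      (≤-reflexive (right a b (length rs) (tally flagBit rs) (tally rootBig rs) (tally leafBit rs) (big (hent h)) R (total* big (trees rs)))))))
    (≤-trans (≤-reflexive (cong (λ z → 4 * (a + b) + (2 * R + 4) * (big (hent h) + z)) (sym (Absorb-bigs abs)))) (m≤m+n _ _))
    where
    slack : ℕ
    slack = length rs + tally flagBit rs + 3 * tally rootBig rs + 2 * tally leafBit rs
    at-node : 2 * tally leafBit rs + 2 + bit (hflag h) ≤
           length rs + 4 * b + tally flagBit rs + 3 * tally rootBig rs + (2 * R + 1) * big (hent h)
    at-node = node-inequality 1≤R (OK-rank ok p) (trans (Contract*-length cs) l) (≤-trans (s≤s z≤n) (≤-reflexive l))
             (result-ranks (proj₁ (Contract-inv* ok ws cs)) (proj₂ (proj₂ (Contract-inv* ok ws cs)))) abs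
    left : ∀ c k f r l g B → suc c + 1 + g + 3 * B + (k + f + 3 * r + 2 * l) ≡ c + k + f + 3 * r + (2 * l + 2 + g) + 3 * B
    left = solve-∀
    right : ∀ a b k f r l B R s → 4 * a + (2 * R + 4) * s + 2 * l + (k + 4 * b + f + 3 * r + (2 * R + 1) * B) + 3 * B ≡
            4 * (a + b) + (2 * R + 4) * (B + s) + (k + f + 3 * r + 2 * l)
    right = solve-∀
  Contract*-progress 1≤R ok [] [] = z≤n
  Contract*-progress {ts = t ∷ ts} 1≤R ok (w ∷ ws) (_∷_ {rs = rs} {a} {r = r} {b} c cs)
    with ok₁ , ⊑₁ , ris ← Contract-inv* ok ws cs = ≤-trans
    (≤-reflexive (left (count t) (count* ts) (length rs) (flagBit r) (tally flagBit rs) (rootBig r) (tally rootBig rs)))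
    (≤-trans (+-mono-≤ (Contract-progress 1≤R ok₁ (Wf-mono ⊑₁ ≤-refl w) c) (Contract*-progress 1≤R ok ws cs))
    (≤-reflexive (right a b (2 * R + 4) (total big (proj₂ r)) (total* big (trees rs)) (leafBit r) (tally leafBit rs))))
    where
    left : ∀ c d k f g r s → c + d + suc k + (f + g) + 3 * (r + s) ≡ c + 1 + f + 3 * r + (d + k + g + 3 * s)
    left = solve-∀
    right : ∀ a b p s u l m → 4 * b + p * s + 2 * l + (4 * a + p * u + 2 * m) ≡ 4 * (a + b) + p * (s + u) + 2 * (l + m)
    right = solve-∀

  -- Markov's inequality for the weights.
  total-big  : ∀ t → total big t * K ≤ total wt t * N
  total-big* : ∀ ts → total* big ts * K ≤ total* wt ts * N
  total-big (tree x e ts) = ≤-trans (≤-reflexive (*-distribʳ-+ K (big e) _)) (≤-trans (+-mono-≤ root-big (total-big* ts))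
    (≤-reflexive (sym (*-distribʳ-+ N (wt e) _))))
    where
    root-big : big e * K ≤ wt e * N
    root-big with K ≤ᵇ wt e * N in eq
    ... | false = z≤n
    ... | true  = ≤-trans (≤-reflexive (*-identityˡ K)) (≤ᵇ⇒≤ K _ (subst T (sym eq) tt))
  total-big* []       = z≤n
  total-big* (t ∷ ts) = ≤-trans (≤-reflexive (*-distribʳ-+ K (total big t) _)) (≤-trans (+-mono-≤ (total-big t) (total-big* ts))
    (≤-reflexive (sym (*-distribʳ-+ N (total wt t) _))))

  -- With K = (8 + 4 R) n the big clusters make up for at most half of
  -- the bound in Contract-progress.
  shrinks : ∀ {T D t T′ r a} → 1 ≤ R → OK fs R T → Wf T D t → Contract T t T′ r a →
            count t ≡ N → 2 ≤ N → 0 < total wt t → K ≡ (8 + 4 * R) * total wt t → N ≤ 8 * a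
  shrinks {t = t} {r = r} {a} 1≤R ok w c refl 2≤N 0<n refl with leafBit r in eq | Contract-progress 1≤R ok w c
  ... | zero | progress = +-cancelʳ-≤ N _ _ (≤-trans double (≤-trans (*-monoʳ-≤ 2 progress)
        (≤-trans (≤-reflexive (rearrange a R B)) (+-monoʳ-≤ (8 * a) few))))
    where
    B = total big (proj₂ r)
    n = total wt t
    double : N + N ≤ 2 * (N + 1 + flagBit r + 3 * rootBig r)
    double = ≤-trans (≤-reflexive (cong (N +_) (sym (+-identityʳ N))))
      (*-monoʳ-≤ 2 (≤-trans (m≤m+n N 1) (≤-trans (m≤m+n _ (flagBit r)) (m≤m+n _ _))))
    rearrange : ∀ a R B → 2 * (4 * a + (2 * R + 4) * B + 2 * 0) ≡ 8 * a + B * (8 + 4 * R)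
    rearrange = solve-∀
    few : B * (8 + 4 * R) ≤ N
    few = *-cancelʳ-≤ _ _ n {{>-nonZero 0<n}} (≤-trans (≤-reflexive (*-assoc B (8 + 4 * R) n))
      (≤-trans (total-big (proj₂ r)) (≤-reflexive (trans (cong (_* N) (Contract-weight c)) (*-comm n N)))))
  -- A root of rank 0 is the whole new tree, so `1 + a ≡ N` and `N ≤ 2 a` by counting alone.
  ... | suc _ | _ = single r eq (proj₂ (proj₂ (Contract-inv ok w c))) (Contract-count c)
    where
    zero-rank : ∀ k {m} → bit (k ≡ᵇ 0) ≡ suc m → k ≡ 0
    zero-rank zero _ = refl
    single : ∀ {T D E} r {m} → leafBit r ≡ suc m → ResultInv T D E r → count (proj₂ r) + a ≡ N → N ≤ 8 * a
    single (false , tree x e []) _ _ eqN = ≤-trans (≤-reflexive (sym eqN))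
      (≤-trans (+-monoˡ-≤ a (s≤s⁻¹ (≤-trans 2≤N (≤-reflexive (sym eqN)))))
      (≤-trans (≤-reflexive (cong (a +_) (sym (+-identityʳ a)))) (*-monoˡ-≤ a (s≤s (s≤s (z≤n {6}))))))
    single (false , tree x e (_ ∷ _)) eq (wf _ l _ _ , _) _ with () ← trans l (zero-rank (rk e) eq)

-- The invariant over all rounds

module Evolution (F : RankedAlphabet) (fs : List (Symbol F)) (R n : ℕ) (1≤R : 1 ≤ R) (0<n : 0 < n) where
  open Clusters F

  K : ℕ
  K = (8 + 4 * R) * n

  -- After `j` rounds at most `(7/8) ^ j * n` clusters are left. Each new entry costs a cluster, so
  -- `length T + count t` never exceeds its initial bound `2 * n`; the same exchange keeps
  -- `heavy m T + count t` from growing once heavy entries can arise. Single nodes have depth 1,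
  -- hence the `1 +` in `D≤`.
  record Evolved (T₀ : Table) (t₀ : Rose) (T : Table) (t : Rose) : Set where
    field
      ok     : OK fs R T
      D j    : ℕ
      shape  : Wf T D t
      D≤     : D ≤ 1 + R * j
      rounds : 8 ^ j * count t ≤ 7 ^ j * n
      weight : total wt t ≡ n
      room   : length T + count t ≤ 2 * n
      sparse : ∀ m → 0 < m → heavy m T ≡ 0 ⊎ (heavy m T + count t) * m ≤ 2 * K
      ext    : T₀ ⊑ T
      steps  : T ⊢ t ⟶* t₀

  evolve : ∀ {T₀ t₀ T t T′ r a} → Evolved T₀ t₀ T t → 2 ≤ count t → Contraction.Contract fs R (count t) K T t T′ r a →
           Evolved T₀ t₀ T′ (proj₂ r) × count t ≤ 8 * a × count (proj₂ r) + a ≡ count t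
  evolve {T₀} {t₀} {T} {t} {T′} {r} {a} ev 2≤ c = evolved , few , counts
    where
    open Evolved ev
    open Contraction fs R (count t) K
    open Analysis F fs R (count t) K
    N  = count t
    N′ = count (proj₂ r)
    inv : OK fs R T′ × T ⊑ T′ × ResultInv T′ D (D + R) r
    inv = Contract-inv ok shape c
    counts : N′ + a ≡ N
    counts = Contract-count c
    few : N ≤ 8 * a
    few = shrinks 1≤R ok shape c refl 2≤ (≤-trans 0<n (≤-reflexive (sym weight))) (cong ((8 + 4 * R) *_) (sym weight))
    decrease : 8 * N′ ≤ 7 * N
    decrease = +-cancelʳ-≤ N _ _ (≤-trans (+-monoʳ-≤ (8 * N′) few) (≤-reflexive (trans (sym (*-distribˡ-+ 8 N′ a))
      (trans (cong (8 *_) counts) (+-comm N (7 * N))))))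
    rounds′ : 8 ^ suc j * N′ ≤ 7 ^ suc j * n
    rounds′ = ≤-trans (≤-reflexive (rearrange 8 (8 ^ j) N′)) (≤-trans (*-monoʳ-≤ (8 ^ j) decrease)
      (≤-trans (≤-reflexive (sym (rearrange 7 (8 ^ j) N))) (≤-trans (≤-reflexive (*-assoc 7 (8 ^ j) N))
        (≤-trans (*-monoʳ-≤ 7 rounds) (≤-reflexive (sym (*-assoc 7 (7 ^ j) n)))))))
      where
      rearrange : ∀ x y z → x * y * z ≡ y * (x * z)
      rearrange = solve-∀
    room′ : length T′ + N′ ≤ 2 * n
    room′ = ≤-trans (+-monoˡ-≤ N′ (Contract-length c)) (≤-trans (≤-reflexive (trans (+-assoc (length T) a N′)
      (cong (length T +_) (trans (+-comm a N′) counts)))) room)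
    sparse′ : ∀ m → 0 < m → heavy m T′ ≡ 0 ⊎ (heavy m T′ + N′) * m ≤ 2 * K
    -- While `2 K ≤ m N`, a round adds nothing heavy. The first round after that starts without
    -- heavy entries and with fewer than `2 K / m` clusters, and from then on the sum cannot grow.
    sparse′ m 0<m with 2 * K ≤? m * N | sparse m 0<m
    ... | yes le | inj₁ eq = inj₁ (n≤0⇒n≡0 (≤-trans (Contract-light m le c) (≤-reflexive eq)))
    ... | yes le | inj₂ sp = inj₂ (≤-trans (*-monoˡ-≤ m (+-mono-≤ (Contract-light m le c) (≤-trans (m≤m+n N′ a) (≤-reflexive counts)))) sp)
    ... | no lt  | inj₁ eq = inj₂ (≤-trans (*-monoˡ-≤ m (+-monoˡ-≤ N′ (≤-trans (Contract-heavy m c) (≤-reflexive (cong (_+ a) eq)))))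
            (≤-trans (≤-reflexive (trans (cong (_* m) (trans (+-comm a N′) counts)) (*-comm N m))) (<⇒≤ (≰⇒> lt))))
    ... | no lt  | inj₂ sp = inj₂ (≤-trans (*-monoˡ-≤ m (+-monoˡ-≤ N′ (Contract-heavy m c)))
            (≤-trans (≤-reflexive (cong (_* m) (trans (+-assoc (heavy m T) a N′) (cong (heavy m T +_) (trans (+-comm a N′) counts))))) sp))
    evolved : Evolved T₀ t₀ T′ (proj₂ r)
    evolved = record
      { ok     = proj₁ inv
      ; D      = D + R
      ; j      = suc j
      ; shape  = proj₁ (proj₂ (proj₂ inv))
      ; D≤     = ≤-trans (+-monoˡ-≤ R D≤) (≤-reflexive (cong suc (trans (+-comm (R * j) R) (sym (*-suc R j)))))
      ; rounds = rounds′
      ; weight = trans (Contract-weight c) weight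
      ; room   = room′
      ; sparse = sparse′
      ; ext    = λ p → proj₁ (proj₂ inv) (ext p)
      ; steps  = Contract-steps ok shape c ◅◅ ⟶*-mono (proj₁ (proj₂ inv)) steps
      }

-- The initial cluster tree and its ranks

module Spelling (F : RankedAlphabet) where
  open Clusters F

  data Assigned (T : Table) : List (Symbol F) → List ℕ → Set where
    []  : Assigned T [] []
    _∷_ : ∀ {f fs x xs} → At T x (leafEntry f) → Assigned T fs xs → Assigned T (f ∷ fs) (x ∷ xs)

  Assigned-mono : ∀ {T U fs xs} → T ⊑ U → Assigned T fs xs → Assigned U fs xs
  Assigned-mono ⊑₀ []       = []
  Assigned-mono ⊑₀ (p ∷ ps) = ⊑₀ p ∷ Assigned-mono ⊑₀ ps

  Assigned-snoc : ∀ {T fs xs f x} → Assigned T fs xs → At T x (leafEntry f) → Assigned T (fs ++ f ∷ []) (xs ++ x ∷ [])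
  Assigned-snoc []       q = q ∷ []
  Assigned-snoc (p ∷ ps) q = p ∷ Assigned-snoc ps q

  Assigned-length : ∀ {T fs xs} → Assigned T fs xs → length fs ≡ length xs
  Assigned-length []       = refl
  Assigned-length (p ∷ ps) = cong suc (Assigned-length ps)

  Assigned-split : ∀ {T} fs {gs xs} → Assigned T (fs ++ gs) xs →
    ∃₂ λ ys zs → xs ≡ ys ++ zs × Assigned T fs ys × Assigned T gs zs
  Assigned-split []       ps       = [] , _ , refl , [] , ps
  Assigned-split (f ∷ fs) (p ∷ ps) with ys , zs , refl , qs , rs ← Assigned-split fs ps =
    _ ∷ ys , zs , refl , p ∷ qs , rs

  -- The cluster tree with one cluster for each node of a term.
  data Spells  (T : Table) {X : Set} : Rose → Term F X → Set
  data Spells* (T : Table) {X : Set} : ∀ {k} → List Rose → Vec (Term F X) k → Set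
  data Spells T where
    node : ∀ {x f ts us} → At T x (leafEntry f) → Spells* T ts us → Spells T (tree x (leafEntry f) ts) (node f us)
  data Spells* T where
    []  : Spells* T [] []
    _∷_ : ∀ {k t u ts} {us : Vec _ k} → Spells T t u → Spells* T ts us → Spells* T (t ∷ ts) (u ∷ us)

  -- The machine stores nothing but the preorder sequence `xs`; the tree meant by it is recovered
  -- along the term.
  spell  : ∀ {T xs} (u : Tree F) → Assigned T (labels u) xs → Σ Rose λ t → flat t ≡ xs × Spells T t u
  spell* : ∀ {T xs k} (us : Vec (Tree F) k) → Assigned T (labels* us) xs → Σ (List Rose) λ ts → flat* ts ≡ xs × Spells* T ts us
  spell (node f us) (_∷_ {x = x} p ps) with ts , refl , sp ← spell* us ps = tree x (leafEntry f) ts , refl , node p sp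
  spell* [] [] = [] , refl , []
  spell* (u ∷ us) ps with ys , zs , refl , qs , rs ← Assigned-split (labels u) ps
    with t , refl , sp ← spell u qs | ts , refl , sps ← spell* us rs = t ∷ ts , refl , sp ∷ sps

  Spells-mono  : ∀ {T U X t} {u : Term F X} → T ⊑ U → Spells T t u → Spells U t u
  Spells-mono* : ∀ {T U X ts k} {us : Vec (Term F X) k} → T ⊑ U → Spells* T ts us → Spells* U ts us
  Spells-mono ⊑₀ (node p sps) = node (⊑₀ p) (Spells-mono* ⊑₀ sps)
  Spells-mono* ⊑₀ []         = []
  Spells-mono* ⊑₀ (sp ∷ sps) = Spells-mono ⊑₀ sp ∷ Spells-mono* ⊑₀ sps

  module _ {T : Table} {X : Set} where

    Spells-wf  : ∀ {t} {u : Term F X} → Spells T t u → Wf T 1 t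
    Spells-wf* : ∀ {ts k} {us : Vec (Term F X) k} → Spells* T ts us → All (Wf T 1) ts × length ts ≡ k
    Spells-wf (node p sps) with ws , l ← Spells-wf* sps = wf p l ≤-refl ws
    Spells-wf* []         = [] , refl
    Spells-wf* (sp ∷ sps) with ws , l ← Spells-wf* sps = Spells-wf sp ∷ ws , cong suc l

    Spells-weight  : ∀ {t} {u : Term F X} → Spells T t u → total wt t ≡ count t
    Spells-weight* : ∀ {ts k} {us : Vec (Term F X) k} → Spells* T ts us → total* wt ts ≡ count* ts
    Spells-weight (node p sps) = cong suc (Spells-weight* sps)
    Spells-weight* []         = refl
    Spells-weight* (sp ∷ sps) = cong₂ _+_ (Spells-weight sp) (Spells-weight* sps)

  1≤size : ∀ (u : Tree F) → 1 ≤ size u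
  1≤size (node f us) = s≤s z≤n

  -- Each child contributes at least one node. This bounds `R` by `n` independently of `r`, so that
  -- ranks fit into machine words.
  rank≤size  : ∀ (u : Tree F) → All (λ f → rank F f ≤ size u) (labels u)
  rank≤size* : ∀ {k} (us : Vec (Tree F) k) → k ≤ length (labels* us) × All (λ f → rank F f ≤ length (labels* us)) (labels* us)
  rank≤size (node f us) with k≤ , rs ← rank≤size* us = m≤n⇒m≤1+n k≤ ∷ All.map m≤n⇒m≤1+n rs
  rank≤size* [] = z≤n , []
  rank≤size* (u ∷ us) with k≤ , rs ← rank≤size* us =
    ≤-trans (+-mono-≤ (1≤size u) k≤) (≤-reflexive (sym (length-++ (labels u)))) ,
    All.++⁺ (All.map (λ le → ≤-trans le (≤-trans (m≤m+n _ _) (≤-reflexive (sym (length-++ (labels u)))))) (rank≤size u))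
      (All.map (λ le → ≤-trans le (≤-trans (m≤n+m _ (size u)) (≤-reflexive (sym (length-++ (labels u)))))) rs)

  maxRank : ℕ → List (Symbol F) → ℕ
  maxRank ρ []       = ρ
  maxRank ρ (f ∷ gs) = maxRank (ρ ⊔ rank F f) gs

  maxRank-≥ : ∀ ρ gs → ρ ≤ maxRank ρ gs × All (λ f → rank F f ≤ maxRank ρ gs) gs
  maxRank-≥ ρ []       = ≤-refl , []
  maxRank-≥ ρ (f ∷ gs) with le , les ← maxRank-≥ (ρ ⊔ rank F f) gs =
    ≤-trans (m≤m⊔n ρ (rank F f)) le , ≤-trans (m≤n⊔m ρ (rank F f)) le ∷ les

  maxRank-≤ : ∀ {B} ρ gs → ρ ≤ B → All (λ f → rank F f ≤ B) gs → maxRank ρ gs ≤ B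
  maxRank-≤ ρ []       le []         = le
  maxRank-≤ ρ (f ∷ gs) le (fe ∷ les) = maxRank-≤ (ρ ⊔ rank F f) gs (⊔-lub le fe) les

-- Counting the nonterminals of small weight

lookup-injective : ∀ {A : Set} {xs : List A} → Unique xs → ∀ i j → List.lookup xs i ≡ List.lookup xs j → i ≡ j
lookup-injective (_ ∷ _)   zero    zero    _  = refl
lookup-injective (ps ∷ _)  zero    (suc j) eq = contradiction eq (All.lookup ps (∈-lookup j))
lookup-injective (ps ∷ _)  (suc i) zero    eq = contradiction (sym eq) (All.lookup ps (∈-lookup i))
lookup-injective (_ ∷ pss) (suc i) (suc j) eq = cong suc (lookup-injective pss i j eq)

pigeonhole : ∀ {B} xs → Unique xs → All (_< B) xs → length xs ≤ B
pigeonhole {B} xs unique bounded = injective⇒≤ {f = f} λ {i} {j} eq → lookup-injective unique i j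
  (trans (sym (toℕ-fromℕ< (bound i))) (trans (cong toℕ eq) (toℕ-fromℕ< (bound j))))
  where
  bound : ∀ i → List.lookup xs i < B
  bound i = All.lookup bounded (∈-lookup i)
  f : Fin (length xs) → Fin B
  f i = fromℕ< (bound i)

-- Bijective numeration in base β.
numeral : ℕ → List ℕ → ℕ
numeral β []      = 0
numeral β (d ∷ w) = suc d + β * numeral β w

numeral-< : ∀ β w → All (_< β) w → numeral β w < suc β ^ length w
numeral-< β []      []         = s≤s z≤n
numeral-< β (d ∷ w) (d< ∷ ds) = ≤-trans (s≤s (+-monoˡ-≤ (β * numeral β w) d<))
  (≤-trans (≤-reflexive (cong suc (sym (*-suc β (numeral β w)))))
    (≤-trans (s≤s (m≤n+m (β * suc (numeral β w)) (numeral β w))) (*-monoʳ-≤ (suc β) (numeral-< β w ds))))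

numeral-head : ∀ {β c d x y} → c < β → d < β → c + β * x ≡ d + β * y → c ≡ d
numeral-head {β} {c} {d} {x} {y} c< d< eq = trans (sym (digit c x c<)) (trans (cong (_% β) eq) (digit d y d<))
  where
  instance
    β-nonZero : NonZero β
    β-nonZero = >-nonZero (≤-<-trans z≤n c<)
  digit : ∀ e w → e < β → (e + β * w) % β ≡ e
  digit e w e< = trans (cong (λ z → (e + z) % β) (*-comm β w)) (trans ([m+kn]%n≡m%n e w β) (m<n⇒m%n≡m e<))

-- The digits run from 1 to `β`. Without a zero digit, words of different lengths cannot have the
-- same number.
numeral-injective : ∀ β u v → All (_< β) u → All (_< β) v → numeral β u ≡ numeral β v → u ≡ v
numeral-injective β []      []      _ _ _ = refl
numeral-injective β (c ∷ u) (d ∷ v) (c< ∷ us) (d< ∷ vs) eq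
  with refl ← numeral-head {x = numeral β u} {numeral β v} c< d< (suc-injective eq) =
  cong (c ∷_) (numeral-injective β u v us vs
    (*-cancelˡ-≡ _ _ β {{>-nonZero (≤-<-trans z≤n c<)}} (+-cancelˡ-≡ c _ _ (suc-injective eq))))

module Positions (F : RankedAlphabet) where

  open RankedAlphabet F using () renaming (_≟_ to _≟ˢ_)

  indexOf : List (Symbol F) → Symbol F → ℕ
  indexOf []       f = 0
  indexOf (g ∷ gs) f with f ≟ˢ g
  ... | yes _ = 0
  ... | no  _ = suc (indexOf gs f)

  indexOf-< : ∀ {gs f} → f ∈ gs → indexOf gs f < length gs
  indexOf-< {g ∷ gs} {f} f∈ with f ≟ˢ g | f∈
  ... | yes _ | _          = s≤s z≤n
  ... | no ne  | here refl  = contradiction refl ne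
  ... | no ne  | there f∈′  = s≤s (indexOf-< f∈′)

  indexOf-injective : ∀ {gs f h} → f ∈ gs → h ∈ gs → indexOf gs f ≡ indexOf gs h → f ≡ h
  indexOf-injective {g ∷ gs} {f} {h} f∈ h∈ eq with f ≟ˢ g | h ≟ˢ g | f∈ | h∈
  ... | yes refl | yes refl | _ | _ = refl
  ... | no ne | _ | here refl | _ = contradiction refl ne
  ... | _ | no ne | _ | here refl = contradiction refl ne
  ... | no _ | no _ | there f∈′ | there h∈′ = indexOf-injective f∈′ h∈′ (suc-injective eq)

module LightEntries (F : RankedAlphabet) (fs : List (Symbol F)) (R : ℕ) (T : Clusters.Table F) (ok : Clusters.OK F fs R T) where
  open Clusters F
  open Positions F

  labelsOf : List (Symbol F)
  labelsOf = deduplicate (RankedAlphabet._≟_ F) fs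

  σ β : ℕ
  σ = length labelsOf
  β = σ + R

  distinct : ∀ {f} → f ∈ fs → f ∈ labelsOf
  distinct = ∈-deduplicate⁺ (RankedAlphabet._≟_ F)

  -- The derivation tree of an entry, in Polish notation.
  data Word : ℕ → Entry → List ℕ → Set where
    term : ∀ {a f} → At T a (leafEntry f) → f ∈ fs → Word a (leafEntry f) (indexOf labelsOf f ∷ [])
    -- Only the position `i` is written, shifted past the `σ` digits for labels; `x` and `c` are
    -- determined by the two subwords.
    comp : ∀ {a x e i c d u v} → At T a (combine x e i c d) → i < R → Word x e u → Word c d v →
           Word a (combine x e i c d) (σ + i ∷ u ++ v)

  -- `k` decreases because a rule refers to entries with smaller numbers.
  word : ∀ k {a e} → a < k → At T a e → ∃ λ w → Word a e w
  word (suc k) (s≤s a≤k) p with OK-valid ok p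
  ... | term f∈ = _ , term p f∈
  ... | comp q r x< c< i< with u , wu ← word k (≤-trans x< a≤k) q | v , wv ← word k (≤-trans c< a≤k) r =
    _ , comp p (≤-trans i< (OK-rank ok q)) wu wv

  word-digits : ∀ {a e w} → Word a e w → All (_< β) w
  word-digits (term _ f∈)      = ≤-trans (indexOf-< (distinct f∈)) (m≤m+n σ R) ∷ []
  word-digits (comp _ i< u v) = +-monoʳ-< σ i< ∷ All.++⁺ (word-digits u) (word-digits v)

  word-length : ∀ {a e w} → Word a e w → suc (length w) ≡ 2 * wt e
  word-length (term _ _) = refl
  word-length (comp {e = e} {d = d} {u = u} {v} _ _ wu wv) = trans (cong (λ l → suc (suc l)) (length-++ u))
    (trans (sym (cong suc (+-suc (length u) (length v)))) (trans (cong₂ _+_ (word-length wu) (word-length wv)) (sym (*-distribˡ-+ 2 (wt e) (wt d)))))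

  -- The first digit tells a leaf from a composition, so Polish notation can be parsed without
  -- brackets. Equal parts have equal numbers by induction, and then `OK-unique` identifies the
  -- entries themselves.
  prefix-free : ∀ {a b d e u v} → Word a d u → Word b e v → ∀ {ys zs} → u ++ ys ≡ v ++ zs → a ≡ b × ys ≡ zs
  prefix-free (term p f∈) (term q g∈) eq with refl ← indexOf-injective (distinct f∈) (distinct g∈) (∷-injectiveˡ eq) =
    OK-unique ok p q refl , ∷-injectiveʳ eq
  prefix-free (term _ f∈) (comp _ _ _ _) eq =
    contradiction (≤-trans (indexOf-< (distinct f∈)) (m≤m+n σ _)) (<-irrefl (∷-injectiveˡ eq))
  prefix-free (comp _ _ _ _) (term _ f∈) eq =
    contradiction (≤-trans (indexOf-< (distinct f∈)) (m≤m+n σ _)) (<-irrefl (sym (∷-injectiveˡ eq)))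
  prefix-free (comp {u = u} {v} p _ wu wv) (comp {u = u′} {v′} q _ wu′ wv′) {ys} {zs} eq
    with refl ← +-cancelˡ-≡ σ _ _ (∷-injectiveˡ eq)
    with refl , eq′ ← prefix-free wu wu′ (trans (sym (++-assoc u v ys)) (trans (∷-injectiveʳ eq) (++-assoc u′ v′ zs)))
    with refl , eq″ ← prefix-free wv wv′ eq′ = OK-unique ok p q refl , eq″

  wordOf : ∀ A → ∃ λ w → Word (toℕ A) (List.lookup T A) w
  wordOf A = word (suc (toℕ A)) ≤-refl (At-lookup T A)

  number : Fin (length T) → ℕ
  number A = numeral β (proj₁ (wordOf A))

  number-injective : ∀ {A B} → number A ≡ number B → A ≡ B
  number-injective {A} {B} eq = toℕ-injective (proj₁ (prefix-free (proj₂ (wordOf A)) (proj₂ (wordOf B)) {[]} {[]}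
    (cong (_++ []) (numeral-injective β _ _ (word-digits (proj₂ (wordOf A))) (word-digits (proj₂ (wordOf B))) eq))))

  -- A derivation tree with `w` leaves has `w - 1` compositions, hence a word of `2 w - 1` digits.
  number-< : ∀ m A → wt (List.lookup T A) ≤ m → number A < suc β ^ (2 * m)
  number-< m A le = ≤-trans (numeral-< β _ (word-digits (proj₂ (wordOf A))))
    (^-monoʳ-≤ (suc β) (≤-trans (n≤1+n _) (≤-trans (≤-reflexive (word-length (proj₂ (wordOf A)))) (*-monoʳ-≤ 2 le))))

  lightIds : ℕ → List (Fin (length T)) → List (Fin (length T))
  lightIds m = filter (λ A → wt (List.lookup T A) ≤? m)

  light+heavy : ∀ m As → length (lightIds m As) + heavy m (map (List.lookup T) As) ≡ length As
  light+heavy m [] = refl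
  light+heavy m (A ∷ As) = go (wt (List.lookup T A) ≤? m)
    where
    light? = λ A → wt (List.lookup T A) ≤? m
    zero-bit : ∀ w → w ≤ m → bit (m <ᵇ w) ≡ 0
    zero-bit w le with m <ᵇ w | <ᵇ⇒< m w
    ... | false | _ = refl
    ... | true  | g = contradiction le (<⇒≱ (g _))
    one-bit : ∀ w → m < w → bit (m <ᵇ w) ≡ 1
    one-bit w lt with m <ᵇ w | <⇒<ᵇ lt
    ... | true | _ = refl
    go : Dec (wt (List.lookup T A) ≤ m) → length (lightIds m (A ∷ As)) + heavy m (map (List.lookup T) (A ∷ As)) ≡ length (A ∷ As)
    go (yes le) = trans (cong₂ (λ As′ k → length As′ + (k + heavy m (map (List.lookup T) As))) (filter-accept light? le) (zero-bit _ le))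
      (cong suc (light+heavy m As))
    go (no gt)  = trans (cong₂ (λ As′ k → length As′ + (k + heavy m (map (List.lookup T) As))) (filter-reject light? gt) (one-bit _ (≰⇒> gt)))
      (trans (+-suc _ _) (cong suc (light+heavy m As)))

  few-light : ∀ m → length T ≤ suc β ^ (2 * m) + heavy m T
  few-light m = ≤-trans (≤-reflexive (sym counted)) (+-mono-≤ few (≤-reflexive (cong (heavy m) lookups)))
    where
    As = allFin (length T)
    lookups : map (List.lookup T) As ≡ T
    lookups = trans (map-tabulate (λ A → A) (List.lookup T)) (tabulate-lookup T)
    counted : length (lightIds m As) + heavy m (map (List.lookup T) As) ≡ length T
    counted = trans (light+heavy m As) (trans (sym (length-map (List.lookup T) As)) (cong length lookups))
    few : length (lightIds m As) ≤ suc β ^ (2 * m)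
    few = ≤-trans (≤-reflexive (sym (length-map number (lightIds m As))))
      (pigeonhole (map number (lightIds m As)) (Unique.map⁺ number-injective (Unique.filter⁺ (λ A → wt (List.lookup T A) ≤? m) (Unique.allFin⁺ _)))
        (All.map⁺ (All.map (λ {A} le → number-< m A le) (All.all-filter (λ A → wt (List.lookup T A) ≤? m) As))))

-- Logarithms and the final estimates

2^≤⇒≤log : ∀ {k n} → 2 ^ k ≤ n → k ≤ ⌊log₂ n ⌋
2^≤⇒≤log {k} le = ≤-trans (≤-reflexive (sym (⌊log₂[2^n]⌋≡n k))) (⌊log₂⌋-mono-≤ le)

<2^suc-log : ∀ n → n < 2 ^ suc ⌊log₂ n ⌋
<2^suc-log n = ≰⇒> λ le → 1+n≰n (2^≤⇒≤log le)

2^log≤ : ∀ n → 1 ≤ n → 2 ^ ⌊log₂ n ⌋ ≤ n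
2^log≤ = <-rec (λ n → 1 ≤ n → 2 ^ ⌊log₂ n ⌋ ≤ n) go
  where
  go : ∀ n → (∀ {m} → m < n → 1 ≤ m → 2 ^ ⌊log₂ m ⌋ ≤ m) → 1 ≤ n → 2 ^ ⌊log₂ n ⌋ ≤ n
  go 1                     rec _ = ≤-refl
  go n@(suc (suc m)) rec _ = ≤-trans (≤-reflexive (cong (2 ^_) log≡)) (≤-trans (*-monoʳ-≤ 2 (rec (⌊n/2⌋<n (suc m)) (s≤s z≤n))) twice)
    where
    log≡ : ⌊log₂ n ⌋ ≡ suc ⌊log₂ ⌊ n /2⌋ ⌋
    log≡ = sym (trans (cong suc (⌊log₂⌊n/2⌋⌋≡⌊log₂n⌋∸1 n)) (m+[n∸m]≡n {1} (2^≤⇒≤log {1} {n} (s≤s (s≤s z≤n)))))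
    twice : 2 * ⌊ n /2⌋ ≤ n
    twice = ≤-trans (+-monoʳ-≤ ⌊ n /2⌋ (≤-trans (≤-reflexive (+-identityʳ _)) (⌊n/2⌋≤⌈n/2⌉ n))) (≤-reflexive (⌊n/2⌋+⌈n/2⌉≡n n))

n≤2^n : ∀ n → n ≤ 2 ^ n
n≤2^n zero    = z≤n
n≤2^n (suc n) = ≤-trans (+-mono-≤ (1≤2^ n) (n≤2^n n)) (≤-reflexive (cong (2 ^ n +_) (sym (+-identityʳ (2 ^ n)))))
  where
  1≤2^ : ∀ n → 1 ≤ 2 ^ n
  1≤2^ n = ^-monoʳ-≤ 2 (z≤n {n})

-- Six rounds halve the number of clusters, since `2 * 7 ^ 6 ≤ 8 ^ 6`. The exponent has the shape
-- that division by 6 produces.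
eighths : ∀ q s → 2 ^ q * 7 ^ (s + q * 6) ≤ 8 ^ (s + q * 6)
eighths zero    s = ≤-trans (≤-reflexive (*-identityˡ _)) (^-monoˡ-≤ (s + 0) (n≤1+n 7))
eighths (suc q) s = ≤-trans (≤-reflexive (trans (cong (λ z → 2 ^ suc q * z) (shift 7)) (rearrange (2 ^ q) (7 ^ (s + q * 6)) (7 ^ 6))))
  (≤-trans (*-mono-≤ (eighths q s) (≤ᵇ⇒≤ (2 * 7 ^ 6) (8 ^ 6) tt)) (≤-reflexive (sym (shift 8))))
  where
  shift : ∀ m → m ^ (s + suc q * 6) ≡ m ^ (s + q * 6) * m ^ 6
  shift m = trans (cong (m ^_) (trans (cong (s +_) (+-comm 6 (q * 6))) (sym (+-assoc s (q * 6) 6)))) (^-distribˡ-+-* m (s + q * 6) 6)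
  rearrange : ∀ a b c → 2 * a * (b * c) ≡ a * b * (2 * c)
  rearrange = solve-∀

-- With `q = j / 6`, the bound of `eighths` gives `2 ^ q ≤ n`. The remainder is at most 5, which is
-- at most five times the logarithm, whence `11 = 5 + 6`.
few-rounds : ∀ j c n → 2 ≤ n → 1 ≤ c → 8 ^ j * c ≤ 7 ^ j * n → j ≤ 11 * ⌊log₂ n ⌋
few-rounds j c n 2≤n 1≤c le = ≤-trans (≤-reflexive j≡) (≤-trans (+-mono-≤ (s≤s⁻¹ (m%n<n j 6)) (*-monoˡ-≤ 6 q≤))
  (≤-trans (+-monoˡ-≤ (⌊log₂ n ⌋ * 6) (m≤m*n 5 ⌊log₂ n ⌋ {{>-nonZero (2^≤⇒≤log {1} 2≤n)}})) (≤-reflexive (rearrange ⌊log₂ n ⌋))))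
  where
  q = j / 6
  j≡ : j ≡ j % 6 + q * 6
  j≡ = m≡m%n+[m/n]*n j 6
  rearrange : ∀ l → 5 * l + l * 6 ≡ 11 * l
  rearrange = solve-∀
  q≤ : q ≤ ⌊log₂ n ⌋
  q≤ = 2^≤⇒≤log (*-cancelʳ-≤ (2 ^ q) n (7 ^ j) {{m^n≢0 7 j}}
    (≤-trans (subst (λ i → 2 ^ q * 7 ^ i ≤ 8 ^ i) (sym j≡) (eighths q (j % 6)))
    (≤-trans (m≤m*n (8 ^ j) c {{>-nonZero 1≤c}}) (≤-trans le (≤-reflexive (*-comm (7 ^ j) n))))))

-- The number of table entries: L = length T, h m = heavy m T.

module _ (n σ R r : ℕ) (2≤n : 2 ≤ n) (2≤r : 2 ≤ r) (R≤r : R ≤ r) where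

  private
    ℓ = ⌊log₂ n ⌋
    a = ⌊log₂ (σ + r) ⌋
    b = ⌊log₂ r ⌋

  1≤a : 1 ≤ a
  1≤a = 2^≤⇒≤log {1} (≤-trans 2≤r (m≤n+m r σ))

  1≤b : 1 ≤ b
  1≤b = 2^≤⇒≤log {1} 2≤r

  1≤ℓ : 1 ≤ ℓ
  1≤ℓ = 2^≤⇒≤log {1} 2≤n

  -- A digit takes at most `2 * a` bits, so the words number at most `2 ^ h` with
  -- `h = 4 a m ≤ ℓ / 2`, about the square root of `n`. The remaining `g = ℓ ∸ h` bits pay for the
  -- factor `ℓ`, because `ℓ ≤ 2 g ≤ 2 * 2 ^ g`.
  few-words : ∀ m → m * (8 * a) ≤ ℓ → suc (σ + R) ^ (2 * m) * ℓ ≤ 2 * n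
  few-words m le = ≤-trans (*-mono-≤ words ℓ≤) (≤-trans (≤-reflexive product) (*-monoʳ-≤ 2 (2^log≤ n (≤-trans (s≤s z≤n) 2≤n))))
    where
    h g : ℕ
    h = 2 * a * (2 * m)
    g = ℓ ∸ h
    h+h≤ℓ : h + h ≤ ℓ
    h+h≤ℓ = ≤-trans (≤-reflexive (rearrange a m)) le
      where
      rearrange : ∀ a m → 2 * a * (2 * m) + 2 * a * (2 * m) ≡ m * (8 * a)
      rearrange = solve-∀
    h≤ℓ : h ≤ ℓ
    h≤ℓ = ≤-trans (m≤m+n h h) h+h≤ℓ
    words : suc (σ + R) ^ (2 * m) ≤ 2 ^ h
    words = ≤-trans (^-monoˡ-≤ (2 * m) (≤-trans (s≤s (+-monoʳ-≤ σ R≤r)) (≤-trans (<2^suc-log (σ + r))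
      (^-monoʳ-≤ 2 (≤-trans (+-monoˡ-≤ a 1≤a) (≤-reflexive (cong (a +_) (sym (+-identityʳ a)))))))))
      (≤-reflexive (^-*-assoc 2 (2 * a) (2 * m)))
    ℓ≤ : ℓ ≤ 2 * 2 ^ g
    ℓ≤ = ≤-trans (≤-reflexive (sym (m+[n∸m]≡n h≤ℓ))) (≤-trans (+-monoˡ-≤ g (≤-trans (≤-reflexive (sym (m+n∸n≡m h h))) (∸-monoˡ-≤ h h+h≤ℓ)))
      (≤-trans (≤-reflexive (cong (g +_) (sym (+-identityʳ g)))) (*-monoʳ-≤ 2 (n≤2^n g))))
    product : 2 ^ h * (2 * 2 ^ g) ≡ 2 * 2 ^ ℓ
    product = trans (rearrange (2 ^ h) (2 ^ g)) (cong (2 *_) (trans (sym (^-distribˡ-+-* 2 h g)) (cong (2 ^_) (m+[n∸m]≡n h≤ℓ))))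
      where
      rearrange : ∀ x y → x * (2 * y) ≡ 2 * (x * y)
      rearrange = solve-∀

  -- Cutting at `m = ℓ / (8 a)` leaves at most `2 n / ℓ` light entries and at most `2 K / m` heavy
  -- ones, which is of order `n a r / ℓ`. If this `m` is 0, then `ℓ ≤ 8 a` and the bound `2 * n` for
  -- all entries is good enough.
  entries-bound : ∀ L (h : ℕ → ℕ) → L ≤ 2 * n → (∀ m → L ≤ suc (σ + R) ^ (2 * m) + h m) →
    (∀ m → 0 < m → h m * m ≤ 2 * ((8 + 4 * R) * n)) → 2 * L * ℓ ≤ 520 * (n * a * r * b)
  entries-bound L h L≤2n light heavy = ≤-trans step (*-monoʳ-≤ 520 (m≤m*n (n * a * r) b {{>-nonZero 1≤b}}))
    where
    instance
      8a-nonZero : NonZero (8 * a)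
      8a-nonZero = >-nonZero (≤-trans 1≤a (m≤m+n a _))
    m = ℓ / (8 * a)
    ℓ≤ : ℓ ≤ suc m * (8 * a)
    ℓ≤ = ≤-trans (≤-reflexive (m≡m%n+[m/n]*n ℓ (8 * a))) (+-monoˡ-≤ (m * (8 * a)) (<⇒≤ (m%n<n ℓ (8 * a))))
    1≤ar : 1 ≤ a * r
    1≤ar = *-mono-≤ 1≤a (≤-trans (s≤s z≤n) 2≤r)
    n≤nar : n ≤ n * a * r
    n≤nar = ≤-trans (m≤m*n n (a * r) {{>-nonZero 1≤ar}}) (≤-reflexive (sym (*-assoc n a r)))
    R-bound : 8 + 4 * R ≤ 8 * r
    R-bound = ≤-trans (+-mono-≤ (*-monoʳ-≤ 4 2≤r) (*-monoʳ-≤ 4 R≤r)) (≤-reflexive (sym (*-distribʳ-+ r 4 4)))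
    step : 2 * L * ℓ ≤ 520 * (n * a * r)
    step with m in eq
    ... | zero = ≤-trans (*-mono-≤ (*-monoʳ-≤ 2 L≤2n) (≤-trans (subst (λ k → ℓ ≤ suc k * (8 * a)) eq ℓ≤) (≤-reflexive (+-identityʳ (8 * a)))))
          (≤-trans (≤-reflexive (rearrange n a)) (≤-trans (*-monoʳ-≤ 32 (m≤m*n (n * a) r {{>-nonZero (≤-trans (s≤s z≤n) 2≤r)}}))
            (*-monoˡ-≤ (n * a * r) (≤ᵇ⇒≤ 32 520 tt))))
      where
      rearrange : ∀ n a → 2 * (2 * n) * (8 * a) ≡ 32 * (n * a)
      rearrange = solve-∀
    ... | suc m′ = ≤-trans (*-monoˡ-≤ ℓ (*-monoʳ-≤ 2 (light (suc m′)))) (≤-trans (≤-reflexive (distribute X H ℓ))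
          (≤-trans (+-mono-≤ (*-monoʳ-≤ 2 words≤) (*-monoʳ-≤ 2 heavy≤)) (≤-trans (≤-reflexive (collect n (n * a * r))) total≤)))
      where
      X = suc (σ + R) ^ (2 * suc m′)
      H = h (suc m′)
      words≤ : X * ℓ ≤ 2 * n
      words≤ = few-words (suc m′) (subst (λ k → k * (8 * a) ≤ ℓ) eq (m/n*n≤m ℓ (8 * a)))
      -- With the cut `m = suc m′`: `H m ≤ 2 K ≤ 16 r n` and `ℓ ≤ (m + 1) * 8 a ≤ 16 a m`, hence
      -- `256 = 16 * 16`.
      heavy≤ : H * ℓ ≤ 256 * (n * a * r)
      heavy≤ = ≤-trans (*-monoʳ-≤ H (≤-trans (subst (λ k → ℓ ≤ suc k * (8 * a)) eq ℓ≤)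
          (*-monoˡ-≤ (8 * a) (≤-trans (≤-reflexive (+-comm 1 (suc m′))) (≤-trans (+-monoʳ-≤ (suc m′) (s≤s z≤n)) (≤-reflexive (sym (twice (suc m′)))))))))
        (≤-trans (≤-reflexive (rearrange₁ H (suc m′) a)) (≤-trans (*-monoˡ-≤ (16 * a) (heavy (suc m′) (s≤s z≤n)))
          (≤-trans (*-monoˡ-≤ (16 * a) (*-monoʳ-≤ 2 (*-monoˡ-≤ n R-bound))) (≤-reflexive (rearrange₂ n a r)))))
        where
        twice : ∀ k → 2 * k ≡ k + k
        twice = solve-∀
        rearrange₁ : ∀ h k a → h * (2 * k * (8 * a)) ≡ h * k * (16 * a)
        rearrange₁ = solve-∀
        rearrange₂ : ∀ n a r → 2 * (8 * r * n) * (16 * a) ≡ 256 * (n * a * r)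
        rearrange₂ = solve-∀
      distribute : ∀ x h l → 2 * (x + h) * l ≡ 2 * (x * l) + 2 * (h * l)
      distribute = solve-∀
      collect : ∀ n p → 2 * (2 * n) + 2 * (256 * p) ≡ 4 * n + 512 * p
      collect = solve-∀
      total≤ : 4 * n + 512 * (n * a * r) ≤ 520 * (n * a * r)
      total≤ = ≤-trans (+-monoˡ-≤ (512 * (n * a * r)) (*-monoʳ-≤ 4 n≤nar)) (≤-trans (≤-reflexive (sym (*-distribʳ-+ (n * a * r) 4 512)))
        (*-monoˡ-≤ (n * a * r) (≤ᵇ⇒≤ 516 520 tt)))

  depth-of-rounds : ∀ D j → D ≤ 1 + R * j → j ≤ 11 * ℓ → D ≤ 12 * (r * ℓ)
  depth-of-rounds D j D≤ j≤ = ≤-trans D≤ (≤-trans (+-mono-≤ (*-mono-≤ (≤-trans (s≤s z≤n) 2≤r) 1≤ℓ) (*-mono-≤ R≤r j≤)) (≤-reflexive (rearrange r ℓ)))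
    where
    rearrange : ∀ r l → r * l + r * (11 * l) ≡ 12 * (r * l)
    rearrange = solve-∀

open State

-- An imperative language with arrays

data Expr : Set where
  lit var : ℕ → Expr
  op      : Op → Expr → Expr → Expr
  _[[_]]  : ℕ → Expr → Expr

data Cmd : Set where
  set     : ℕ → Expr → Cmd
  write   : ℕ → Expr → Expr → Cmd
  readIO  : ℕ → Expr → Cmd
  writeIO : Expr → Expr → Cmd
  _⍮_     : Cmd → Cmd → Cmd
  if      : Expr → Expr → Cmd → Cmd → Cmd
  while   : Expr → Expr → Cmd → Cmd
  nop     : Cmd

infixr 4 _⍮_

-- The array io holds the input and the output of the program; it is the
-- initial segment of the memory.
record Store : Set where
  constructor ⟪_,_,_⟫
  field
    vars   : ℕ → ℕ
    arrays : ℕ → ℕ → ℕ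
    io     : ℕ → ℕ

open Store

eval : Expr → Store → ℕ
eval (lit c)    s = c
eval (var x)    s = vars s x
eval (op o a b) s = evalOp o (eval a s) (eval b s)
eval (c [[ e ]]) s = arrays s c (eval e s)

setVar : ℕ → ℕ → Store → Store
setVar x v s = ⟪ vars s [ x ↦ v ] , arrays s , io s ⟫

setCell : ℕ → ℕ → ℕ → Store → Store
setCell c i v s = ⟪ vars s , (λ d j → if (d ≡ᵇ c) ∧ (j ≡ᵇ i) then v else arrays s d j) , io s ⟫

setIO : ℕ → ℕ → Store → Store
setIO i v s = ⟪ vars s , arrays s , io s [ i ↦ v ] ⟫

-- Register 40 contains the first address used for arrays, register 41
-- contains 0; from 42 on there are registers for intermediate results.
-- The arrays are interleaved: cell i of array c is at address base + 16 i + c.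

locate : ℕ → Reg → Program
locate c t =
  const (suc t) 16 ⨾ arith t mul t (suc t) ⨾ const (suc t) c ⨾ arith t add t (suc t) ⨾ arith t add t 40

compileExpr : Expr → Reg → Program
compileExpr (lit c)     t = const t c
compileExpr (var x)     t = arith t add x 41
compileExpr (op o a b)  t = compileExpr a t ⨾ compileExpr b (suc t) ⨾ arith t o t (suc t)
compileExpr (c [[ e ]]) t = compileExpr e t ⨾ locate c t ⨾ load t t

compileTest : Expr → Expr → Program
compileTest a b = compileExpr a 42 ⨾ compileExpr b 43

compile : Cmd → Program
compile (set x e)     = compileExpr e 42 ⨾ arith x add 42 41
compile (write c a b) = compileExpr a 42 ⨾ locate c 42 ⨾ compileExpr b 43 ⨾ store 42 43
compile (readIO x e)  = compileExpr e 42 ⨾ load x 42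
compile (writeIO a b) = compileTest a b ⨾ store 42 43
compile (P ⍮ Q)       = compile P ⨾ compile Q
compile (if a b P Q)  = compileTest a b ⨾ ifLess 42 43 (compile P) (compile Q)
-- `whileLess` compares registers, so both sides are evaluated before the loop and again at the end
-- of each pass.
compile (while a b P) = compileTest a b ⨾ whileLess 42 43 (compile P ⨾ compileTest a b)
compile nop           = skip

exprCost : Expr → ℕ
exprCost (lit c)     = 1
exprCost (var x)     = 1
exprCost (op o a b)  = exprCost a + (exprCost b + 1)
exprCost (c [[ e ]]) = exprCost e + (5 + 1)

testCost : Expr → Expr → ℕ
testCost a b = exprCost a + exprCost b

cost : Cmd → ℕ
cost (set x e)     = exprCost e + 1
cost (write c a b) = exprCost a + (5 + (exprCost b + 1))
cost (readIO x e)  = exprCost e + 1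
cost (writeIO a b) = testCost a b + 1
cost (P ⍮ Q)       = cost P + cost Q
cost (if a b P Q)  = testCost a b + suc (cost P ⊔ cost Q)
-- A default value: `wp` is false for loops, whose time is counted by `while-yes-rule` and
-- `while-no-rule`.
cost (while a b P) = 0
cost nop           = 1

-- If all variables and cells are below b, then the value of e is below
-- b ^ degree e.
degree : Expr → ℕ
degree (lit c)         = 1
degree (var x)         = 1
degree (op add a b)    = degree a + degree b
degree (op monus a b)  = degree a
degree (op mul a b)    = degree a + degree b
degree (op div a b)    = degree a
degree (c [[ e ]])     = 1

-- Boolean tests let the proof be inferred for a concrete program. Degree at most 16 keeps all
-- intermediate values below `b ^ 16`; the largest expression of the program, `permitted`, has
-- degree 11.
AdmissibleExpr : Expr → Set
AdmissibleExpr (lit c)     = T (c <ᵇ 32)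
AdmissibleExpr (var x)     = T (x <ᵇ 40)
AdmissibleExpr (op o a b)  = AdmissibleExpr a × AdmissibleExpr b × T (degree (op o a b) ≤ᵇ 16)
AdmissibleExpr (c [[ e ]]) = AdmissibleExpr e × T (c <ᵇ 16)

Admissible : Cmd → Set
Admissible (set x e)     = T (x <ᵇ 40) × AdmissibleExpr e
Admissible (write c a b) = T (c <ᵇ 16) × AdmissibleExpr a × AdmissibleExpr b
Admissible (readIO x e)  = T (x <ᵇ 40) × AdmissibleExpr e
Admissible (writeIO a b) = AdmissibleExpr a × AdmissibleExpr b
Admissible (P ⍮ Q)       = Admissible P × Admissible Q
Admissible (if a b P Q)  = AdmissibleExpr a × AdmissibleExpr b × Admissible P × Admissible Q
Admissible (while a b P) = AdmissibleExpr a × AdmissibleExpr b × Admissible P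
Admissible nop           = ⊤

-- Soundness of the compiler

update-same : ∀ (f : ℕ → ℕ) a v → (f [ a ↦ v ]) a ≡ v
update-same f a v with a ≡ᵇ a in eq
... | true  = refl
... | false with () ← subst T eq (≡⇒≡ᵇ a a refl)

update-other : ∀ (f : ℕ → ℕ) a v {b} → b ≢ a → (f [ a ↦ v ]) b ≡ f b
update-other f a v {b} b≢a with b ≡ᵇ a in eq
... | true  = contradiction (≡ᵇ⇒≡ b a (subst T (sym eq) tt)) b≢a
... | false = refl

update-cong : ∀ {f g : ℕ → ℕ} {a v w b} → (b ≢ a → f b ≡ g b) → v ≡ w → (f [ a ↦ v ]) b ≡ (g [ a ↦ w ]) b
update-cong {a = a} {b = b} f≡g refl with b ≡ᵇ a in eq
... | true  = refl
... | false = f≡g λ { refl → subst T eq (≡⇒≡ᵇ a a refl) }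

update-< : ∀ {f : ℕ → ℕ} {a v B} → v < B → (∀ x → f x < B) → ∀ x → (f [ a ↦ v ]) x < B
update-< {a = a} v<B f<B x with x ≡ᵇ a
... | true  = v<B
... | false = f<B x

-- Both `x + y` and `x * y` are less than `(1 + x) * (1 + y)`.
^-sum-bound : ∀ {b x y} d e → 0 < b → x < b ^ d → y < b ^ e → x + y < b ^ (d + e) × x * y < b ^ (d + e)
^-sum-bound {b} {x} {y} d e 0<b x< y< = subst (λ z → x + y < z × x * y < z) (sym (^-distribˡ-+-* b d e))
  (≤-trans (s≤s lemma) (*-mono-≤ x< y<) , ≤-trans (s≤s (≤-trans (m≤m+n (x * y) x) (≤-reflexive (+-comm (x * y) x)))) (≤-trans (s≤s lemma2) (*-mono-≤ x< y<)))
  where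
  lemma : x + y ≤ y + x * suc y
  lemma = ≤-trans (≤-reflexive (+-comm x y)) (+-monoʳ-≤ y (≤-trans (≤-reflexive (sym (*-identityʳ x))) (*-monoʳ-≤ x (s≤s z≤n))))
  lemma2 : x + x * y ≤ y + x * suc y
  lemma2 = ≤-trans (≤-reflexive (sym (*-suc x y))) (m≤n+m _ y)

module Machine (W base b : ℕ) (32≤b : 32 ≤ b) (fits : 16 * b ^ 16 + 16 + base ≤ W) where

  0<b : 0 < b
  0<b = ≤-trans (s≤s z≤n) 32≤b

  instance
    b-nonZero : NonZero b
    b-nonZero = >-nonZero 0<b

  bound<W : ∀ {d x} → d ≤ 16 → x < b ^ d → x < W
  bound<W {d} d≤16 x< = ≤-trans x< (≤-trans (^-monoʳ-≤ b d≤16)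
    (≤-trans (m≤m*n (b ^ 16) 16) (≤-trans (≤-reflexive (*-comm (b ^ 16) 16))
      (≤-trans (m≤m+n _ 16) (≤-trans (m≤m+n _ base) fits)))))

  b<W : ∀ {x} → x < b → x < W
  b<W x<b = bound<W {1} (s≤s z≤n) (≤-trans x<b (≤-reflexive (sym (*-identityʳ b))))

  <32 : ∀ {c} → T (c <ᵇ 32) → c < b
  <32 {c} c< = ≤-trans (<ᵇ⇒< c 32 c<) 32≤b

  16<W : 16 < W
  16<W = b<W (<32 tt)

  record Bounded (s : Store) : Set where
    field
      vars<   : ∀ x → vars s x < b
      arrays< : ∀ c i → arrays s c i < b
      io<     : ∀ i → io s i < b
  open Bounded

  degree≤16 : ∀ e → AdmissibleExpr e → degree e ≤ 16
  degree≤16 (lit c)     ok = s≤s z≤n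
  degree≤16 (var x)     ok = s≤s z≤n
  degree≤16 (op o a b)  (_ , _ , ok) = ≤ᵇ⇒≤ _ 16 ok
  degree≤16 (c [[ e ]]) ok = s≤s z≤n

  eval-bound : ∀ e {s} → Bounded s → AdmissibleExpr e → eval e s < b ^ degree e
  eval-bound (lit c) B ok = ≤-trans (<32 ok) (≤-reflexive (sym (*-identityʳ b)))
  eval-bound (var x) B ok = ≤-trans (vars< B x) (≤-reflexive (sym (*-identityʳ b)))
  eval-bound (op add e f) B (oke , okf , _) =
    proj₁ (^-sum-bound (degree e) (degree f) 0<b (eval-bound e B oke) (eval-bound f B okf))
  eval-bound (op mul e f) B (oke , okf , _) =
    proj₂ (^-sum-bound (degree e) (degree f) 0<b (eval-bound e B oke) (eval-bound f B okf))
  eval-bound (op monus e f) {s} B (oke , _) = ≤-<-trans (m∸n≤m (eval e s) (eval f s)) (eval-bound e B oke)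
  eval-bound (op div e f) {s} B (oke , _) with eval f s
  ... | zero  = ≤-<-trans z≤n (eval-bound e B oke)
  ... | suc m = ≤-<-trans (m/n≤m (eval e s) (suc m)) (eval-bound e B oke)
  eval-bound (c [[ e ]]) {s} B ok = ≤-trans (arrays< B c (eval e s)) (≤-reflexive (sym (*-identityʳ b)))

  eval<W : ∀ e {s} → Bounded s → AdmissibleExpr e → eval e s < W
  eval<W e B ok = bound<W (degree≤16 e ok) (eval-bound e B ok)

  address : ℕ → ℕ → ℕ
  address c i = i * 16 + c + base

  record Simulates (s : Store) (σ : State) : Set where
    field
      vars≈   : ∀ x → x < 40 → reg σ x ≡ vars s x
      base≈   : reg σ 40 ≡ base
      zero≈   : reg σ 41 ≡ 0
      arrays≈ : ∀ c i → c < 16 → mem σ (address c i) ≡ arrays s c i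
      io≈     : ∀ i → i < base → mem σ i ≡ io s i
      bounded : Bounded s
  open Simulates

  preserve : ∀ {s σ σ′} → Simulates s σ → (∀ y → y < 42 → reg σ′ y ≡ reg σ y) → mem σ′ ≡ mem σ → Simulates s σ′
  preserve S same refl = record
    { vars≈   = λ x x<40 → trans (same x (<-trans x<40 (<ᵇ⇒< 40 42 tt))) (vars≈ S x x<40)
    ; base≈   = trans (same 40 (<ᵇ⇒< 40 42 tt)) (base≈ S)
    ; zero≈   = trans (same 41 (<ᵇ⇒< 41 42 tt)) (zero≈ S)
    ; arrays≈ = arrays≈ S
    ; io≈     = io≈ S
    ; bounded = bounded S
    }

  -- The registers from `t` on are the evaluation stack of expressions, so only those below `t` have
  -- to survive.
  Computes : Program → State → ℕ → Reg → ℕ → Set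
  Computes P σ k t v = Σ State λ σ′ → Exec W P σ k σ′ × reg σ′ t ≡ v ×
    (∀ y → y < t → reg σ′ y ≡ reg σ y) × mem σ′ ≡ mem σ

  locate-computes : ∀ c t {σ v} → 42 ≤ t → c < 16 → reg σ t ≡ v → v < b ^ 16 → reg σ 40 ≡ base →
    Computes (locate c t) σ 5 t (address c v)
  locate-computes c t {σ} {v} 42≤t c<16 refl v< refl =
    _ , (const 16<W ⨾ arith (subst (_< W) (sym e₁) l₁) ⨾ const (<-trans c<16 16<W) ⨾
        arith (subst (_< W) (sym e₂) l₂) ⨾ arith (subst (_< W) (sym e₃) l₃)) ,
    trans (update-same ρ₄ t (ρ₄ t + ρ₄ 40)) e₃ ,
    (λ y y<t → trans (update-other ρ₄ t (ρ₄ t + ρ₄ 40) (<⇒≢ y<t)) (below y y<t)) ,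
    refl
    where
    ρ₁ ρ₂ ρ₃ ρ₄ : ℕ → ℕ
    ρ₁ = reg σ [ suc t ↦ 16 ]
    ρ₂ = ρ₁ [ t ↦ ρ₁ t * ρ₁ (suc t) ]
    ρ₃ = ρ₂ [ suc t ↦ c ]
    ρ₄ = ρ₃ [ t ↦ ρ₃ t + ρ₃ (suc t) ]
    below : ∀ y → y < t → ρ₄ y ≡ reg σ y
    below y y<t = trans (update-other ρ₃ t (ρ₃ t + ρ₃ (suc t)) (<⇒≢ y<t))
      (trans (update-other ρ₂ (suc t) c (<⇒≢ (m≤n⇒m≤1+n y<t))) (trans (update-other ρ₁ t (ρ₁ t * ρ₁ (suc t)) (<⇒≢ y<t))
        (update-other (reg σ) (suc t) 16 (<⇒≢ (m≤n⇒m≤1+n y<t)))))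
    t≢ : t ≢ suc t
    t≢ = <⇒≢ ≤-refl
    40< : 40 < t
    40< = ≤-trans (<ᵇ⇒< 40 42 tt) 42≤t
    e₁ : ρ₁ t * ρ₁ (suc t) ≡ reg σ t * 16
    e₁ = cong₂ _*_ (update-other (reg σ) (suc t) 16 t≢) (update-same (reg σ) (suc t) 16)
    e₂ : ρ₃ t + ρ₃ (suc t) ≡ reg σ t * 16 + c
    e₂ = cong₂ _+_ (trans (update-other ρ₂ (suc t) c t≢) (trans (update-same ρ₁ t (ρ₁ t * ρ₁ (suc t))) e₁)) (update-same ρ₂ (suc t) c)
    e₃ : ρ₄ t + ρ₄ 40 ≡ reg σ t * 16 + c + reg σ 40
    e₃ = cong₂ _+_ (trans (update-same ρ₃ t (ρ₃ t + ρ₃ (suc t))) e₂) (below 40 40<)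
    m₁ : reg σ t * 16 ≤ 16 * b ^ 16
    m₁ = ≤-trans (*-monoˡ-≤ 16 (<⇒≤ v<)) (≤-reflexive (*-comm (b ^ 16) 16))
    l₃ : reg σ t * 16 + c + reg σ 40 < W
    l₃ = ≤-trans (s≤s (+-monoˡ-≤ (reg σ 40) (+-monoˡ-≤ c m₁))) (≤-trans (+-monoˡ-≤ (reg σ 40) (+-monoʳ-< (16 * b ^ 16) c<16)) fits)
    l₂ : reg σ t * 16 + c < W
    l₂ = ≤-<-trans (m≤m+n _ (reg σ 40)) l₃
    l₁ : reg σ t * 16 < W
    l₁ = ≤-<-trans (m≤m+n _ c) l₂

  expr-computes : ∀ e t {s σ} → 42 ≤ t → AdmissibleExpr e → Simulates s σ →
    Computes (compileExpr e t) σ (exprCost e) t (eval e s)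
  expr-computes (lit c) t {s} {σ} 42≤t ok S =
    _ , const (b<W (<32 ok)) , update-same (reg σ) t c , (λ y y<t → update-other (reg σ) t c (<⇒≢ y<t)) , refl
  expr-computes (var x) t {s} {σ} 42≤t ok S =
    _ , arith (subst (_< W) (sym eq) (b<W (vars< (bounded S) x))) , trans (update-same (reg σ) t _) eq ,
    (λ y y<t → update-other (reg σ) t (reg σ x + reg σ 41) (<⇒≢ y<t)) , refl
    where
    eq : reg σ x + reg σ 41 ≡ vars s x
    eq = trans (cong₂ _+_ (vars≈ S x (<ᵇ⇒< x 40 ok)) (zero≈ S)) (+-identityʳ _)
  expr-computes (op o e f) t {s} {σ} 42≤t ok@(oke , okf , _) S
    with σ₁ , E₁ , v₁ , same₁ , m₁ ← expr-computes e t 42≤t oke S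
    with σ₂ , E₂ , v₂ , same₂ , m₂ ← expr-computes f (suc t) (m≤n⇒m≤1+n 42≤t) okf
           (preserve S (λ y y<42 → same₁ y (≤-trans y<42 42≤t)) m₁)
    = _ , (E₁ ⨾ E₂ ⨾ arith (subst (_< W) (sym eq) (eval<W (op o e f) (bounded S) ok))) ,
      trans (update-same (reg σ₂) t _) eq ,
      (λ y y<t → trans (update-other (reg σ₂) t (evalOp o (reg σ₂ t) (reg σ₂ (suc t))) (<⇒≢ y<t)) (trans (same₂ y (m≤n⇒m≤1+n y<t)) (same₁ y y<t))) ,
      trans m₂ m₁
    where
    eq : evalOp o (reg σ₂ t) (reg σ₂ (suc t)) ≡ eval (op o e f) s
    eq = cong₂ (evalOp o) (trans (same₂ t ≤-refl) v₁) v₂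
  expr-computes (c [[ e ]]) t {s} {σ} 42≤t (oke , c<) S
    with σ₁ , E₁ , v₁ , same₁ , m₁ ← expr-computes e t 42≤t oke S
    with σ₂ , E₂ , v₂ , same₂ , m₂ ← locate-computes c t {σ₁} 42≤t (<ᵇ⇒< c 16 c<) v₁
           (≤-trans (eval-bound e (bounded S) oke) (^-monoʳ-≤ b (degree≤16 e oke)))
           (trans (same₁ 40 (≤-trans (<ᵇ⇒< 40 42 tt) 42≤t)) (base≈ S))
    = _ , (E₁ ⨾ E₂ ⨾ load (subst (_< W) (sym eq) (b<W (arrays< (bounded S) c _)))) ,
      trans (update-same (reg σ₂) t _) eq ,
      (λ y y<t → trans (update-other (reg σ₂) t (mem σ₂ (reg σ₂ t)) (<⇒≢ y<t)) (trans (same₂ y y<t) (same₁ y y<t))) ,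
      trans m₂ m₁
    where
    eq : mem σ₂ (reg σ₂ t) ≡ arrays s c (eval e s)
    eq = trans (cong₂ (λ f x → f x) (trans m₂ m₁) v₂) (arrays≈ S c _ (<ᵇ⇒< c 16 c<))

  -- A Hoare triple for total correctness with a time bound. The post-condition may itself be a
  -- `Run` of what remains of the program; this is how `run-seq` composes commands and how loops are
  -- unfolded.
  record Run (P : Cmd) (s : Store) (k : ℕ) (Q : Store → Set) : Set where
    constructor ran
    field
      execute : ∀ {σ} → Simulates s σ → Σ ℕ λ l → Σ State λ σ′ → Σ Store λ s′ →
        l ≤ k × Exec W (compile P) σ l σ′ × Simulates s′ σ′ × Q s′
  open Run

  run-weaken : ∀ {P s k l Q} → k ≤ l → Run P s k Q → Run P s l Q
  run-weaken k≤l run = ran λ S → let j , σ′ , s′ , j≤k , rest = execute run S in j , σ′ , s′ , ≤-trans j≤k k≤l , rest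

  run-map : ∀ {P s k Q R} → (∀ s → Q s → R s) → Run P s k Q → Run P s k R
  run-map f run = ran λ S → let j , σ′ , s′ , j≤k , E , S′ , q = execute run S in j , σ′ , s′ , j≤k , E , S′ , f s′ q

  run-seq : ∀ {P Q s k l R} → Run P s k (λ s′ → Run Q s′ l R) → Run (P ⍮ Q) s (k + l) R
  run-seq run = ran λ S →
    let j₁ , σ₁ , s₁ , j₁≤ , E₁ , S₁ , run₂ = execute run S
        j₂ , σ₂ , s₂ , j₂≤ , E₂ , S₂ , q = execute run₂ S₁
    in j₁ + j₂ , σ₂ , s₂ , +-mono-≤ j₁≤ j₂≤ , (E₁ ⨾ E₂) , S₂ , q

  test-computes : ∀ a b {s σ} → AdmissibleExpr a → AdmissibleExpr b → Simulates s σ →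
    Σ State λ σ′ → Exec W (compileTest a b) σ (testCost a b) σ′ ×
      reg σ′ 42 ≡ eval a s × reg σ′ 43 ≡ eval b s × Simulates s σ′
  test-computes a b {s} oka okb S
    with σ₁ , E₁ , v₁ , same₁ , m₁ ← expr-computes a 42 ≤-refl oka S
    with σ₂ , E₂ , v₂ , same₂ , m₂ ← expr-computes b 43 (n≤1+n 42) okb (preserve S same₁ m₁)
    = σ₂ , (E₁ ⨾ E₂) , trans (same₂ 42 ≤-refl) v₁ , v₂ ,
      preserve S (λ y y<42 → trans (same₂ y (m≤n⇒m≤1+n y<42)) (same₁ y y<42)) (trans m₂ m₁)

  -- A run of the loop from `s′` begins with the test. In the compiled program this test closes the
  -- pass before, so the run is cut after its test and regrouped.
  while-yes-rule : ∀ {a b P s k l Q} → AdmissibleExpr a → AdmissibleExpr b → eval a s < eval b s →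
    Run P s k (λ s′ → Run (while a b P) s′ l Q) → Run (while a b P) s (testCost a b + suc k + l) Q
  execute (while-yes-rule {a} {b} {k = k} {l = l} oka okb a<b run) S
    with σ₀ , E₀ , v , w , S₀ ← test-computes a b oka okb S
    with j₁ , σ₁ , s₁ , j₁≤ , E₁ , S₁ , run₂ ← execute run S₀
    with _ , σ₂ , s₂ , j₂≤ , (_⨾_ {T = t₁} {T′ = t₂} Et Ew) , S₂ , q ← execute run₂ S₁
    = _ , σ₂ , s₂ ,
      ≤-trans (≤-reflexive (rearrange (testCost a b) j₁ t₁ t₂))
        (+-mono-≤ (+-monoʳ-≤ (testCost a b) (s≤s j₁≤)) j₂≤) ,
      (E₀ ⨾ while-yes (subst₂ _<_ (sym v) (sym w) a<b) (E₁ ⨾ Et) Ew) , S₂ , q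
    where
    rearrange : ∀ c j t₁ t₂ → c + (1 + ((j + t₁) + t₂)) ≡ c + suc j + (t₁ + t₂)
    rearrange = solve-∀

  while-no-rule : ∀ {a b P s Q} → AdmissibleExpr a → AdmissibleExpr b → ¬ eval a s < eval b s →
    Q s → Run (while a b P) s (testCost a b + 1) Q
  execute (while-no-rule {a} {b} {s = s} oka okb a≮b q) S
    with σ₀ , E₀ , v , w , S₀ ← test-computes a b oka okb S
    = _ , σ₀ , s , ≤-refl , (E₀ ⨾ while-no (λ lt → a≮b (subst₂ _<_ v w lt))) , S₀ , q

  -- Cells, variables and literals are known to be below b.
  ResultBounded : Expr → Store → Set
  ResultBounded e s = if degree e ≤ᵇ 1 then ⊤ else eval e s < b

  -- Weakest preconditions of loop-free commands. For a concrete command this computes to the bounds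
  -- that are not evident, followed by the post-condition; loops are treated by induction on the
  -- data instead.
  wp : Cmd → Store → (Store → Set) → Set
  wp (set x e)       s Q = ResultBounded e s × Q (setVar x (eval e s) s)
  wp (write c e f)   s Q = ResultBounded f s × Q (setCell c (eval e s) (eval f s) s)
  wp (readIO x e)    s Q = eval e s < base × Q (setVar x (io s (eval e s)) s)
  wp (writeIO e f)   s Q = eval e s < base × ResultBounded f s × Q (setIO (eval e s) (eval f s) s)
  wp (P ⍮ P′)        s Q = wp P s λ s′ → wp P′ s′ Q
  wp (if e f P P′)   s Q = (eval e s < eval f s → wp P s Q) × (eval f s ≤ eval e s → wp P′ s Q)
  wp (while e f P)   s Q = ⊥
  wp nop             s Q = Q s

  wp-mono : ∀ P {s} Q R → (∀ s → Q s → R s) → wp P s Q → wp P s R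
  wp-mono (set x e)     Q R f (bd , q)       = bd , f _ q
  wp-mono (write c e g) Q R f (bd , q)       = bd , f _ q
  wp-mono (readIO x e)  Q R f (lt , q)       = lt , f _ q
  wp-mono (writeIO e g) Q R f (lt , bd , q)  = lt , bd , f _ q
  wp-mono (P ⍮ P′)      Q R f p              = wp-mono P _ _ (λ s → wp-mono P′ Q R f) p
  wp-mono (if e g P P′) Q R f (u , v)        = (λ lt → wp-mono P Q R f (u lt)) , (λ le → wp-mono P′ Q R f (v le))
  wp-mono nop           Q R f q              = f _ q

  result<b : ∀ e {s} → Bounded s → AdmissibleExpr e → ResultBounded e s → eval e s < b
  result<b e {s} B ok bd with degree e ≤ᵇ 1 in eq
  ... | false = bd
  ... | true  = ≤-trans (eval-bound e B ok) (≤-trans (^-monoʳ-≤ b (≤ᵇ⇒≤ (degree e) 1 (subst T (sym eq) tt)))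
                  (≤-reflexive (*-identityʳ b)))

  setVar-simulates : ∀ {s σ σ′} x {v} → x < 40 → v < b → Simulates s σ →
    (∀ y → reg σ′ y ≡ (reg σ [ x ↦ v ]) y) → mem σ′ ≡ mem σ → Simulates (setVar x v s) σ′
  setVar-simulates {s} {σ} x {v} x<40 v<b S r refl = record
    { vars≈   = λ y y<40 → trans (r y) (update-cong {reg σ} {vars s} {x} {b = y} (λ _ → vars≈ S y y<40) refl)
    ; base≈   = trans (r 40) (trans (update-other (reg σ) x v (≢-sym (<⇒≢ x<40))) (base≈ S))
    ; zero≈   = trans (r 41) (trans (update-other (reg σ) x v (≢-sym (<⇒≢ (m≤n⇒m≤1+n x<40)))) (zero≈ S))
    ; arrays≈ = arrays≈ S
    ; io≈     = io≈ S
    ; bounded = record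
      { vars<   = update-< v<b (vars< (bounded S))
      ; arrays< = arrays< (bounded S)
      ; io<     = io< (bounded S)
      }
    }

  address-injective : ∀ {c d} i j → c < 16 → d < 16 → address c i ≡ address d j → c ≡ d × i ≡ j
  address-injective {c} {d} i j c< d< eq = go i j (+-cancelʳ-≡ base _ _ eq)
    where
    go : ∀ i j → i * 16 + c ≡ j * 16 + d → c ≡ d × i ≡ j
    go zero    zero    eq = eq , refl
    go zero    (suc j) eq = contradiction (≤-trans (m≤m+n 16 (j * 16 + d)) (≤-reflexive (sym eq))) (<⇒≱ c<)
    go (suc i) zero    eq = contradiction (≤-trans (m≤m+n 16 (i * 16 + c)) (≤-reflexive eq)) (<⇒≱ d<)
    go (suc i) (suc j) eq with refl , refl ← go i j (+-cancelˡ-≡ 16 _ _ eq) = refl , refl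

  setCell-simulates : ∀ {s σ σ′} c i {v} → c < 16 → v < b → Simulates s σ →
    (∀ y → y < 42 → reg σ′ y ≡ reg σ y) → mem σ′ ≡ mem σ [ address c i ↦ v ] → Simulates (setCell c i v s) σ′
  setCell-simulates {s} {σ} c i {v} c<16 v<b S r refl = record
    { vars≈   = λ x x<40 → trans (r x (<-trans x<40 (<ᵇ⇒< 40 42 tt))) (vars≈ S x x<40)
    ; base≈   = trans (r 40 (<ᵇ⇒< 40 42 tt)) (base≈ S)
    ; zero≈   = trans (r 41 (<ᵇ⇒< 41 42 tt)) (zero≈ S)
    ; arrays≈ = arr
    ; io≈     = λ j j<base → trans (update-other (mem σ) (address c i) v
                  (<⇒≢ (≤-trans j<base (m≤n+m base (i * 16 + c))))) (io≈ S j j<base)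
    ; bounded = record
      { vars<   = vars< (bounded S)
      ; arrays< = arr<
      ; io<     = io< (bounded S)
      }
    }
    where
    arr< : ∀ d j → arrays (setCell c i v s) d j < b
    arr< d j with d ≡ᵇ c
    ... | false = arrays< (bounded S) d j
    ... | true  = update-< v<b (arrays< (bounded S) d) j
    arr : ∀ d j → d < 16 → (mem σ [ address c i ↦ v ]) (address d j) ≡ arrays (setCell c i v s) d j
    arr d j d<16 with d ≡ᵇ c in eq
    ... | false = trans (update-other (mem σ) (address c i) v λ eqa →
                    subst T eq (≡⇒≡ᵇ d c (proj₁ (address-injective j i d<16 c<16 eqa)))) (arrays≈ S d j d<16)
    ... | true with refl ← ≡ᵇ⇒≡ d c (subst T (sym eq) tt) with j ≟ i
    ...   | yes refl = trans (update-same (mem σ) (address c i) v) (sym (update-same (arrays s c) i v))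
    ...   | no j≢i   = trans (update-other (mem σ) (address c i) v (λ eqa → j≢i (proj₂ (address-injective j i c<16 c<16 eqa))))
                         (trans (arrays≈ S c j c<16) (sym (update-other (arrays s c) i v j≢i)))

  setIO-simulates : ∀ {s σ σ′} i {v} → i < base → v < b → Simulates s σ →
    (∀ y → y < 42 → reg σ′ y ≡ reg σ y) → mem σ′ ≡ mem σ [ i ↦ v ] → Simulates (setIO i v s) σ′
  setIO-simulates {s} {σ} i {v} i< v<b S r refl = record
    { vars≈   = λ x x<40 → trans (r x (<-trans x<40 (<ᵇ⇒< 40 42 tt))) (vars≈ S x x<40)
    ; base≈   = trans (r 40 (<ᵇ⇒< 40 42 tt)) (base≈ S)
    ; zero≈   = trans (r 41 (<ᵇ⇒< 41 42 tt)) (zero≈ S)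
    ; arrays≈ = λ d j d<16 → trans (update-other (mem σ) i v
                  (≢-sym (<⇒≢ (≤-trans i< (m≤n+m base (j * 16 + d)))))) (arrays≈ S d j d<16)
    ; io≈     = λ j j<base → update-cong {mem σ} {io s} {i} {b = j} (λ _ → io≈ S j j<base) refl
    ; bounded = record
      { vars<   = vars< (bounded S)
      ; arrays< = arrays< (bounded S)
      ; io<     = update-< v<b (io< (bounded S))
      }
    }

  wp-sound : ∀ P s Q → Admissible P → wp P s Q → Run P s (cost P) Q
  execute (wp-sound (set x e) s Q (x<40 , ok) (bd , q)) {σ} S
    with σ₁ , E₁ , v₁ , same₁ , m₁ ← expr-computes e 42 ≤-refl ok S
    = _ , _ , _ , ≤-refl ,
      (E₁ ⨾ arith (subst (_< W) (sym eq) (b<W v<b))) ,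
      setVar-simulates x (<ᵇ⇒< x 40 x<40) v<b (preserve S same₁ m₁)
        (λ y → update-cong {reg σ₁} {reg σ₁} {x} {b = y} (λ _ → refl) eq) refl ,
      q
    where
    v<b : eval e s < b
    v<b = result<b e (bounded S) ok bd
    eq : reg σ₁ 42 + reg σ₁ 41 ≡ eval e s
    eq = trans (cong₂ _+_ v₁ (trans (same₁ 41 ≤-refl) (zero≈ S))) (+-identityʳ _)
  execute (wp-sound (write c e f) s Q (c<16 , oke , okf) (bd , q)) {σ} S
    with σ₁ , E₁ , v₁ , same₁ , m₁ ← expr-computes e 42 ≤-refl oke S
    with σ₂ , E₂ , v₂ , same₂ , m₂ ← locate-computes c 42 {σ₁} ≤-refl (<ᵇ⇒< c 16 c<16) v₁
           (≤-trans (eval-bound e (bounded S) oke) (^-monoʳ-≤ b (degree≤16 e oke)))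
           (trans (same₁ 40 (<ᵇ⇒< 40 42 tt)) (base≈ S))
    with σ₃ , E₃ , v₃ , same₃ , m₃ ← expr-computes f 43 (n≤1+n 42) okf
           (preserve S (λ y y<42 → trans (same₂ y y<42) (same₁ y y<42)) (trans m₂ m₁))
    = _ , _ , _ , ≤-refl ,
      (E₁ ⨾ E₂ ⨾ E₃ ⨾ store (subst (_< W) (sym v₃) (b<W v<b))) ,
      setCell-simulates c (eval e s) (<ᵇ⇒< c 16 c<16) v<b S
        (λ y y<42 → trans (same₃ y (m≤n⇒m≤1+n y<42)) (trans (same₂ y y<42) (same₁ y y<42)))
        (cong₂ (λ μ w → μ [ proj₁ w ↦ proj₂ w ]) (trans m₃ (trans m₂ m₁)) (cong₂ _,_ (trans (same₃ 42 ≤-refl) v₂) v₃)) ,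
      q
    where
    v<b : eval f s < b
    v<b = result<b f (bounded S) okf bd
  execute (wp-sound (readIO x e) s Q (x<40 , ok) (i< , q)) {σ} S
    with σ₁ , E₁ , v₁ , same₁ , m₁ ← expr-computes e 42 ≤-refl ok S
    = _ , _ , _ , ≤-refl ,
      (E₁ ⨾ load (subst (_< W) (sym eq) (b<W (io< (bounded S) _)))) ,
      setVar-simulates x (<ᵇ⇒< x 40 x<40) (io< (bounded S) _) (preserve S same₁ m₁)
        (λ y → update-cong {reg σ₁} {reg σ₁} {x} {b = y} (λ _ → refl) eq) refl ,
      q
    where
    eq : mem σ₁ (reg σ₁ 42) ≡ io s (eval e s)
    eq = trans (cong₂ (λ μ a → μ a) m₁ v₁) (io≈ S _ i<)
  execute (wp-sound (writeIO e f) s Q (oke , okf) (i< , bd , q)) {σ} S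
    with σ₁ , E₁ , v₁ , v₂ , S₁ ← test-computes e f oke okf S
    = _ , _ , _ , ≤-refl ,
      (E₁ ⨾ store (subst (_< W) (sym v₂) (b<W v<b))) ,
      setIO-simulates (eval e s) i< v<b S₁ (λ _ _ → refl) (cong₂ (λ a w → mem σ₁ [ a ↦ w ]) v₁ v₂) ,
      q
    where
    v<b : eval f s < b
    v<b = result<b f (bounded S) okf bd
  wp-sound (P ⍮ P′) s Q (ok , ok′) p = run-seq (run-map (λ s′ → wp-sound P′ s′ Q ok′) (wp-sound P s _ ok p))
  execute (wp-sound (if e f P P′) s Q (oke , okf , ok , ok′) (yes-case , no-case)) S
    with σ₁ , E₁ , v₁ , v₂ , S₁ ← test-computes e f oke okf S with eval e s <? eval f s
  ... | yes lt with j , σ′ , s′ , j≤ , E , rest ← execute (wp-sound P s Q ok (yes-case lt)) S₁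
    = _ , σ′ , s′ , +-monoʳ-≤ (testCost e f) (s≤s (≤-trans j≤ (m≤m⊔n _ _))) ,
      (E₁ ⨾ if-yes (subst₂ _<_ (sym v₁) (sym v₂) lt) E) , rest
  ... | no nlt with j , σ′ , s′ , j≤ , E , rest ← execute (wp-sound P′ s Q ok′ (no-case (≮⇒≥ nlt))) S₁
    = _ , σ′ , s′ , +-monoʳ-≤ (testCost e f) (s≤s (≤-trans j≤ (m≤n⊔m _ _))) ,
      (E₁ ⨾ if-no (λ lt → nlt (subst₂ _<_ v₁ v₂ lt)) E) , rest
  execute (wp-sound nop s Q _ q) S = _ , _ , _ , ≤-refl , skip , S , q

-- Lists and stacks in memory

Holds : (ℕ → ℕ) → ℕ → List ℕ → Set
Holds f o []       = ⊤
Holds f o (x ∷ xs) = f o ≡ x × Holds f (suc o) xs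

Holds-cong : ∀ {f g o} xs → (∀ i → o ≤ i → i < o + length xs → g i ≡ f i) → Holds f o xs → Holds g o xs
Holds-cong []       eq _        = tt
Holds-cong {o = o} (x ∷ xs) eq (h , hs) =
  trans (eq o ≤-refl (m<m+n o (s≤s z≤n))) h ,
  Holds-cong xs (λ i o< i< → eq i (<⇒≤ o<) (≤-trans i< (≤-reflexive (sym (+-suc o (length xs)))))) hs

Holds-++⁺ : ∀ {f o} xs {ys} → Holds f o xs → Holds f (o + length xs) ys → Holds f o (xs ++ ys)
Holds-++⁺ {f} {o} []       {ys} _        k = subst (λ i → Holds f i ys) (+-identityʳ o) k
Holds-++⁺ {f} {o} (x ∷ xs) {ys} (h , hs) k = h , Holds-++⁺ xs hs (subst (λ i → Holds f i ys) (+-suc o (length xs)) k)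

Holds-++⁻ : ∀ {f o} xs {ys} → Holds f o (xs ++ ys) → Holds f o xs × Holds f (o + length xs) ys
Holds-++⁻ {f} {o} []       {ys} k = tt , subst (λ i → Holds f i ys) (sym (+-identityʳ o)) k
Holds-++⁻ {f} {o} (x ∷ xs) {ys} (h , hs) with k , l ← Holds-++⁻ xs hs =
  (h , k) , subst (λ i → Holds f i ys) (sym (+-suc o (length xs))) l

Holds-below : ∀ {f o i v} xs → i < o → Holds f o xs → Holds (f [ i ↦ v ]) o xs
Holds-below {f} {i = i} {v} xs i<o = Holds-cong xs λ j o≤j _ → update-other f i v (≢-sym (<⇒≢ (≤-trans i<o o≤j)))

Holds-above : ∀ {f o i v} xs → o + length xs ≤ i → Holds f o xs → Holds (f [ i ↦ v ]) o xs
Holds-above {f} {i = i} {v} xs ≤i = Holds-cong xs λ j _ j< → update-other f i v (<⇒≢ (≤-trans j< ≤i))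

Holds-cons : ∀ {f o v xs} → Holds f (suc o) xs → Holds (f [ o ↦ v ]) o (v ∷ xs)
Holds-cons {f} {o} {v} {xs} hs = update-same f o v , Holds-below xs ≤-refl hs

Holds-snoc : ∀ {f o i v} xs → o + length xs ≡ i → Holds f o xs → Holds (f [ i ↦ v ]) o (xs ++ v ∷ [])
Holds-snoc {f} {o} {v = v} xs refl hs =
  Holds-++⁺ xs (Holds-above xs ≤-refl hs) (update-same f (o + length xs) v , tt)

Holds-update : ∀ {f o i y v} xs {zs} → o + length xs ≡ i → Holds f o (xs ++ y ∷ zs) → Holds (f [ i ↦ v ]) o (xs ++ v ∷ zs)
Holds-update {f} {o} {v = v} xs {zs} refl hs with k , _ , l ← Holds-++⁻ xs hs =
  Holds-++⁺ xs (Holds-above xs ≤-refl k) (update-same f (o + length xs) v , Holds-below zs ≤-refl l)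

-- Position, flag and number of each cluster that waits for its parent, kept in three parallel
-- arrays. The head of the list is the top of the stack.
Stack : Set
Stack = List (ℕ × ℕ × ℕ)

HoldsStack : (A B C : ℕ → ℕ) → Stack → Set
HoldsStack A B C []                = ⊤
HoldsStack A B C ((p , f , x) ∷ S) =
  A (length S) ≡ p × B (length S) ≡ f × C (length S) ≡ x × HoldsStack A B C S

HoldsStack-push : ∀ {A B C p f x} S → HoldsStack A B C S → ∀ {l} → length S ≡ l →
                  HoldsStack (A [ l ↦ p ]) (B [ l ↦ f ]) (C [ l ↦ x ]) ((p , f , x) ∷ S)
HoldsStack-push {A} {B} {C} {p} {f} {x} S hs refl =
  update-same A (length S) p , update-same B (length S) f , update-same C (length S) x , above S ≤-refl hs
  where
  above : ∀ S′ {l} → length S′ ≤ l → HoldsStack A B C S′ → HoldsStack (A [ l ↦ p ]) (B [ l ↦ f ]) (C [ l ↦ x ]) S′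
  above []             _    _                 = tt
  above (e ∷ S′) {l} lt (h₁ , h₂ , h₃ , hs) =
    trans (update-other A l p (<⇒≢ lt)) h₁ , trans (update-other B l f (<⇒≢ lt)) h₂ ,
    trans (update-other C l x (<⇒≢ lt)) h₃ , above S′ (<⇒≤ lt) hs

-- In the output of a round, 0 stands for a deleted position and suc x for x.
decode : List ℕ → List ℕ
decode []           = []
decode (zero ∷ xs)  = decode xs
decode (suc x ∷ xs) = x ∷ decode xs

decode-++ : ∀ xs ys → decode (xs ++ ys) ≡ decode xs ++ decode ys
decode-++ []           ys = refl
decode-++ (zero ∷ xs)  ys = decode-++ xs ys
decode-++ (suc x ∷ xs) ys = cong (x ∷_) (decode-++ xs ys)

-- Tables of rules in memory

module _ (M : ℕ) where

  -- The number with digits `x`, `i`, `c` in base `M`: a hash function without collisions.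
  key : ℕ → ℕ → ℕ → ℕ
  key x i c = (x * M + i) * M + c

  pair-injective : ∀ {i j} x y → i < M → j < M → x * M + i ≡ y * M + j → x ≡ y × i ≡ j
  pair-injective zero    zero    _  _  eq = refl , eq
  pair-injective {j = j} zero    (suc y) i< _  eq = contradiction (≤-trans (m≤m+n M (y * M + j))
    (≤-reflexive (trans (sym (+-assoc M (y * M) j)) (sym eq)))) (<⇒≱ i<)
  pair-injective {i = i} (suc x) zero    _  j< eq = contradiction (≤-trans (m≤m+n M (x * M + i))
    (≤-reflexive (trans (sym (+-assoc M (x * M) i)) eq))) (<⇒≱ j<)
  pair-injective (suc x) (suc y) i< j< eq
    with refl , refl ← pair-injective x y i< j< (+-cancelˡ-≡ M _ _ (trans (sym (+-assoc M _ _)) (trans eq (+-assoc M _ _)))) =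
    refl , refl

  key-injective : ∀ {x i c y j d} → i < M → c < M → j < M → d < M → key x i c ≡ key y j d → x ≡ y × i ≡ j × c ≡ d
  key-injective {x} {i} {c} {y} {j} {d} i< c< j< d< eq
    with eq′ , refl ← pair-injective (x * M + i) (y * M + j) c< d< eq
    with refl , refl ← pair-injective x y i< j< eq′ = refl , refl , refl

module Representation (F : RankedAlphabet) (fs : List (Symbol F)) (code : Symbol F → ℕ)
  (code-injective : ∀ {f g} → f ∈ fs → g ∈ fs → code f ≡ code g → f ≡ g) (M : ℕ) where
  open Clusters F

  encodeRuleOf : Rule → List ℕ
  encodeRuleOf (term f)     = 0 ∷ code f ∷ []
  encodeRuleOf (comp B i C) = 1 ∷ B ∷ i ∷ C ∷ []

  encodeEntry : Entry → List ℕ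
  encodeEntry e = rk e ∷ encodeRuleOf (rule e)

  encodeTable : Table → List ℕ
  encodeTable = concatMap encodeEntry

  encodeTable-snoc : ∀ T e → encodeTable (T ++ e ∷ []) ≡ encodeTable T ++ encodeEntry e
  encodeTable-snoc T e = trans (concatMap-++ encodeEntry T (e ∷ [])) (cong (encodeTable T ++_) (++-identityʳ (encodeEntry e)))

  encodeEntry-length : ∀ e → length (encodeEntry e) ≤ 5
  encodeEntry-length (entry (term f) _ _ _)     = s≤s (s≤s (s≤s z≤n))
  encodeEntry-length (entry (comp B i C) _ _ _) = ≤-refl

  encodeTable-length : ∀ T → length (encodeTable T) ≤ 5 * length T
  encodeTable-length []      = z≤n
  encodeTable-length (e ∷ T) = ≤-trans (≤-reflexive (length-++ (encodeEntry e)))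
    (≤-trans (+-mono-≤ (encodeEntry-length e) (encodeTable-length T)) (≤-reflexive (sym (*-suc 5 (length T)))))

  -- The possible contents of the hash table at ρ.
  data Located (T : Table) (ρ : Rule) : ℕ → Set where
    absent : Fresh T ρ → Located T ρ 0
    at     : ∀ {a e} → At T a e → rule e ≡ ρ → Located T ρ (suc a)

  Located-snoc : ∀ {T ρ v e} → rule e ≢ ρ → Located T ρ v → Located (T ++ e ∷ []) ρ v
  Located-snoc {T} {ρ} {e = e} ne (absent fr) = absent λ _ _ p → fresh (At-snoc⁻ T p)
    where
    fresh : ∀ {a d} → At T a d ⊎ a ≡ length T × d ≡ e → rule d ≢ ρ
    fresh (inj₁ q)          = fr _ _ q
    fresh (inj₂ (_ , refl)) = ne
  Located-snoc ne (at p eq) = at (At-++ p) eq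

  Located-positive : ∀ {T ρ v} → Located T ρ v → 0 < v → ∃₂ λ a e → v ∸ 1 ≡ a × At T a e × rule e ≡ ρ
  Located-positive (at {a} {e} p eq) _ = a , e , refl , p , eq

  Located-zero : ∀ {T ρ v} → Located T ρ v → v ≤ 0 → Fresh T ρ
  Located-zero (absent fresh) _ = fresh

  -- The rules are written directly into the output area, `q` being its first free cell. Cells 0 and
  -- 1 are kept for the number of nonterminals and the start symbol, which are known only at the
  -- end.
  record Represents (T : Table) (nid q : ℕ) (RK WT TC H IO : ℕ → ℕ) : Set where
    field
      nid≡  : nid ≡ length T
      q≡    : q ≡ 2 + length (encodeTable T)
      ranks : ∀ {a e} → At T a e → RK a ≡ rk e
      wts   : ∀ {a e} → At T a e → WT a ≡ wt e
      terms : ∀ {f} → f ∈ fs → Located T (term f) (TC (code f))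
      comps : ∀ {x i c} → i < M → c < M → Located T (comp x i c) (H (key M x i c))
      out   : Holds IO 2 (encodeTable T)
  open Represents

  represents-empty : ∀ {RK WT TC H IO} → (∀ i → TC i ≡ 0) → (∀ i → H i ≡ 0) → Represents [] 0 2 RK WT TC H IO
  represents-empty TC≡0 H≡0 = record
    { nid≡  = refl
    ; q≡    = refl
    ; ranks = λ ()
    ; wts   = λ ()
    ; terms = λ {f} _ → subst (Located [] (term f)) (sym (TC≡0 _)) (absent λ _ _ ())
    ; comps = λ {x} {i} {c} _ _ → subst (Located [] (comp x i c)) (sym (H≡0 _)) (absent λ _ _ ())
    ; out   = tt
    }

  represents-term : ∀ {T nid q RK WT TC H IO f r k} → f ∈ fs → r ≡ rank F f → k ≡ code f → Fresh T (term f) →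
    Represents T nid q RK WT TC H IO →
    Represents (T ++ leafEntry f ∷ []) (nid + 1) (q + 3) (RK [ nid ↦ r ]) (WT [ nid ↦ 1 ])
      (TC [ k ↦ nid + 1 ]) H (((IO [ q ↦ r ]) [ q + 1 ↦ 0 ]) [ q + 2 ↦ k ])
  represents-term {T} {RK = RK} {WT} {TC} {H} {IO} {f} f∈ refl refl fr
    record { nid≡ = refl ; q≡ = refl ; ranks = rks ; wts = wts ; terms = tms ; comps = cps ; out = o } = record
    { nid≡  = sym (length-++ T)
    ; q≡    = trans (cong (2 +_) (sym (length-++ (encodeTable T)))) (cong (λ xs → 2 + length xs) (sym (encodeTable-snoc T (leafEntry f))))
    ; ranks = λ p → rks′ (At-snoc⁻ T p)
    ; wts   = λ p → wts′ (At-snoc⁻ T p)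
    ; terms = tms′
    ; comps = λ i< c< → Located-snoc (λ ()) (cps i< c<)
    ; out   = subst (Holds _ 2) (trans (++-assoc (E ++ _) _ _) (trans (++-assoc E _ _) (sym (encodeTable-snoc T (leafEntry f)))))
        (Holds-snoc ((E ++ rank F f ∷ []) ++ 0 ∷ []) (trans (cong (2 +_) (trans (length-++ (E ++ _)) (trans (cong (_+ 1) (length-++ E)) (+-assoc (length E) 1 1)))) refl)
          (Holds-snoc (E ++ rank F f ∷ []) (cong (2 +_) (length-++ E)) (Holds-snoc E refl o)))
    }
    where
    E = encodeTable T
    rks′ : ∀ {a e} → At T a e ⊎ a ≡ length T × e ≡ leafEntry f → (RK [ length T ↦ rank F f ]) a ≡ rk e
    rks′ (inj₁ p)             = trans (update-other RK (length T) _ (<⇒≢ (At-< p))) (rks p)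
    rks′ (inj₂ (refl , refl)) = update-same RK (length T) _
    wts′ : ∀ {a e} → At T a e ⊎ a ≡ length T × e ≡ leafEntry f → (WT [ length T ↦ 1 ]) a ≡ wt e
    wts′ (inj₁ p)             = trans (update-other WT (length T) _ (<⇒≢ (At-< p))) (wts p)
    wts′ (inj₂ (refl , refl)) = update-same WT (length T) _
    tms′ : ∀ {g} → g ∈ fs → Located (T ++ leafEntry f ∷ []) (term g) ((TC [ code f ↦ length T + 1 ]) (code g))
    tms′ {g} g∈ with code g ≟ code f
    ... | yes eq rewrite code-injective g∈ f∈ eq | update-same TC (code f) (length T + 1) | +-comm (length T) 1 =
      at (At-last T) refl
    ... | no ne rewrite update-other TC (code f) (length T + 1) ne =
      Located-snoc (λ { refl → ne refl }) (tms g∈)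

  represents-comp : ∀ {T nid q RK WT TC H IO x e i c d k r w x′ i′ c′} → Fresh T (comp x i c) →
    i < M → c < M → k ≡ key M x i c → r ≡ rk e + rk d ∸ 1 → w ≡ wt e + wt d →
    x′ ≡ x → i′ ≡ i → c′ ≡ c →
    Represents T nid q RK WT TC H IO →
    Represents (T ++ combine x e i c d ∷ []) (nid + 1) (q + 5) (RK [ nid ↦ r ]) (WT [ nid ↦ w ])
      TC (H [ k ↦ nid + 1 ]) (((((IO [ q ↦ r ]) [ q + 1 ↦ 1 ]) [ q + 2 ↦ x′ ]) [ q + 3 ↦ i′ ]) [ q + 4 ↦ c′ ])
  represents-comp {T} {RK = RK} {WT} {TC} {H} {IO} {x} {e} {i} {c} {d} fr i< c< refl refl refl refl refl refl
    record { nid≡ = refl ; q≡ = refl ; ranks = rks ; wts = wts ; terms = tms ; comps = cps ; out = o } = record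
    { nid≡  = sym (length-++ T)
    ; q≡    = trans (cong (2 +_) (sym (length-++ (encodeTable T)))) (cong (λ xs → 2 + length xs) (sym (encodeTable-snoc T f)))
    ; ranks = λ p → rks′ (At-snoc⁻ T p)
    ; wts   = λ p → wts′ (At-snoc⁻ T p)
    ; terms = λ g∈ → Located-snoc (λ ()) (tms g∈)
    ; comps = cps′
    ; out   = subst (Holds _ 2) assoc
        (Holds-snoc E₄ (cong (2 +_) l₄) (Holds-snoc E₃ (cong (2 +_) l₃) (Holds-snoc E₂ (cong (2 +_) l₂)
        (Holds-snoc E₁ (cong (2 +_) l₁) (Holds-snoc E refl o)))))
    }
    where
    f = combine x e i c d
    E = encodeTable T
    E₁ E₂ E₃ E₄ : List ℕ
    E₁ = E ++ rk f ∷ []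
    E₂ = E₁ ++ 1 ∷ []
    E₃ = E₂ ++ x ∷ []
    E₄ = E₃ ++ i ∷ []
    snoc-length : ∀ m (xs : List ℕ) y → length xs ≡ length E + m → length (xs ++ y ∷ []) ≡ length E + suc m
    snoc-length m xs y eq = trans (length-++ xs) (trans (cong (_+ 1) eq) (trans (+-assoc (length E) m 1) (cong (length E +_) (+-comm m 1))))
    l₁ : length E₁ ≡ length E + 1
    l₁ = length-++ E {rk f ∷ []}
    l₂ = snoc-length 1 E₁ 1 l₁
    l₃ = snoc-length 2 E₂ x l₂
    l₄ = snoc-length 3 E₃ i l₃
    assoc : E₄ ++ c ∷ [] ≡ encodeTable (T ++ f ∷ [])
    assoc = trans (++-assoc E₃ _ _) (trans (++-assoc E₂ _ _) (trans (++-assoc E₁ _ _)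
      (trans (++-assoc E _ _) (sym (encodeTable-snoc T f)))))
    rks′ : ∀ {a e} → At T a e ⊎ a ≡ length T × e ≡ f → (RK [ length T ↦ rk f ]) a ≡ rk e
    rks′ (inj₁ p)             = trans (update-other RK (length T) (rk f) (<⇒≢ (At-< p))) (rks p)
    rks′ (inj₂ (refl , refl)) = update-same RK (length T) (rk f)
    wts′ : ∀ {a e} → At T a e ⊎ a ≡ length T × e ≡ f → (WT [ length T ↦ wt f ]) a ≡ wt e
    wts′ (inj₁ p)             = trans (update-other WT (length T) (wt f) (<⇒≢ (At-< p))) (wts p)
    wts′ (inj₂ (refl , refl)) = update-same WT (length T) (wt f)
    cps′ : ∀ {y j b} → j < M → b < M → Located (T ++ f ∷ []) (comp y j b) ((H [ key M x i c ↦ length T + 1 ]) (key M y j b))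
    cps′ {y} {j} {b} j< b< with key M y j b ≟ key M x i c
    ... | yes eq with refl , refl , refl ← key-injective M {y} {j} {b} {x} {i} {c} j< b< i< c< eq
      rewrite update-same H (key M x i c) (length T + 1) | +-comm (length T) 1 = at (At-last T) refl
    ... | no ne rewrite update-other H (key M x i c) (length T + 1) ne =
      Located-snoc (λ { refl → ne refl }) (cps j< b<)

-- Argument vectors as lists

module _ {A : Set} where

  vec : ∀ {k} (xs : List A) → length xs ≡ k → Vec A k
  vec xs refl = fromList xs

  toList-vec : ∀ {k} xs (eq : length xs ≡ k) → toList (vec xs eq) ≡ xs
  toList-vec xs refl = toList∘fromList xs

  toList-injective : ∀ {k} (u v : Vec A k) → toList u ≡ toList v → u ≡ v
  toList-injective []      []      _  = refl
  toList-injective (x ∷ u) (y ∷ v) eq with refl ← cong (List.head) eq =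
    cong (x ∷_) (toList-injective u v (cong (drop 1) eq))

  lookup-split : ∀ {k} (v : Vec A k) as {b cs} → toList v ≡ as ++ b ∷ cs →
    Σ (Fin k) λ i → toℕ i ≡ length as × lookup v i ≡ b × (∀ b′ → toList (v [ i ]≔ b′) ≡ as ++ b′ ∷ cs) ×
      (∀ {P : A → Set} → All P as → All P cs → ∀ j → j ≢ i → P (lookup v j))
  lookup-split (x ∷ v) [] refl = zero , refl , refl , (λ b′ → refl) , others
    where
    all : ∀ {k} {P : A → Set} (v : Vec A k) → All P (toList v) → ∀ j → P (lookup v j)
    all (y ∷ v) (p ∷ ps) zero    = p
    all (y ∷ v) (p ∷ ps) (suc j) = all v ps j
    others : ∀ {P : A → Set} → All P [] → All P (toList v) → ∀ j → j ≢ zero → P (lookup (x ∷ v) j)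
    others _ ps zero    j≢ = contradiction refl j≢
    others _ ps (suc j) _  = all v ps j
  lookup-split (x ∷ v) (a ∷ as) {b} {cs} eq with refl ← cong List.head eq
    with i , i≡ , b≡ , upd , others ← lookup-split v as (cong (drop 1) eq) =
    suc i , cong suc i≡ , b≡ , (λ b′ → cong (x ∷_) (upd b′)) , others′
    where
    others′ : ∀ {P : A → Set} → All P (x ∷ as) → All P cs → ∀ j → j ≢ suc i → P (lookup (x ∷ v) j)
    others′ (p ∷ ps) qs zero    _  = p
    others′ (p ∷ ps) qs (suc j) j≢ = others ps qs j (λ { refl → j≢ refl })

module _ {F : RankedAlphabet} {X : Set} where

  params*-toList : ∀ {k} (ts : Vec (Term F X) k) → params* ts ≡ concatMap params (toList ts)
  params*-toList []       = refl
  params*-toList (t ∷ ts) = cong (params t ++_) (params*-toList ts)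

  labels*-toList : ∀ {k} (ts : Vec (Term F X) k) → labels* ts ≡ concatMap labels (toList ts)
  labels*-toList []       = refl
  labels*-toList (t ∷ ts) = cong (labels t ++_) (labels*-toList ts)

  params-param : ∀ xs → concatMap params (map (param {F} {X}) xs) ≡ xs
  params-param []       = refl
  params-param (x ∷ xs) = cong (x ∷_) (params-param xs)

  labels-param : ∀ xs → concatMap labels (map (param {F} {X}) xs) ≡ []
  labels-param []       = refl
  labels-param (x ∷ xs) = labels-param xs

  toList-subst : ∀ {Y : Set} {k} (ts : Vec (Term F X) k) (θ : X → Term F Y) → toList (ts ⟪ θ ⟫*) ≡ map (_⟪ θ ⟫) (toList ts)
  toList-subst []       θ = refl
  toList-subst (t ∷ ts) θ = cong (t ⟪ θ ⟫ ∷_) (toList-subst ts θ)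

map-lookup : ∀ {A : Set} {k} (v : Vec A k) → map (lookup v) (allFin k) ≡ toList v
map-lookup v = trans (map-tabulate (λ i → i) (lookup v)) (go v)
  where
  go : ∀ {A : Set} {k} (v : Vec A k) → List.tabulate (lookup v) ≡ toList v
  go []      = refl
  go (x ∷ v) = cong (x ∷_) (go v)

-- The grammar given by a table

module Grammar (F : RankedAlphabet) (fs : List (Symbol F)) (R : ℕ) (T : Clusters.Table F) (ok : Clusters.OK F fs R T) where
  open Clusters F
  open Spelling F

  entryOf : Fin (length T) → Entry
  entryOf = List.lookup T

  arity : Fin (length T) → ℕ
  arity A = rk (entryOf A)

  position : ∀ {U a e} → At U a e → Fin (length U)
  position here      = zero
  position (there p) = suc (position p)

  position-toℕ : ∀ {U a e} (p : At U a e) → toℕ (position p) ≡ a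
  position-toℕ here      = refl
  position-toℕ (there p) = cong suc (position-toℕ p)

  position-lookup : ∀ {U a e} (p : At U a e) → List.lookup U (position p) ≡ e
  position-lookup here      = refl
  position-lookup (there p) = position-lookup p

  Sentential : Set → Set
  Sentential X = Term (F ⊕ arity) X

  module _ {X : Set} (B C : Fin (length T)) (xs ys zs : List X)
    (eqB : length xs + suc (length zs) ≡ arity B) (eqC : length ys ≡ arity C) where

    inner : Sentential X
    inner = node (inj₂ C) (Vec.map param (vec ys eqC))

    arguments : List (Sentential X)
    arguments = map param xs ++ inner ∷ map param zs

    arguments-length : length arguments ≡ arity B
    arguments-length = trans (length-++ (map param xs)) (trans (cong₂ (λ i j → i + suc j) (length-map param xs) (length-map param zs)) eqB)

    composition : Sentential X
    composition = node (inj₂ B) (vec arguments arguments-length)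

    toList-inner : toList (Vec.map (param {F ⊕ arity}) (vec ys eqC)) ≡ map param ys
    toList-inner = trans (toList-map param (vec ys eqC)) (cong (map param) (toList-vec ys eqC))

    composition-params : params composition ≡ xs ++ ys ++ zs
    composition-params = trans (params*-toList (vec arguments arguments-length))
      (trans (cong (concatMap params) (toList-vec arguments arguments-length))
      (trans (concatMap-++ params (map param xs) (inner ∷ map param zs))
      (cong₂ _++_ (params-param xs) (cong₂ _++_
        (trans (params*-toList (Vec.map param (vec ys eqC))) (trans (cong (concatMap params) toList-inner) (params-param ys)))
        (params-param zs)))))

    composition-labels : labels composition ≡ inj₂ B ∷ inj₂ C ∷ []
    composition-labels = cong (inj₂ B ∷_) (trans (labels*-toList (vec arguments arguments-length))
      (trans (cong (concatMap labels) (toList-vec arguments arguments-length))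
      (trans (concatMap-++ labels (map param xs) (inner ∷ map param zs))
      (cong₂ _++_ (labels-param xs) (cong₂ (λ us vs → inj₂ C ∷ us ++ vs)
        (trans (labels*-toList (Vec.map param (vec ys eqC))) (trans (cong (concatMap labels) toList-inner) (labels-param ys)))
        (labels-param zs))))))

    private
      hole-split = lookup-split (vec arguments arguments-length) (map param xs) {inner} {map param zs} (toList-vec arguments arguments-length)

    hole : Fin (arity B)
    hole = proj₁ hole-split

    hole-toℕ : toℕ hole ≡ length xs
    hole-toℕ = trans (proj₁ (proj₂ hole-split)) (length-map param xs)

    hole-lookup : lookup (vec arguments arguments-length) hole ≡ inner
    hole-lookup = proj₁ (proj₂ (proj₂ hole-split))

    others-lookup : ∀ j → j ≢ hole → ∃ λ x → lookup (vec arguments arguments-length) j ≡ param x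
    others-lookup = proj₂ (proj₂ (proj₂ (proj₂ hole-split))) {λ t → ∃ λ x → t ≡ param x} (are-params xs) (are-params zs)
      where
      are-params : ∀ us → All (λ (t : Sentential X) → ∃ λ x → t ≡ param x) (map param us)
      are-params []       = []
      are-params (u ∷ us) = (u , refl) ∷ are-params us

    module _ {Y : Set} (θ : X → Sentential Y) where

      map-subst : ∀ xs → map (_⟪ θ ⟫) (map param xs) ≡ map θ xs
      map-subst []       = refl
      map-subst (x ∷ xs) = cong (θ x ∷_) (map-subst xs)

      innerArguments : Vec (Sentential Y) (arity C)
      innerArguments = Vec.map param (vec ys eqC) ⟪ θ ⟫*

      innerArguments-toList : toList innerArguments ≡ map θ ys
      innerArguments-toList = trans (toList-subst (Vec.map param (vec ys eqC)) θ) (trans (cong (map (_⟪ θ ⟫)) toList-inner) (map-subst ys))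

      composition-subst : toList (vec arguments arguments-length ⟪ θ ⟫*) ≡ map θ xs ++ node (inj₂ C) innerArguments ∷ map θ zs
      composition-subst = trans (toList-subst (vec arguments arguments-length) θ)
        (trans (cong (map (_⟪ θ ⟫)) (toList-vec arguments arguments-length))
        (trans (map-++ (_⟪ θ ⟫) (map param xs) (inner ∷ map param zs))
        (cong₂ (λ us vs → us ++ node (inj₂ C) innerArguments ∷ vs) (map-subst xs) (map-subst zs))))

  -- The parameters left of the hole, those passed to the inner nonterminal, and those right of the
  -- hole. Being consecutive blocks of the increasing list, they join up to it again, which is the
  -- validity of the pattern.
  module Split (i j l : ℕ) where
    xs ys zs : List (Fin l)
    xs = take i (allFin l)
    ys = take j (drop i (allFin l))
    zs = drop j (drop i (allFin l))

    together : xs ++ ys ++ zs ≡ allFin l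
    together = trans (cong (xs ++_) (take++drop≡id j (drop i (allFin l)))) (take++drop≡id i (allFin l))

    length-drop-i : length (drop i (allFin l)) ≡ l ∸ i
    length-drop-i = trans (length-drop i (allFin l)) (cong (_∸ i) (length-tabulate {n = l} (λ k → k)))

    xs-length : i ≤ l → length xs ≡ i
    xs-length i≤l = trans (length-take i (allFin l)) (trans (cong (i ⊓_) (length-tabulate {n = l} (λ k → k))) (m≤n⇒m⊓n≡m i≤l))

    ys-length : i + j ≤ l → length ys ≡ j
    ys-length le = trans (length-take j (drop i (allFin l))) (trans (cong (j ⊓_) length-drop-i)
      (m≤n⇒m⊓n≡m (≤-trans (≤-reflexive (sym (m+n∸m≡n i j))) (∸-monoˡ-≤ i le))))

    zs-length : length zs ≡ l ∸ i ∸ j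
    zs-length = trans (length-drop j (drop i (allFin l))) (cong (_∸ j) length-drop-i)

  position-fits : ∀ {i k j} → i < k → i + j ≤ k + j ∸ 1
  position-fits {j = j} i<k = ∸-monoˡ-≤ 1 (+-monoˡ-≤ j i<k)

  positions-add-up : ∀ {i k j} → i < k → i + suc (k + j ∸ 1 ∸ i ∸ j) ≡ k
  positions-add-up {i} {suc k} {j} (s≤s i≤k) = trans (+-suc i _) (cong suc
    (trans (cong (λ z → i + (z ∸ j)) (trans (cong (_∸ i) (+-comm k j)) (+-∸-assoc j i≤k)))
      (trans (cong (i +_) (m+n∸m≡n j (k ∸ i))) (m+[n∸m]≡n i≤k))))

  module Binary {a x e i c d} (p : At T x e) (q : At T c d) (x< : x < a) (c< : c < a) (i< : i < rk e) where
    open Split i (rk d) (rk e + rk d ∸ 1) public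

    B C : Fin (length T)
    B = position p
    C = position q

    xs≡ : length xs ≡ i
    xs≡ = xs-length (≤-trans (m≤m+n i (rk d)) (position-fits i<))

    eqB : length xs + suc (length zs) ≡ arity B
    eqB = trans (cong₂ (λ u v → u + suc v) xs≡ zs-length)
      (trans (positions-add-up {i} {rk e} {rk d} i<) (cong rk (sym (position-lookup p))))

    eqC : length ys ≡ arity C
    eqC = trans (ys-length (position-fits i<)) (cong rk (sym (position-lookup q)))

    right : Sentential (Fin (rk e + rk d ∸ 1))
    right = composition B C xs ys zs eqB eqC

  rightHandSide : ∀ {a g} → Valid fs T a g → Sentential (Fin (rk g))
  rightHandSide (term {f = f} _)       = node (inj₁ f) (Vec.map param (Vec.allFin (rank F f)))
  rightHandSide (comp p q x< c< i<) = Binary.right p q x< c< i<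

  vector-params : ∀ {k} {X : Set} (v : Vec X k) → params* (Vec.map (param {F ⊕ arity}) v) ≡ toList v
  vector-params []      = refl
  vector-params (x ∷ v) = cong (x ∷_) (vector-params v)

  vector-labels : ∀ {k} {X : Set} (v : Vec X k) → labels* (Vec.map (param {F ⊕ arity}) v) ≡ []
  vector-labels []      = refl
  vector-labels (x ∷ v) = vector-labels v

  toList-tabulate : ∀ {A : Set} {k} (f : Fin k → A) → toList (tabulate f) ≡ List.tabulate f
  toList-tabulate {k = zero}  f = refl
  toList-tabulate {k = suc k} f = cong (f zero ∷_) (toList-tabulate (λ i → f (suc i)))

  rightHandSide-valid : ∀ {a g} (v : Valid fs T a g) → ValidPattern (rightHandSide v)
  rightHandSide-valid (term {f = f} _)    = trans (vector-params (Vec.allFin (rank F f))) (toList-tabulate (λ i → i))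
  rightHandSide-valid (comp p q x< c< i<) = trans (composition-params B C xs ys zs eqB eqC) together
    where open Binary p q x< c< i<

  occurs-in : ∀ {B C D : Fin (length T)} {xs : List (Symbol F ⊎ Fin (length T))} → xs ≡ inj₂ B ∷ inj₂ C ∷ [] → inj₂ D ∈ xs → D ≡ B ⊎ D ≡ C
  occurs-in refl (here refl)         = inj₁ refl
  occurs-in refl (there (here refl)) = inj₂ refl

  rightHandSide-occurs : ∀ {a g} (v : Valid fs T a g) {D} → inj₂ D ∈ labels (rightHandSide v) → toℕ D < a
  rightHandSide-occurs (term {f = f} _) (there m) with () ← subst (_ ∈_) (vector-labels (Vec.allFin (rank F f))) m
  rightHandSide-occurs {a} (comp p q x< c< i<) {D} m =
    below (occurs-in (composition-labels B C xs ys zs eqB eqC) m)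
    where
    open Binary p q x< c< i<
    below : D ≡ B ⊎ D ≡ C → toℕ D < a
    below (inj₁ refl) = subst (_< a) (sym (position-toℕ p)) x<
    below (inj₂ refl) = subst (_< a) (sym (position-toℕ q)) c<

  rightHandSide-size : ∀ {a g} (v : Valid fs T a g) → size (rightHandSide v) ≤ 2
  rightHandSide-size (term {f = f} _) = ≤-trans (≤-reflexive (cong (λ xs → suc (length xs)) (vector-labels (Vec.allFin (rank F f))))) (s≤s z≤n)
  rightHandSide-size (comp p q x< c< i<) = ≤-reflexive (cong length (composition-labels B C xs ys zs eqB eqC))
    where open Binary p q x< c< i<

  valid : ∀ A → Valid fs T (toℕ A) (entryOf A)
  valid A = OK-valid ok (At-lookup T A)

  module _ (start : Fin (length T)) (start-rank : arity start ≡ 0) where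

    grammar : TSLP F
    grammar = record
      { #nonterminals = length T
      ; nrank         = arity
      ; start         = start
      ; start-rank    = start-rank
      ; rhs           = λ A → rightHandSide (valid A)
      ; rhs-valid     = λ A → rightHandSide-valid (valid A)
      ; acyclic       = λ A cycle → <-irrefl refl (descend cycle)
      }
      where
      descend : ∀ {A B} → TransClosure (λ B A → inj₂ B ∈ labels (rightHandSide (valid A))) B A → toℕ B < toℕ A
      descend {A} [ m ]     = rightHandSide-occurs (valid A) m
      descend (_∷_ {y = C} m ms) = <-trans (rightHandSide-occurs (valid C) m) (descend ms)

    private
      G = grammar

    normalForm : ∀ {a g} (v : Valid fs T a g) → NormalForm G (rightHandSide v)
    normalForm (term {f = f} _)       = terminal f (Vec.allFin (rank F f)) refl
    normalForm (comp p q x< c< i<) =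
      binary B (hole B C xs ys zs eqB eqC) C (vec (arguments B C xs ys zs eqB eqC) (arguments-length B C xs ys zs eqB eqC)) (vec ys eqC) refl
        (hole-lookup B C xs ys zs eqB eqC) (others-lookup B C xs ys zs eqB eqC)
      where open Binary p q x< c< i<

    cnf : ChomskyNormalForm G
    cnf A = normalForm (valid A)

    -- Recursion on a bound for the depth, since the nonterminals of a rule are found through their
    -- positions in the table.
    derive : ∀ k A → dp (entryOf A) ≤ k → Σ (DerivationTree G cnf A) λ D → treeDepth G cnf D ≤ dp (entryOf A)
    derive-children : ∀ k {a g} (v : Valid fs T a g) → dp g ≤ k →
      Σ (Children G cnf (normalForm v)) λ c → suc (childrenDepth G cnf c) ≤ dp g
    derive k A dp≤ = let c , le = derive-children k (valid A) dp≤ in expand c , le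
    derive-children k (term _) _ = leaf , ≤-refl
    derive-children (suc k) (comp {e = e} {d = d} p q x< c< i<) (s≤s dp≤) =
      branch (proj₁ left) (proj₁ right) , s≤s (⊔-mono-≤ (≤-trans (proj₂ left) (≤-reflexive (cong dp (position-lookup p))))
        (≤-trans (proj₂ right) (≤-reflexive (cong dp (position-lookup q)))))
      where
      left : Σ (DerivationTree G cnf (position p)) λ D → treeDepth G cnf D ≤ dp (entryOf (position p))
      left = derive k (position p) (≤-trans (≤-reflexive (cong dp (position-lookup p))) (≤-trans (m≤m⊔n (dp e) (dp d)) dp≤))
      right : Σ (DerivationTree G cnf (position q)) λ D → treeDepth G cnf D ≤ dp (entryOf (position q))
      right = derive k (position q) (≤-trans (≤-reflexive (cong dp (position-lookup q))) (≤-trans (m≤n⊔m (dp e) (dp d)) dp≤))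

    grammar-size : grammarSize G ≤ 2 * length T
    grammar-size = ≤-trans (bounded (allFin (length T))) (≤-reflexive (cong (2 *_) (length-tabulate {n = length T} (λ i → i))))
      where
      bounded : ∀ As → sum (map (λ A → size (rightHandSide (valid A))) As) ≤ 2 * length As
      bounded []       = z≤n
      bounded (A ∷ As) = ≤-trans (+-mono-≤ (rightHandSide-size (valid A)) (bounded As)) (≤-reflexive (sym (*-suc 2 (length As))))

    -- Cluster trees correspond to sentential forms made of nonterminals only. Comparing arguments
    -- as lists avoids casts along equations between ranks.
    data Rep {X : Set} : Rose → Sentential X → Set
    data Rep* {X : Set} : List Rose → List (Sentential X) → Set
    data Rep {X} where
      node : ∀ {x e ts A us} → At T x e → toℕ A ≡ x → Rep* ts (toList us) → Rep (tree x e ts) (node (inj₂ A) us)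
    data Rep* {X} where
      []  : Rep* [] []
      _∷_ : ∀ {t u ts us} → Rep t u → Rep* ts us → Rep* (t ∷ ts) (u ∷ us)

    module _ {X : Set} where

      Rep*-++ : ∀ {ts us : List Rose} {ms ns : List (Sentential X)} → Rep* ts ms → Rep* us ns → Rep* (ts ++ us) (ms ++ ns)
      Rep*-++ []       ss = ss
      Rep*-++ (r ∷ rs) ss = r ∷ Rep*-++ rs ss

      Rep*-split : ∀ ts {us} (ms : List (Sentential X)) {ns} → length ts ≡ length ms → Rep* (ts ++ us) (ms ++ ns) → Rep* ts ms × Rep* us ns
      Rep*-split []       []       _  rs       = [] , rs
      Rep*-split (t ∷ ts) (m ∷ ms) eq (r ∷ rs) with ps , qs ← Rep*-split ts ms (suc-injective eq) rs = r ∷ ps , qs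

      Rep*-focus : ∀ ts {t us} {ms : List (Sentential X)} → Rep* (ts ++ t ∷ us) ms →
        ∃₂ λ as m → ∃ λ bs → ms ≡ as ++ m ∷ bs × Rep* ts as × Rep t m × Rep* us bs
      Rep*-focus []       (r ∷ rs) = [] , _ , _ , refl , [] , r , rs
      Rep*-focus (t ∷ ts) (r ∷ rs) with as , m , bs , refl , ps , q , qs ← Rep*-focus ts rs = _ ∷ as , m , bs , refl , r ∷ ps , q , qs

      step-inside : ∀ {s} {us : Vec (Sentential X) (RankedAlphabet.rank (F ⊕ arity) s)} as {m m′ bs} → toList us ≡ as ++ m ∷ bs → Step G m m′ →
        ∃ λ vs → toList vs ≡ as ++ m′ ∷ bs × Step G (node s us) (node s vs)
      step-inside {s} {us} as {m} {m′} eq st with i , _ , m≡ , upd , _ ← lookup-split us as eq =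
        us [ i ]≔ m′ , upd m′ , inside s us i (subst (λ t → Step G t m′) (sym m≡) st)

      -- Substitution into the right-hand side is a `split`: the arguments are cut into the same
      -- three blocks as the parameters.
      rep-composition : ∀ {a g x e c d} (v : Valid fs T a g) us cs {vs} (args : Vec (Sentential X) (rk g)) → rule g ≡ comp x (length us) c →
        At T x e → At T c d → length cs ≡ rk d → Rep* (us ++ cs ++ vs) (toList args) →
        Rep (tree x e (us ++ tree c d cs ∷ vs)) (rightHandSide v ⟪ lookup args ⟫)
      rep-composition (comp p q x< c< i<) us cs {vs} args refl p′ q′ l rs
        with refl ← At-functional p p′ | refl ← At-functional q q′ =
        node p (position-toℕ p) (subst (Rep* _) (sym (composition-subst B C xs ys zs eqB eqC θ))
          (Rep*-++ (proj₁ outer) (node q (position-toℕ q) (subst (Rep* cs) (sym (innerArguments-toList B C xs ys zs eqB eqC θ)) (proj₁ middle)) ∷ proj₂ middle)))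
        where
        open Binary p q x< c< i<
        θ = lookup args
        split-args : toList args ≡ map θ xs ++ map θ ys ++ map θ zs
        split-args = trans (sym (map-lookup args)) (trans (cong (map θ) (sym together)) (trans (map-++ θ xs (ys ++ zs)) (cong (map θ xs ++_) (map-++ θ ys zs))))
        outer : Rep* us (map θ xs) × Rep* (cs ++ vs) (map θ ys ++ map θ zs)
        outer = Rep*-split us (map θ xs) (trans (sym xs≡) (sym (length-map θ xs))) (subst (Rep* (us ++ cs ++ vs)) split-args rs)
        middle : Rep* cs (map θ ys) × Rep* vs (map θ zs)
        middle = Rep*-split cs (map θ ys) (trans l (trans (cong rk (sym (position-lookup q))) (trans (sym eqC) (sym (length-map θ ys))))) (proj₂ outer)

      rep-step : ∀ {t t′} {m : Sentential X} → T ⊢ t ⟶ t′ → Rep t m → ∃ λ m′ → Rep t′ m′ × Step G m m′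
      rep-step (split us cs vs p eq q r l) (node {A = A} {us = args} _ A≡ rs) = _ ,
        rep-composition (valid A) us cs args (trans (cong rule (At-functional (subst (λ a → At T a (entryOf A)) A≡ (At-lookup T A)) p)) eq) q r l rs ,
        replace A args
      rep-step (inside us vs s) (node {A = A} {us = args} p A≡ rs)
        with as , m , bs , ms≡ , rs₁ , r , rs₂ ← Rep*-focus us rs
        with m′ , r′ , st ← rep-step s r
        with args′ , eq , st′ ← step-inside {inj₂ A} {args} as ms≡ st =
        node (inj₂ A) args′ , node p A≡ (subst (Rep* _) (sym eq) (Rep*-++ rs₁ (r′ ∷ rs₂))) , st′

      rep-steps : ∀ {t t′} {m : Sentential X} → T ⊢ t ⟶* t′ → Rep t m → ∃ λ m′ → Rep t′ m′ × Star (Step G) m m′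
      rep-steps ε        r = _ , r , ε
      rep-steps (s ◅ ss) r with m₁ , r₁ , st ← rep-step s r with m₂ , r₂ , sts ← rep-steps ss r₁ = m₂ , r₂ , st ◅ sts

      data Steps* : List (Sentential X) → List (Sentential X) → Set where
        []  : Steps* [] []
        _∷_ : ∀ {m m′ ms ms′} → Star (Step G) m m′ → Steps* ms ms′ → Steps* (m ∷ ms) (m′ ∷ ms′)

      star-inside : ∀ {s} {us : Vec (Sentential X) (RankedAlphabet.rank (F ⊕ arity) s)} as {m m′ bs} → toList us ≡ as ++ m ∷ bs → Star (Step G) m m′ →
        ∃ λ vs → toList vs ≡ as ++ m′ ∷ bs × Star (Step G) (node s us) (node s vs)
      star-inside as eq ε = _ , eq , ε
      star-inside {s} as eq (st ◅ sts) with vs , eq′ , st′ ← step-inside {s} as eq st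
        with ws , eq″ , sts′ ← star-inside {s} as eq′ sts = ws , eq″ , st′ ◅ sts′

      stars-inside : ∀ {s} {us : Vec (Sentential X) (RankedAlphabet.rank (F ⊕ arity) s)} as {ms ms′} → toList us ≡ as ++ ms → Steps* ms ms′ →
        ∃ λ vs → toList vs ≡ as ++ ms′ × Star (Step G) (node s us) (node s vs)
      stars-inside as eq [] = _ , eq , ε
      stars-inside {s} as {m ∷ ms} {m′ ∷ ms′} eq (st ∷ sts)
        with vs , eq′ , st′ ← star-inside {s} as eq st
        with ws , eq″ , sts′ ← stars-inside {s} (as ++ m′ ∷ []) (trans eq′ (sym (++-assoc as (m′ ∷ []) ms))) sts =
        ws , trans eq″ (++-assoc as (m′ ∷ []) ms′) , st′ ◅◅ sts′

      terminal-arguments : ∀ {k} (args : Vec (Sentential X) k) → toList (Vec.map (param {F ⊕ arity}) (Vec.allFin k) ⟪ lookup args ⟫*) ≡ toList args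
      terminal-arguments {k} args = trans (toList-subst (Vec.map param (Vec.allFin k)) (lookup args))
        (trans (cong (map (_⟪ lookup args ⟫)) (trans (toList-map param (Vec.allFin k)) (cong (map param) (toList-tabulate (λ i → i)))))
        (trans (sym (map-∘ (allFin k))) (map-lookup args)))

      rep-terminal : ∀ {a g f} (v : Valid fs T a g) (args : Vec (Sentential X) (rk g)) → g ≡ leafEntry f →
        ∃ λ vs → toList vs ≡ toList args × rightHandSide v ⟪ lookup args ⟫ ≡ node (inj₁ f) vs
      rep-terminal (term _) args refl = _ , terminal-arguments args , refl

      -- When every cluster is a single node, only terminal rules remain to be applied, at the root
      -- first and then in its arguments.
      spelled  : ∀ {t} {u : Term F X} {m : Sentential X} → Spells T t u → Rep t m → Star (Step G) m (terminalTerm G u)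
      spelled* : ∀ {k ts} {us : Vec (Term F X) k} {ms : List (Sentential X)} → Spells* T ts us → Rep* ts ms → Steps* ms (toList (terminalTerm* G us))
      spelled {u = node f us} (node p sps) (node {A = A} {us = args} p′ A≡ rs)
        with vs , vs≡ , eq ← rep-terminal (valid A) args (At-functional (subst (λ a → At T a (entryOf A)) A≡ (At-lookup T A)) p)
        with ws , ws≡ , sts ← stars-inside {inj₁ f} {vs} [] vs≡ (spelled* sps rs)
        with refl ← toList-injective ws (terminalTerm* G us) ws≡ =
        subst (λ m → Step G (node (inj₂ A) args) m) eq (replace A args) ◅ sts
      spelled* []         []       = []
      spelled* (sp ∷ sps) (r ∷ rs) = spelled sp r ∷ spelled* sps rs

    no-arguments : ∀ {k} {X : Set} → k ≡ 0 → (us : Vec (Sentential X) k) → Rep* [] (toList us)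
    no-arguments refl [] = []

    Spells-subst : ∀ {k t} {u : Tree F} (eq : 0 ≡ k) → Spells T t u → Spells T t (subst (λ n → Term F (Fin n)) eq u)
    Spells-subst refl sp = sp

    produces : ∀ {e t₀} {u : Tree F} → At T (toℕ start) e → T ⊢ tree (toℕ start) e [] ⟶* t₀ → Spells T t₀ u → Produces G u
    produces p sts sp
      with m , r , sts′ ← rep-steps sts (node {us = tabulate param} p refl (no-arguments start-rank (tabulate param))) =
      sts′ ◅◅ spelled (Spells-subst (sym start-rank) sp) r

    module Encoding (code : Symbol F → ℕ) (code-injective : ∀ {f g} → f ∈ fs → g ∈ fs → code f ≡ code g → f ≡ g) (M : ℕ) where
      open Representation F fs code code-injective M using (encodeRuleOf; encodeEntry; encodeTable)

      encode-rule : ∀ {a g} (v : Valid fs T a g) → encodeRule code G (normalForm v) ≡ encodeRuleOf (rule g)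
      encode-rule (term _) = refl
      encode-rule (comp p q x< c< i<) =
        cong (1 ∷_) (cong₂ _∷_ (position-toℕ p) (cong₂ (λ i c → i ∷ c ∷ []) (trans (hole-toℕ B C xs ys zs eqB eqC) xs≡) (position-toℕ q)))
        where open Binary p q x< c< i<

      encode-grammar : encodeGrammar code G cnf ≡ length T ∷ toℕ start ∷ encodeTable T
      encode-grammar = cong (λ xs → length T ∷ toℕ start ∷ List.concat xs) (trans
        (map-tabulate (λ A → A) (λ A → arity A ∷ encodeRule code G (cnf A)))
        (trans (tabulate-cong (λ A → cong (arity A ∷_) (encode-rule (valid A))))
        (trans (sym (map-tabulate (List.lookup T) encodeEntry)) (cong (map encodeEntry) (tabulate-lookup T)))))

-- The program

infixl 6 _⊞_ _⊟_
infixl 7 _⊠_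

_⊞_ _⊟_ _⊠_ : Expr → Expr → Expr
_⊞_ = op add
_⊟_ = op monus
_⊠_ = op mul

vSize vRank vNid vOut vCount vPos vX vArity vIndex vSp vFlag vHash vC vCode : ℕ
vSize  = 0   -- n
vRank  = 1   -- R
vNid   = 2   -- length of the table
vOut   = 3   -- first free cell of the output
vCount = 4   -- number of clusters
vPos   = 5
vX     = 6
vArity = 7
vIndex = 8
vSp    = 9   -- height of the stack
vFlag  = 10
vHash  = 11
vC     = 12
vCode  = 13

aIn aCur aNew aRank aWeight aTerm aComp aStPos aStFlag aStId : ℕ
aIn     = 1
aCur    = 2
aNew    = 3
aRank   = 4
aWeight = 5
aTerm   = 6
aComp   = 7
aStPos  = 8
aStFlag = 9
aStId   = 10

keyExpr threshold permitted newRank newWeight : Expr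
keyExpr = (var vX ⊠ (lit 2 ⊠ var vSize) ⊞ var vIndex) ⊠ (lit 2 ⊠ var vSize) ⊞ var vC
threshold = (lit 8 ⊞ lit 4 ⊠ var vRank) ⊠ var vSize
-- A product that is positive iff none of the reasons for a refusal applies.
permitted =
  (lit 1 ⊟ (aStFlag [[ var vSp ]])) ⊠
  (lit 2 ⊞ var vRank ⊟ ((aRank [[ var vX ]]) ⊞ (aRank [[ aStId [[ var vSp ]] ]]))) ⊠
  (threshold ⊟ (aWeight [[ var vX ]]) ⊠ var vCount) ⊠
  (threshold ⊟ (aWeight [[ aStId [[ var vSp ]] ]]) ⊠ var vCount)
newRank = (aRank [[ var vX ]]) ⊞ (aRank [[ var vC ]]) ⊟ lit 1
newWeight = (aWeight [[ var vX ]]) ⊞ (aWeight [[ var vC ]])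

emitComposition recordComposition findChild lookUp absorbChild childStep childLoop : Cmd
emitComposition =
  writeIO (var vOut) newRank ⍮
  writeIO (var vOut ⊞ lit 1) (lit 1) ⍮
  writeIO (var vOut ⊞ lit 2) (var vX) ⍮
  writeIO (var vOut ⊞ lit 3) (var vIndex) ⍮
  writeIO (var vOut ⊞ lit 4) (var vC)
recordComposition =
  write aComp keyExpr (var vNid ⊞ lit 1) ⍮
  set vIndex (var vIndex ⊞ (aRank [[ var vC ]])) ⍮
  write aWeight (var vNid) newWeight ⍮
  write aRank (var vNid) newRank ⍮
  set vX (var vNid) ⍮
  set vNid (var vNid ⊞ lit 1) ⍮
  set vOut (var vOut ⊞ lit 5)
findChild =
  set vC (aStId [[ var vSp ]]) ⍮
  set vHash (aComp [[ keyExpr ]]) ⍮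
  -- Only the root of the child is deleted from the preorder sequence. Its own children already
  -- stand where the children of the composition belong.
  write aNew (aStPos [[ var vSp ]]) (lit 0) ⍮
  set vFlag (lit 1)
lookUp =
  if (lit 0) (var vHash)
    (set vX (var vHash ⊟ lit 1) ⍮ set vIndex (var vIndex ⊞ (aRank [[ var vC ]])))
    (emitComposition ⍮ recordComposition)
absorbChild = findChild ⍮ lookUp
childStep =
  set vArity (var vArity ⊟ lit 1) ⍮
  set vSp (var vSp ⊟ lit 1) ⍮
  if (lit 0) permitted absorbChild (set vIndex (var vIndex ⊞ lit 1))
childLoop = while (lit 0) (var vArity) childStep

-- The preorder is scanned from right to left. When a node is reached, its children have been
-- treated and lie on the stack, the first child on top.
nodeStart nodeEnd nodeStep nodeLoop : Cmd
nodeStart =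
  set vPos (var vPos ⊟ lit 1) ⍮
  set vX (aCur [[ var vPos ]]) ⍮
  set vArity (aRank [[ var vX ]]) ⍮
  set vIndex (lit 0) ⍮
  set vFlag (lit 0)
nodeEnd =
  write aNew (var vPos) (var vX ⊞ lit 1) ⍮
  write aStPos (var vSp) (var vPos) ⍮
  write aStFlag (var vSp) (var vFlag) ⍮
  write aStId (var vSp) (var vX) ⍮
  set vSp (var vSp ⊞ lit 1)
nodeStep = nodeStart ⍮ childLoop ⍮ nodeEnd
nodeLoop = while (lit 0) (var vPos) nodeStep

childTime childExit : ℕ
childTime = testCost (lit 0) (var vArity) + suc (cost childStep)
childExit = testCost (lit 0) (var vArity) + 1

nodeTime : ℕ → ℕ
nodeTime k = testCost (lit 0) (var vPos) + suc (cost nodeStart + (k * childTime + childExit + cost nodeEnd))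

vNew : ℕ
vNew = 14

compactStep compactLoop roundStep roundLoop : Cmd
compactStep =
  set vHash (aNew [[ var vPos ]]) ⍮
  if (lit 0) (var vHash)
    (write aCur (var vNew) (var vHash ⊟ lit 1) ⍮ set vNew (var vNew ⊞ lit 1))
    nop ⍮
  set vPos (var vPos ⊞ lit 1)
compactLoop = while (var vPos) (var vCount) compactStep
roundStep =
  (set vPos (var vCount) ⍮ set vSp (lit 0)) ⍮
  nodeLoop ⍮
  (set vPos (lit 0) ⍮ set vNew (lit 0)) ⍮
  compactLoop ⍮
  set vCount (var vNew)
roundLoop = while (lit 1) (var vCount) roundStep

beginTime nodeExit middleTime endTime compactTime compactExit : ℕ
beginTime = cost (set vPos (var vCount) ⍮ set vSp (lit 0))
nodeExit = testCost (lit 0) (var vPos) + 1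
middleTime = cost (set vPos (lit 0) ⍮ set vNew (lit 0))
endTime = cost (set vCount (var vNew))
compactTime = testCost (var vPos) (var vCount) + suc (cost compactStep)
compactExit = testCost (var vPos) (var vCount) + 1

-- The input is copied to the array `aIn` first, because the rules are written over it.
copyStep copyLoop newTerm readStep rankStep findTerm termStep assignStep initStep initLoop : Cmd
copyStep =
  readIO vX (var vPos) ⍮
  write aIn (var vPos) (var vX) ⍮
  set vPos (var vPos ⊞ lit 1)
copyLoop = while (var vPos) (lit 1 ⊞ lit 2 ⊠ var vSize) copyStep
newTerm =
  writeIO (var vOut) (var vArity) ⍮
  writeIO (var vOut ⊞ lit 1) (lit 0) ⍮
  writeIO (var vOut ⊞ lit 2) (var vCode) ⍮
  write aTerm (var vCode) (var vNid ⊞ lit 1) ⍮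
  write aRank (var vNid) (var vArity) ⍮
  write aWeight (var vNid) (lit 1) ⍮
  set vX (var vNid) ⍮
  set vNid (var vNid ⊞ lit 1) ⍮
  set vOut (var vOut ⊞ lit 3)
readStep =
  set vCode (aIn [[ lit 1 ⊞ lit 2 ⊠ var vPos ]]) ⍮
  set vArity (aIn [[ lit 2 ⊞ lit 2 ⊠ var vPos ]])
rankStep = if (var vRank) (var vArity) (set vRank (var vArity)) nop
findTerm = set vHash (aTerm [[ var vCode ]])
termStep = if (lit 0) (var vHash) (set vX (var vHash ⊟ lit 1)) newTerm
assignStep =
  write aCur (var vPos) (var vX) ⍮
  set vPos (var vPos ⊞ lit 1)
initStep = readStep ⍮ rankStep ⍮ findTerm ⍮ termStep ⍮ assignStep
initLoop = while (var vPos) (var vSize) initStep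

initTime initExit : ℕ
initTime = testCost (var vPos) (var vSize) + suc (cost initStep)
initExit = testCost (var vPos) (var vSize) + 1

startStep print main : Cmd
startStep = set vPos (lit 0) ⍮ set vRank (lit 2) ⍮ set vOut (lit 2)
print = writeIO (lit 0) (var vNid) ⍮ writeIO (lit 1) (aCur [[ lit 0 ]])
main = readIO vSize (lit 0) ⍮ copyLoop ⍮ startStep ⍮ initLoop ⍮ set vCount (var vSize) ⍮ roundLoop ⍮ print

copyTime copyExit roundExit : ℕ
copyTime = testCost (var vPos) (lit 1 ⊞ lit 2 ⊠ var vSize) + suc (cost copyStep)
copyExit = testCost (var vPos) (lit 1 ⊞ lit 2 ⊠ var vSize) + 1
roundExit = testCost (lit 1) (var vCount) + 1

nodeCost fixedCost roundCost : ℕ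
nodeCost = nodeTime 0 + childTime
fixedCost = beginTime + nodeExit + middleTime + compactExit + endTime
roundCost = testCost (lit 1) (var vCount) + suc (fixedCost + nodeCost + compactTime)

mainTime : ℕ → ℕ → ℕ
mainTime l n = cost (readIO vSize (lit 0)) + (l * copyTime + copyExit + (cost startStep +
  (n * initTime + initExit + (cost (set vCount (var vSize)) + (8 * roundCost * n + roundExit + cost print)))))

mainCost : ℕ
mainCost = cost (readIO vSize (lit 0)) + 3 * copyTime + copyExit + cost startStep + initTime + initExit +
  cost (set vCount (var vSize)) + 8 * roundCost + roundExit + cost print

mainTime≤ : ∀ n → 1 ≤ n → mainTime (1 + 2 * n) n ≤ mainCost * n
mainTime≤ n 1≤n = bound (cost (readIO vSize (lit 0))) copyTime copyExit (cost startStep) initTime initExit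
  (cost (set vCount (var vSize))) (8 * roundCost) roundExit (cost print)
  where
  collect : ∀ a b c d e f g h i j n →
    (a + b + c + d + f + g + i + j) * n + (2 * b + e + h) * n ≡ (a + 3 * b + c + d + e + f + g + h + i + j) * n
  collect = solve-∀
  rearrange : ∀ a b c d e f g h i j n → a + ((1 + 2 * n) * b + c + (d + (n * e + f + (g + (h * n + i + j))))) ≡
    a + b + c + d + f + g + i + j + (2 * b + e + h) * n
  rearrange = solve-∀
  bound : ∀ a b c d e f g h i j → a + ((1 + 2 * n) * b + c + (d + (n * e + f + (g + (h * n + i + j))))) ≤
    (a + 3 * b + c + d + e + f + g + h + i + j) * n
  bound a b c d e f g h i j = ≤-trans (≤-reflexive (rearrange a b c d e f g h i j n))
    (≤-trans (+-monoˡ-≤ _ (m≤m*n (a + b + c + d + f + g + i + j) n {{>-nonZero 1≤n}})) (≤-reflexive (collect a b c d e f g h i j n)))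

-- Correctness of the contraction pass

product-positive : ∀ a b → 0 < a * b → 0 < a × 0 < b
product-positive (suc a) (suc b) _ = s≤s z≤n , s≤s z≤n
product-positive (suc a) zero lt = contradiction (≤-trans lt (≤-reflexive (*-zeroʳ a))) λ ()

product-zero : ∀ a b → a * b ≤ 0 → a ≤ 0 ⊎ b ≤ 0
product-zero zero    b    _ = inj₁ z≤n
product-zero (suc a) zero _ = inj₂ z≤n

monus-positive : ∀ a b → 0 < a ∸ b → b < a
monus-positive a b lt = ≰⇒> λ a≤b → contradiction (≤-trans lt (≤-reflexive (m≤n⇒m∸n≡0 a≤b))) λ ()

monus-zero : ∀ a b → a ∸ b ≤ 0 → a ≤ b
monus-zero a b le = m∸n≡0⇒m≤n (n≤0⇒n≡0 le)

-- The results of a round for a tree: whether the root has absorbed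
-- something, the new tree, and the array aNew right of its root.
Result : RankedAlphabet → Set
Result F = Bool × Clusters.Rose F × List ℕ

record Setting (F : RankedAlphabet) : Set where
  field
    fs             : List (Symbol F)
    code           : Symbol F → ℕ
    code-injective : ∀ {f g} → f ∈ fs → g ∈ fs → code f ≡ code g → f ≡ g
    W b n R        : ℕ
    1≤R            : 1 ≤ R
    0<n            : 0 < n
    32≤b           : 32 ≤ b
    fits           : 16 * b ^ 16 + 16 + (16 * n + 16) ≤ W
    base≤b         : 16 * n + 16 ≤ b
    R≤2n           : R ≤ 2 * n
    2K<b           : 2 * ((8 + 4 * R) * n) < b

module Rounds (F : RankedAlphabet) (setting : Setting F) where

  open Setting setting

  -- `base` leaves room for the `1 + 2 n` cells of the input and for the output, which is at most
  -- `2 + 5 * 2 n` cells long. `M` bounds the number of rules as well as the positions of children.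
  base K M : ℕ
  base = 16 * n + 16
  K    = (8 + 4 * R) * n
  M    = 2 * n

  open Clusters F
  open Machine W base b 32≤b fits
  open Representation F fs code code-injective M
  open Store

  TableIn : Table → Store → Set
  TableIn T s = Represents T (vars s vNid) (vars s vOut) (arrays s aRank) (arrays s aWeight) (arrays s aTerm) (arrays s aComp) (io s)

  small<b : ∀ {x} m → x ≤ m * n + 15 → m ≤ 16 → x < b
  small<b m x≤ m≤16 = ≤-trans (s≤s x≤) (≤-trans (s≤s (+-monoˡ-≤ 15 (*-monoˡ-≤ n m≤16)))
    (≤-trans (≤-reflexive (sym (+-suc (16 * n) 15))) base≤b))

  module Round (N : ℕ) (1≤N : 1 ≤ N) (N≤n : N ≤ n) (cur : ℕ → ℕ) where
    open Contraction fs R N K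

    record Frame (T : Table) (s : Store) : Set where
      field
        size≡  : vars s vSize ≡ n
        rank≡  : vars s vRank ≡ R
        count≡ : vars s vCount ≡ N
        cur≡   : arrays s aCur ≡ cur
        table  : TableIn T s
    open Frame

    outcomes : List (Result F) → List (Bool × Rose)
    outcomes = map λ (flag , t , _) → flag , t

    -- The part of `aNew` that belongs to siblings already treated. Roots are stored plus one, as 0
    -- marks a deleted position.
    cells : List (Result F) → List ℕ → List ℕ
    cells []                     rest = rest
    cells ((_ , t , blk) ∷ ms) rest = suc (root t) ∷ blk ++ cells ms rest

    frames : ℕ → List (Result F) → Stack
    frames o []                        = []
    frames o ((flag , t , blk) ∷ ms) = (o , bit flag , root t) ∷ frames (o + suc (length blk)) ms

    frames-length : ∀ o ms S → length (frames o ms ++ S) ≡ length ms + length S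
    frames-length o []       S = refl
    frames-length o (m ∷ ms) S = cong suc (frames-length _ ms S)

    Decodes : Result F → Set
    Decodes (_ , tree x e us , blk) = decode blk ≡ flat* us

    -- The head at position `p` in the midst of its children: `dn` is the final contents of the
    -- cells of those dealt with, followed by the cells of the waiting ones, `ms`, and by `rest`,
    -- all that lies right of this subtree. `S` is the stack below the waiting children.
    record InNode (T : Table) (h : Head) (ms : List (Result F)) (p : ℕ) (dn : List ℕ) (S : Stack) (rest : List ℕ)
                  (s : Store) : Set where
      field
        frame  : Frame T s
        x≡     : vars s vX ≡ hid h
        arity≡ : vars s vArity ≡ length ms
        index≡ : vars s vIndex ≡ length (hkids h)
        flag≡  : vars s vFlag ≡ bit (hflag h)
        pos≡   : vars s vPos ≡ p
        sp≡    : vars s vSp ≡ length ms + length S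
        stack  : HoldsStack (arrays s aStPos) (arrays s aStFlag) (arrays s aStId) (frames (suc p + length dn) ms ++ S)
        new    : Holds (arrays s aNew) (suc p) (dn ++ cells ms rest)
    open InNode

    next-frames : ∀ p (dn : List ℕ) {v} (blk : List ℕ) ms {A B C S} → HoldsStack A B C (frames (suc p + length dn + suc (length blk)) ms ++ S) →
                  HoldsStack A B C (frames (suc p + length (dn ++ v ∷ blk)) ms ++ S)
    next-frames p dn {v} blk ms {A} {B} {C} {S} = subst (λ o → HoldsStack A B C (frames o ms ++ S))
      (trans (+-assoc (suc p) (length dn) _) (cong (suc p +_) (sym (length-++ dn {v ∷ blk}))))

    permitted-value : ∀ {sf rx rd wx wd r m k} {flag : Bool} {e d} →
      sf ≡ bit flag → rx ≡ rk e → rd ≡ rk d → wx ≡ wt e → wd ≡ wt d → r ≡ R → m ≡ N → k ≡ n →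
      (1 ∸ sf) * (2 + r ∸ (rx + rd)) * ((8 + 4 * r) * k ∸ wx * m) * ((8 + 4 * r) * k ∸ wd * m) ≡
      (1 ∸ bit flag) * (2 + R ∸ (rk e + rk d)) * (K ∸ wt e * N) * (K ∸ wt d * N)
    permitted-value refl refl refl refl refl refl refl refl = refl

    allowed : ∀ flag e d → 0 < (1 ∸ bit flag) * (2 + R ∸ (rk e + rk d)) * (K ∸ wt e * N) * (K ∸ wt d * N) →
              flag ≡ false × rk e + rk d ≤ suc R × wt e * N < K × wt d * N < K
    allowed flag e d pos
      with pos₁ , d< ← product-positive ((1 ∸ bit flag) * (2 + R ∸ (rk e + rk d)) * (K ∸ wt e * N)) (K ∸ wt d * N) pos
      with pos₂ , e< ← product-positive ((1 ∸ bit flag) * (2 + R ∸ (rk e + rk d))) (K ∸ wt e * N) pos₁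
      with f< , r< ← product-positive (1 ∸ bit flag) (2 + R ∸ (rk e + rk d)) pos₂ =
      unset flag f< , s≤s⁻¹ (monus-positive (2 + R) _ r<) , monus-positive K (wt e * N) e< , monus-positive K (wt d * N) d<
      where
      unset : ∀ flag → 0 < 1 ∸ bit flag → flag ≡ false
      unset false _ = refl

    refused : ∀ flag e d → (1 ∸ bit flag) * (2 + R ∸ (rk e + rk d)) * (K ∸ wt e * N) * (K ∸ wt d * N) ≤ 0 →
              Refusal e flag d
    refused flag e d le
      with product-zero ((1 ∸ bit flag) * (2 + R ∸ (rk e + rk d)) * (K ∸ wt e * N)) (K ∸ wt d * N) le
    ... | inj₂ d≥ = bigChild (monus-zero K (wt d * N) d≥)
    ... | inj₁ le₁ with product-zero ((1 ∸ bit flag) * (2 + R ∸ (rk e + rk d))) (K ∸ wt e * N) le₁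
    ...   | inj₂ e≥ = bigHead (monus-zero K (wt e * N) e≥)
    ...   | inj₁ le₂ with product-zero (1 ∸ bit flag) (2 + R ∸ (rk e + rk d)) le₂
    ...     | inj₂ r≥ = high (monus-zero (2 + R) _ r≥)
    ...     | inj₁ f≥ with flag
    ...       | true = busy refl

    weight<b : ∀ e d → wt e * N < K → wt d * N < K → wt e + wt d < b
    weight<b e d e< d< = ≤-trans (s≤s (+-mono-≤ (≤K (wt e) e<) (≤K (wt d) d<)))
      (≤-trans (s≤s (≤-reflexive (cong (K +_) (sym (+-identityʳ K))))) 2K<b)
      where
      ≤K : ∀ w → w * N < K → w ≤ K
      ≤K w lt = ≤-trans (m≤m*n w N {{>-nonZero 1≤N}}) (<⇒≤ lt)

    record NewComposition (T : Table) (x : ℕ) (e : Entry) (i c : ℕ) (d : Entry) (s : Store) : Set where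
      field
        x-at    : At T x e
        c-at    : At T c d
        i<M     : i < M
        room    : length T < M
        i+d≤    : i + rk d ≤ M
        r≤      : rk e + rk d ≤ suc R
        e<      : wt e * N < K
        d<      : wt d * N < K
        size≡n  : vars s vSize ≡ n
        vX≡      : vars s vX ≡ x
        vIndex≡      : vars s vIndex ≡ i
        vC≡      : vars s vC ≡ c
        tableIn   : TableIn T s
        fresh   : Fresh T (comp x i c)

    module Addition {T : Table} {x : ℕ} {e : Entry} {i c : ℕ} {d : Entry} {s : Store} (new-composition : NewComposition T x e i c d s) where
      open NewComposition new-composition

      private
        f = combine x e i c d
        r = arrays s aRank (vars s vX) + arrays s aRank (vars s vC) ∸ 1
        w = arrays s aWeight (vars s vX) + arrays s aWeight (vars s vC)
        q = vars s vOut
        io₁ = ((((io s [ q ↦ r ]) [ q + 1 ↦ 1 ]) [ q + 2 ↦ vars s vX ]) [ q + 3 ↦ vars s vIndex ]) [ q + 4 ↦ vars s vC ]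

      rank-x : arrays s aRank (vars s vX) ≡ rk e
      rank-x = trans (cong (arrays s aRank) vX≡) (Represents.ranks tableIn x-at)

      rank-c : arrays s aRank (vars s vC) ≡ rk d
      rank-c = trans (cong (arrays s aRank) vC≡) (Represents.ranks tableIn c-at)

      weight-x : arrays s aWeight (vars s vX) ≡ wt e
      weight-x = trans (cong (arrays s aWeight) vX≡) (Represents.wts tableIn x-at)

      weight-c : arrays s aWeight (vars s vC) ≡ wt d
      weight-c = trans (cong (arrays s aWeight) vC≡) (Represents.wts tableIn c-at)

      q+<base : ∀ m → m ≤ 5 → q + m < base
      q+<base m m≤5 = ≤-trans (s≤s (≤-trans (+-mono-≤ (≤-trans (≤-reflexive (Represents.q≡ tableIn))
          (+-monoʳ-≤ 2 (≤-trans (encodeTable-length T) (*-monoʳ-≤ 5 (<⇒≤ room))))) m≤5)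
          (≤-reflexive (rearrange n))))
        (≤-trans (≤-reflexive (sym (+-suc (10 * n) 7))) (+-mono-≤ (*-monoˡ-≤ n {10} {16} (≤ᵇ⇒≤ 10 16 tt)) (≤ᵇ⇒≤ 8 16 tt)))
        where
        rearrange : ∀ n → 2 + 5 * (2 * n) + 5 ≡ 10 * n + 7
        rearrange = solve-∀

      ≤M⇒<b : ∀ {v} → v ≤ M → v < b
      ≤M⇒<b v≤ = small<b 2 (≤-trans v≤ (m≤m+n M 15)) (s≤s (s≤s z≤n))

      nid+1<b : vars s vNid + 1 < b
      nid+1<b = ≤M⇒<b (≤-trans (≤-reflexive (trans (cong (_+ 1) (Represents.nid≡ tableIn)) (+-comm _ 1))) room)

      rank<b : r < b
      rank<b = ≤M⇒<b (≤-trans (≤-reflexive (cong (_∸ 1) (cong₂ _+_ rank-x rank-c))) (≤-trans (∸-monoˡ-≤ 1 r≤) R≤2n))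

      weight<b′ : w < b
      weight<b′ = subst (_< b) (sym (cong₂ _+_ weight-x weight-c)) (weight<b e d e< d<)

      index<b : vars s vIndex + arrays s aRank (vars s vC) < b
      index<b = ≤M⇒<b (≤-trans (≤-reflexive (cong₂ _+_ vIndex≡ rank-c)) i+d≤)

      emit-wp : wp emitComposition s λ s₁ → s₁ ≡ ⟪ vars s , arrays s , io₁ ⟫
      emit-wp = subst (_< base) (+-identityʳ q) (q+<base 0 z≤n) , rank<b ,
        q+<base 1 (s≤s z≤n) , tt , q+<base 2 (s≤s (s≤s z≤n)) , tt ,
        q+<base 3 (s≤s (s≤s (s≤s z≤n))) , tt , q+<base 4 (s≤s (s≤s (s≤s (s≤s z≤n)))) , tt , refl

      record Added (s₂ : Store) : Set where
        field
          table₂  : TableIn (T ++ f ∷ []) s₂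
          x₂      : vars s₂ vX ≡ length T
          index₂  : vars s₂ vIndex ≡ i + rk d
          size₂   : vars s₂ vSize ≡ vars s vSize
          rank₂   : vars s₂ vRank ≡ vars s vRank
          count₂  : vars s₂ vCount ≡ vars s vCount
          arity₂  : vars s₂ vArity ≡ vars s vArity
          flag₂   : vars s₂ vFlag ≡ vars s vFlag
          pos₂    : vars s₂ vPos ≡ vars s vPos
          sp₂     : vars s₂ vSp ≡ vars s vSp
          cur₂    : arrays s₂ aCur ≡ arrays s aCur
          new₂    : arrays s₂ aNew ≡ arrays s aNew
          stPos₂  : arrays s₂ aStPos ≡ arrays s aStPos
          stFlag₂ : arrays s₂ aStFlag ≡ arrays s aStFlag
          stId₂   : arrays s₂ aStId ≡ arrays s aStId

      hash-index : (vars s vX * (2 * vars s vSize) + vars s vIndex) * (2 * vars s vSize) + vars s vC ≡ key M x i c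
      hash-index = value vX≡ size≡n vIndex≡ vC≡
        where
        value : ∀ {x′ n′ i′ c′} → x′ ≡ x → n′ ≡ n → i′ ≡ i → c′ ≡ c → (x′ * (2 * n′) + i′) * (2 * n′) + c′ ≡ key M x i c
        value refl refl refl refl = refl

      record-table : Represents (T ++ f ∷ []) (vars s vNid + 1) (vars s vOut + 5) (arrays s aRank [ vars s vNid ↦ r ])
        (arrays s aWeight [ vars s vNid ↦ w ]) (arrays s aTerm)
        (arrays s aComp [ (vars s vX * (2 * vars s vSize) + vars s vIndex) * (2 * vars s vSize) + vars s vC ↦ vars s vNid + 1 ]) io₁
      record-table = represents-comp {x = x} {e} {i} {c} {d} fresh i<M (<-trans (At-< c-at) room) hash-index
        (cong (_∸ 1) (cong₂ _+_ rank-x rank-c)) (cong₂ _+_ weight-x weight-c) vX≡ vIndex≡ vC≡ tableIn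

      record-wp : wp recordComposition ⟪ vars s , arrays s , io₁ ⟫ Added
      record-wp = nid+1<b , index<b , weight<b′ , rank<b , tt , nid+1<b , <-≤-trans (q+<base 5 ≤-refl) base≤b , record
        { table₂ = record-table
        ; x₂ = Represents.nid≡ tableIn
        ; index₂ = cong₂ _+_ vIndex≡ rank-c
        ; size₂ = refl ; rank₂ = refl ; count₂ = refl ; arity₂ = refl ; flag₂ = refl ; pos₂ = refl ; sp₂ = refl
        ; cur₂ = refl ; new₂ = refl ; stPos₂ = refl ; stFlag₂ = refl ; stId₂ = refl
        }

      addition-wp : wp (emitComposition ⍮ recordComposition) s Added
      addition-wp = wp-mono emitComposition {s} (λ s₁ → s₁ ≡ ⟪ vars s , arrays s , io₁ ⟫) (λ s₁ → wp recordComposition s₁ Added)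
        (λ { _ refl → record-wp }) emit-wp

    -- A derivation of `Absorb` is completed from its end, whereas the machine starts at its
    -- beginning. So a step is recorded as `continue`, which puts it in front of any completion; `δ`
    -- is 1 if the child was absorbed and 0 otherwise.
    record Stepped (T : Table) (D E : ℕ) (h : Head) (r : Result F) (ms : List (Result F)) (p : ℕ) (dn : List ℕ)
                   (S : Stack) (rest : List ℕ) (s : Store) : Set where
      field
        T₁       : Table
        h₁       : Head
        dn₁      : List ℕ
        β₁ δ     : ℕ
        continue : ∀ {rs T₂ h₂ a} → Absorb T₁ h₁ rs T₂ h₂ a → Absorb T h (outcomes (r ∷ []) ++ rs) T₂ h₂ (δ + a)
        T₁-ok    : OK fs R T₁
        T⊑T₁     : T ⊑ T₁
        T₁-size  : length T₁ ≤ length T + 1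
        invariant : HeadInv T₁ D E β₁ (length ms) h₁
        decoded  : decode dn₁ ≡ flat* (hkids h₁)
        longer   : length dn₁ ≡ length dn + length (cells (r ∷ []) [])
        state    : InNode T₁ h₁ ms p dn₁ S rest s

    module Child {T D E β x e fl ts flag c d us blk ms p dn S rest s}
      (ok : OK fs R T) (hi : HeadInv T D E β (suc (length ms)) (head x e fl ts))
      (ri : ResultInv T D E (flag , tree c d us)) (blk-ok : decode blk ≡ flat* us) (dn-ok : decode dn ≡ flat* ts)
      (room : length T < M)
      (I : InNode T (head x e fl ts) ((flag , tree c d us , blk) ∷ ms) p dn S rest s) where

      private
        fr = frame I
        Next = Stepped T D E (head x e fl ts) (flag , tree c d us , blk) ms p dn S rest
        sp = vars s vSp ∸ 1
        C = arrays s aStId sp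

      index< : length ts < M
      index< = ≤-trans (≤-trans (m≤m+n _ (length ms)) (≤-reflexive (trans (sym (+-suc (length ts) (length ms))) (HeadInv.arity hi))))
        (≤-trans (OK-rank ok (HeadInv.at hi)) R≤2n)

      c-at : At T c d
      c-at with wf q _ _ _ ← proj₁ ri = q

      us-length : length us ≡ rk d
      us-length with wf _ l _ _ ← proj₁ ri = l

      sp-value : sp ≡ length (frames (suc p + length dn + suc (length blk)) ms ++ S)
      sp-value = trans (cong (_∸ 1) (sp≡ I)) (sym (frames-length _ ms S))

      pos-value : arrays s aStPos sp ≡ suc p + length dn
      pos-value = trans (cong (arrays s aStPos) sp-value) (proj₁ (stack I))

      flag-value : arrays s aStFlag sp ≡ bit flag
      flag-value = trans (cong (arrays s aStFlag) sp-value) (proj₁ (proj₂ (stack I)))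

      c-value : C ≡ c
      c-value = trans (cong (arrays s aStId) sp-value) (proj₁ (proj₂ (proj₂ (stack I))))

      stack-value : HoldsStack (arrays s aStPos) (arrays s aStFlag) (arrays s aStId) (frames (suc p + length dn + suc (length blk)) ms ++ S)
      stack-value = proj₂ (proj₂ (proj₂ (stack I)))

      rank-x : arrays s aRank (vars s vX) ≡ rk e
      rank-x = trans (cong (arrays s aRank) (x≡ I)) (Represents.ranks (table fr) (HeadInv.at hi))

      rank-c : arrays s aRank C ≡ rk d
      rank-c = trans (cong (arrays s aRank) c-value) (Represents.ranks (table fr) c-at)

      weight-x : arrays s aWeight (vars s vX) ≡ wt e
      weight-x = trans (cong (arrays s aWeight) (x≡ I)) (Represents.wts (table fr) (HeadInv.at hi))

      weight-c : arrays s aWeight C ≡ wt d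
      weight-c = trans (cong (arrays s aWeight) c-value) (Represents.wts (table fr) c-at)

      blk-length : ∀ v → length (dn ++ v ∷ blk) ≡ length dn + suc (length (blk ++ []))
      blk-length v = trans (length-++ dn {v ∷ blk}) (cong (λ z → length dn + suc (length z)) (sym (++-identityʳ blk)))

      index+1<b : vars s vIndex + 1 < b
      index+1<b = small<b 2 (≤-trans (≤-reflexive (trans (cong (_+ 1) (index≡ I)) (+-comm _ 1))) (≤-trans index< (m≤m+n M 15)))
        (s≤s (s≤s z≤n))

      keep-post : Refusal e flag d →
        Next (setVar vIndex (vars s vIndex + 1) (setVar vSp sp (setVar vArity (vars s vArity ∸ 1) s)))
      keep-post ref = record
        { T₁ = T ; h₁ = head x e fl (ts ++ tree c d us ∷ []) ; dn₁ = dn ++ suc c ∷ blk ; β₁ = β ; δ = 0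
        ; continue = keep ref
        ; T₁-ok = ok ; T⊑T₁ = λ q → q ; T₁-size = m≤m+n _ 1
        ; invariant = HeadInv-keep hi (proj₁ ri)
        ; decoded = trans (decode-++ dn _) (trans (cong₂ (λ xs ys → xs ++ c ∷ ys) dn-ok (trans blk-ok (sym (++-identityʳ _)))) (sym (flat*-++ ts _)))
        ; longer = blk-length (suc c)
        ; state = record
          { frame  = record { size≡ = size≡ fr ; rank≡ = rank≡ fr ; count≡ = count≡ fr ; cur≡ = cur≡ fr ; table = table fr }
          ; x≡     = x≡ I
          ; arity≡ = cong (_∸ 1) (arity≡ I)
          ; index≡ = trans (cong (_+ 1) (index≡ I)) (sym (length-++ ts))
          ; flag≡  = flag≡ I
          ; pos≡   = pos≡ I
          ; sp≡    = cong (_∸ 1) (sp≡ I)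
          ; stack  = next-frames p dn {suc c} blk ms stack-value
          ; new    = subst (Holds _ (suc p)) (sym (++-assoc dn (suc c ∷ blk) (cells ms rest))) (new I)
          }
        }

      hash-index : (vars s vX * (2 * vars s vSize) + vars s vIndex) * (2 * vars s vSize) + C ≡ key M x (length ts) c
      hash-index = value (x≡ I) (size≡ fr) (index≡ I) c-value
        where
        value : ∀ {x′ n′ i′ c′ i} → x′ ≡ x → n′ ≡ n → i′ ≡ i → c′ ≡ c → (x′ * (2 * n′) + i′) * (2 * n′) + c′ ≡ key M x i c
        value refl refl refl refl = refl

      located : Located T (comp x (length ts) c) (arrays s aComp ((vars s vX * (2 * vars s vSize) + vars s vIndex) * (2 * vars s vSize) + C))
      located = subst (λ k → Located T (comp x (length ts) c) (arrays s aComp k)) (sym hash-index)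
        (Represents.comps (table fr) {x} {length ts} {c} index< (<-trans (At-< c-at) room))

      new-value : Holds (arrays s aNew [ arrays s aStPos sp ↦ 0 ]) (suc p) ((dn ++ 0 ∷ blk) ++ cells ms rest)
      new-value = subst (Holds _ (suc p)) (sym (++-assoc dn (0 ∷ blk) (cells ms rest))) (Holds-update dn (sym pos-value) (new I))

      record Chosen (s₁ : Store) : Set where
        field
          frame₁   : Frame T s₁
          x₁       : vars s₁ vX ≡ x
          c₁       : vars s₁ vC ≡ c
          arity₁   : vars s₁ vArity ≡ length ms
          index₁   : vars s₁ vIndex ≡ length ts
          flag₁    : vars s₁ vFlag ≡ 1
          pos₁     : vars s₁ vPos ≡ p
          sp₁      : vars s₁ vSp ≡ length ms + length S
          stack₁   : HoldsStack (arrays s₁ aStPos) (arrays s₁ aStFlag) (arrays s₁ aStId) (frames (suc p + length (dn ++ 0 ∷ blk)) ms ++ S)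
          new₁     : Holds (arrays s₁ aNew) (suc p) ((dn ++ 0 ∷ blk) ++ cells ms rest)
          located₁ : Located T (comp x (length ts) c) (vars s₁ vHash)

      s₀ : Store
      s₀ = setVar vSp sp (setVar vArity (vars s vArity ∸ 1) s)

      find-wp : wp findChild s₀ Chosen
      find-wp = tt , tt , tt , tt , record
        { frame₁ = record { size≡ = size≡ fr ; rank≡ = rank≡ fr ; count≡ = count≡ fr ; cur≡ = cur≡ fr ; table = table fr }
        ; x₁ = x≡ I ; c₁ = c-value ; arity₁ = cong (_∸ 1) (arity≡ I) ; index₁ = index≡ I ; flag₁ = refl ; pos₁ = pos≡ I
        ; sp₁ = cong (_∸ 1) (sp≡ I) ; stack₁ = next-frames p dn {0} blk ms stack-value ; new₁ = new-value ; located₁ = located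
        }

      module Absorbing (flag≡false : flag ≡ false) (r≤ : rk e + rk d ≤ suc R) (e< : wt e * N < K) (d< : wt d * N < K) where

        private
          f = combine x e (length ts) c d

        index-value : length ts + rk d ≡ length (ts ++ us)
        index-value = trans (cong (length ts +_) (sym us-length)) (sym (length-++ ts))

        index≤M : length ts + rk d ≤ M
        index≤M = ≤-trans (s≤s⁻¹ (≤-trans (+-monoˡ-≤ (rk d) (≤-trans (s≤s (m≤m+n (length ts) (length ms)))
          (≤-reflexive (trans (sym (+-suc (length ts) (length ms))) (HeadInv.arity hi))))) r≤)) R≤2n

        absorb-post : ∀ {y T₁ s₂} → Intern T f y T₁ →
          InNode T₁ (head y f true (ts ++ us)) ms p (dn ++ 0 ∷ blk) S rest s₂ → Next s₂
        absorb-post int I₂ = record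
          { δ = 1
          ; continue = λ abs → subst (λ φ → Absorb T _ ((φ , tree c d us) ∷ _) _ _ _) (sym flag≡false) (absorb r≤ e< d< int abs)
          ; T₁-ok = Intern-OK ok (HeadInv-valid hi (proj₁ ri)) (∸-monoˡ-≤ 1 r≤) int
          ; T⊑T₁ = Intern-⊑ int
          ; T₁-size = Analysis.Intern-length F fs R N K int
          ; invariant = HeadInv-absorb hi (subst (λ φ → ResultInv T D E (φ , tree c d us)) flag≡false ri) int
          ; decoded = trans (decode-++ dn (0 ∷ blk)) (trans (cong₂ _++_ dn-ok blk-ok) (sym (flat*-++ ts us)))
          ; longer = blk-length 0
          ; state = I₂
          }

        module _ {s₁ : Store} (ch : Chosen s₁) where
          open Chosen ch

          rank-c₁ : arrays s₁ aRank (vars s₁ vC) ≡ rk d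
          rank-c₁ = trans (cong (arrays s₁ aRank) c₁) (Represents.ranks (table frame₁) c-at)

          hit : 0 < vars s₁ vHash → Next (setVar vIndex (vars s₁ vIndex + arrays s₁ aRank (vars s₁ vC)) (setVar vX (vars s₁ vHash ∸ 1) s₁))
          hit pos with a , g , eq , q , ρ≡ ← Located-positive located₁ pos with refl ← OK-combine ok q ρ≡ (HeadInv.at hi) c-at =
            absorb-post (found q) record
            { frame  = record { size≡ = size≡ frame₁ ; rank≡ = rank≡ frame₁ ; count≡ = count≡ frame₁ ; cur≡ = cur≡ frame₁ ; table = table frame₁ }
            ; x≡ = eq ; arity≡ = arity₁ ; index≡ = trans (cong₂ _+_ index₁ rank-c₁) index-value ; flag≡ = flag₁
            ; pos≡ = pos₁ ; sp≡ = sp₁ ; stack = stack₁ ; new = new₁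
            }

          new-composition : Fresh T (comp x (length ts) c) → NewComposition T x e (length ts) c d s₁
          new-composition fresh = record
            { x-at = HeadInv.at hi ; c-at = c-at ; i<M = index< ; room = room ; i+d≤ = index≤M ; r≤ = r≤ ; e< = e< ; d< = d<
            ; size≡n = size≡ frame₁ ; vX≡ = x₁ ; vIndex≡ = index₁ ; vC≡ = c₁ ; tableIn = table frame₁ ; fresh = fresh }

          grow : (fresh : Fresh T (comp x (length ts) c)) → ∀ s₂ → Addition.Added (new-composition fresh) s₂ → Next s₂
          grow fresh s₂ ad = absorb-post (added fresh) record
            { frame  = record { size≡ = trans size₂ (size≡ frame₁) ; rank≡ = trans rank₂ (rank≡ frame₁)
                              ; count≡ = trans count₂ (count≡ frame₁) ; cur≡ = trans cur₂ (cur≡ frame₁) ; table = table₂ }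
            ; x≡ = x₂ ; arity≡ = trans arity₂ arity₁ ; index≡ = trans index₂ index-value ; flag≡ = trans flag₂ flag₁
            ; pos≡ = trans pos₂ pos₁ ; sp≡ = trans sp₂ sp₁
            ; stack = subst₂ (λ A B → HoldsStack A B _ _) (sym stPos₂) (sym stFlag₂) (subst (λ C → HoldsStack _ _ C _) (sym stId₂) stack₁)
            ; new = subst (λ φ → Holds φ (suc p) _) (sym new₂) new₁
            }
            where open Addition.Added ad

          branch-wp : wp lookUp s₁ Next
          branch-wp = (λ pos → tt , small<b 2 (≤-trans (≤-reflexive (cong₂ _+_ index₁ rank-c₁)) (≤-trans index≤M (m≤m+n M 15))) (s≤s (s≤s z≤n)) , hit pos) ,
            (λ none → wp-mono (emitComposition ⍮ recordComposition) {s₁} (Addition.Added (new-composition (Located-zero located₁ none))) Next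
              (grow (Located-zero located₁ none)) (Addition.addition-wp (new-composition (Located-zero located₁ none))))

        absorb-wp : wp absorbChild s₀ Next
        absorb-wp = wp-mono findChild {s₀} Chosen (λ s₁ → wp lookUp s₁ Next) (λ _ → branch-wp) find-wp

      child-wp : wp childStep s Next
      child-wp = tt , tt , (λ pos → absorbing (allowed flag e d (subst (0 <_) value pos))) ,
        (λ none → index+1<b , keep-post (refused flag e d (subst (_≤ 0) value none)))
        where
        value : eval permitted s₀ ≡ (1 ∸ bit flag) * (2 + R ∸ (rk e + rk d)) * (K ∸ wt e * N) * (K ∸ wt d * N)
        value = permitted-value {flag = flag} {e} {d} flag-value rank-x rank-c weight-x weight-c (rank≡ fr) (count≡ fr) (size≡ fr)
        absorbing : flag ≡ false × rk e + rk d ≤ suc R × wt e * N < K × wt d * N < K → wp absorbChild s₀ Next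
        absorbing (a , b , c , d) = Absorbing.absorb-wp a b c d

      child-run : Run childStep s (cost childStep) Next
      child-run = wp-sound childStep s Next _ child-wp

    record Finished (T : Table) (h : Head) (rs : List (Bool × Rose)) (p : ℕ) (dn : List ℕ) (l : ℕ) (S : Stack) (rest : List ℕ)
                    (s : Store) : Set where
      field
        T₁       : Table
        h₁       : Head
        dn₁      : List ℕ
        a        : ℕ
        absorbed : Absorb T h rs T₁ h₁ a
        fits₁    : length T₁ ≤ M
        decoded  : decode dn₁ ≡ flat* (hkids h₁)
        longer   : length dn₁ ≡ length dn + l
        state    : InNode T₁ h₁ [] p dn₁ S rest s

    cells-length : ∀ m ms → length (cells (m ∷ ms) []) ≡ length (cells (m ∷ []) []) + length (cells ms [])
    cells-length (_ , _ , blk) ms = cong suc (trans (length-++ blk) (cong (_+ length (cells ms [])) (cong length (sym (++-identityʳ blk)))))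

    -- The waiting clusters bound the absorptions still possible, and these bound the new entries.
    -- So the hypothesis on `length T` survives each step and keeps the table within `M`.
    children-run : ∀ ms {T D E β h p dn S rest s} → OK fs R T → HeadInv T D E β (length ms) h →
      All (ResultInv T D E) (outcomes ms) → All Decodes ms → decode dn ≡ flat* (hkids h) →
      length T + count* (trees (outcomes ms)) ≤ M → InNode T h ms p dn S rest s →
      Run childLoop s (length ms * childTime + childExit) (Finished T h (outcomes ms) p dn (length (cells ms [])) S rest)
    children-run [] ok hi [] [] dn-ok room I =
      while-no-rule {lit 0} {var vArity} {childStep} _ _ (λ pos → contradiction (≤-trans pos (≤-reflexive (arity≡ I))) λ ()) record
        { absorbed = done ; fits₁ = ≤-trans (m≤m+n _ 0) room ; decoded = dn-ok ; longer = sym (+-identityʳ _) ; state = I }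
    children-run (m@(flag , tree c d us , blk) ∷ ms) {T} {D} {E} {h = h} {p} {dn} {S} {rest} {s} ok hi (ri ∷ ris) (blk-ok ∷ dec) dn-ok room I =
      run-weaken {childLoop} (≤-reflexive (sym (+-assoc childTime (length ms * childTime) childExit)))
        (while-yes-rule {lit 0} {var vArity} {childStep} _ _ (≤-trans (s≤s z≤n) (≤-reflexive (sym (arity≡ I))))
          (run-map {childStep} (λ _ → next)
            (Child.child-run ok hi ri blk-ok dn-ok
              (≤-trans (≤-trans (≤-reflexive (+-comm 1 _)) (+-monoʳ-≤ (length T) (s≤s z≤n))) room) I)))
      where
      next : ∀ {s} → Stepped T D E h m ms p dn S rest s →
             Run childLoop s (length ms * childTime + childExit)
               (Finished T h (outcomes (m ∷ ms)) p dn (length (cells (m ∷ ms) [])) S rest)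
      next st = run-map {childLoop} finish
        (children-run ms T₁-ok invariant (ResultInv-mono T⊑T₁ ris) dec decoded
          (≤-trans (≤-trans (+-monoˡ-≤ _ T₁-size) (≤-trans (≤-reflexive (+-assoc (length T) 1 _))
            (+-monoʳ-≤ (length T) (s≤s (m≤n+m _ (count* us)))))) room) state)
        where
        open Stepped st
        finish : ∀ s′ → Finished T₁ h₁ (outcomes ms) p dn₁ (length (cells ms [])) S rest s′ →
                 Finished T h (outcomes (m ∷ ms)) p dn (length (cells (m ∷ ms) [])) S rest s′
        finish s′ f = record
          { absorbed = continue (Finished.absorbed f)
          ; fits₁    = Finished.fits₁ f
          ; decoded  = Finished.decoded f
          ; longer   = trans (Finished.longer f) (trans (cong (_+ length (cells ms [])) longer)
                         (trans (+-assoc (length dn) _ _) (cong (length dn +_) (sym (cells-length m ms)))))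
          ; state    = Finished.state f
          }

    record Between (T : Table) (p : ℕ) (S : Stack) (rest : List ℕ) (s : Store) : Set where
      field
        frame : Frame T s
        pos≡  : vars s vPos ≡ p
        sp≡   : vars s vSp ≡ length S
        stack : HoldsStack (arrays s aStPos) (arrays s aStFlag) (arrays s aStId) S
        new   : Holds (arrays s aNew) p rest
    open Between

    time  : Rose → ℕ
    time* : List Rose → ℕ
    time (tree x e ts) = time* ts + nodeTime (length ts)
    time* []       = 0
    time* (t ∷ ts) = time* ts + time t

    start-wp : ∀ {T₁ x e ms p S rest s} → At T₁ x e → length ms ≡ rk e → cur p ≡ x →
      Between T₁ (suc p) (frames (suc p) ms ++ S) (cells ms rest) s →
      wp nodeStart s (InNode T₁ (head x e false []) ms p [] S rest)
    start-wp {T₁} {x} {e} {ms} {p} {S} {rest} {s} q l c≡ B = tt , tt , tt , tt , tt , record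
      { frame  = record { size≡ = size≡ fr ; rank≡ = rank≡ fr ; count≡ = count≡ fr ; cur≡ = cur≡ fr ; table = table fr }
      ; x≡     = x-value
      ; arity≡ = trans (cong (arrays s aRank) x-value) (trans (Represents.ranks (table fr) q) (sym l))
      ; index≡ = refl
      ; flag≡  = refl
      ; pos≡   = pos-value
      ; sp≡    = trans (sp≡ B) (frames-length _ ms S)
      ; stack  = subst (λ o → HoldsStack (arrays s aStPos) (arrays s aStFlag) (arrays s aStId) (frames o ms ++ S)) (sym (+-identityʳ (suc p))) (stack B)
      ; new    = new B
      }
      where
      fr = frame B
      pos-value : vars s vPos ∸ 1 ≡ p
      pos-value = cong (_∸ 1) (pos≡ B)
      x-value : arrays s aCur (vars s vPos ∸ 1) ≡ x
      x-value = trans (cong₂ (λ φ i → φ i) (cur≡ fr) pos-value) c≡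

    end-wp : ∀ {T₁ h p dn S rest s} → At T₁ (hid h) (hent h) → length T₁ ≤ M → length S < n →
      InNode T₁ h [] p dn S rest s →
      wp nodeEnd s (Between T₁ p ((p , bit (hflag h) , hid h) ∷ S) (suc (hid h) ∷ dn ++ rest))
    end-wp {T₁} {h} {p} {dn} {S} {rest} {s} q l≤ S< I =
      small<b 2 (≤-trans (≤-reflexive x-value) (≤-trans (≤-trans (At-< q) l≤) (m≤m+n M 15))) (s≤s (s≤s z≤n)) , tt , tt , tt ,
      small<b 1 (≤-trans (≤-reflexive (trans (cong (_+ 1) (InNode.sp≡ I)) (+-comm _ 1))) (≤-trans S< (≤-trans (≤-reflexive (sym (*-identityˡ n))) (m≤m+n _ 15)))) (s≤s z≤n) ,
      record
      { frame = record { size≡ = size≡ fr ; rank≡ = rank≡ fr ; count≡ = count≡ fr ; cur≡ = cur≡ fr ; table = table fr }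
      ; pos≡  = InNode.pos≡ I
      ; sp≡   = trans (cong (_+ 1) (InNode.sp≡ I)) (+-comm _ 1)
      ; stack = move (InNode.pos≡ I) (InNode.flag≡ I) (InNode.x≡ I)
      ; new   = subst₂ (λ i v → Holds (arrays s aNew [ i ↦ v ]) p (suc (hid h) ∷ dn ++ rest)) (sym (InNode.pos≡ I)) (sym x-value)
          (Holds-cons (InNode.new I))
      }
      where
      fr = InNode.frame I
      move : ∀ {u v w} → vars s vPos ≡ u → vars s vFlag ≡ v → vars s vX ≡ w →
        HoldsStack (arrays s aStPos [ vars s vSp ↦ vars s vPos ]) (arrays s aStFlag [ vars s vSp ↦ vars s vFlag ])
          (arrays s aStId [ vars s vSp ↦ vars s vX ]) ((u , v , w) ∷ S)
      move refl refl refl = HoldsStack-push S (InNode.stack I) (sym (InNode.sp≡ I))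
      x-value : vars s vX + 1 ≡ suc (hid h)
      x-value = trans (cong (_+ 1) (InNode.x≡ I)) (+-comm _ 1)

    start-run : ∀ {T₁ x e ms p S rest s} → At T₁ x e → length ms ≡ rk e → cur p ≡ x →
      Between T₁ (suc p) (frames (suc p) ms ++ S) (cells ms rest) s →
      Run nodeStart s (cost nodeStart) (InNode T₁ (head x e false []) ms p [] S rest)
    start-run {T₁} {x} {e} {ms} {p} {S} {rest} {s} q l c≡ B =
      wp-sound nodeStart s (InNode T₁ (head x e false []) ms p [] S rest) _ (start-wp {T₁} {x} {e} {ms} {p} {S} {rest} {s} q l c≡ B)

    end-run : ∀ {T₁ h p dn S rest s} → At T₁ (hid h) (hent h) → length T₁ ≤ M → length S < n →
      InNode T₁ h [] p dn S rest s →
      Run nodeEnd s (cost nodeEnd) (Between T₁ p ((p , bit (hflag h) , hid h) ∷ S) (suc (hid h) ∷ dn ++ rest))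
    end-run {T₁} {h} {p} {dn} {S} {rest} {s} q l≤ S< I =
      wp-sound nodeEnd s (Between T₁ p ((p , bit (hflag h) , hid h) ∷ S) (suc (hid h) ∷ dn ++ rest)) _
        (end-wp {T₁} {h} {p} {dn} {S} {rest} {s} q l≤ S< I)

    node-run : ∀ {T₁ D x e ms p S rest s} → OK fs R T₁ → At T₁ x e → dp e ≤ D → length ms ≡ rk e → cur p ≡ x →
      All (ResultInv T₁ D (D + R)) (outcomes ms) → All Decodes ms → length T₁ + count* (trees (outcomes ms)) ≤ M →
      length S < n → Between T₁ (suc p) (frames (suc p) ms ++ S) (cells ms rest) s →
      Run nodeStep s (cost nodeStart + (length ms * childTime + childExit + cost nodeEnd))
        λ s′ → Σ Table λ T₂ → Σ Head λ h → Σ (List ℕ) λ dn → ∃ λ a →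
          Absorb T₁ (head x e false []) (outcomes ms) T₂ h a × decode dn ≡ flat* (hkids h) × length dn ≡ length (cells ms []) ×
          Between T₂ p ((p , bit (hflag h) , hid h) ∷ S) (suc (hid h) ∷ dn ++ rest) s′
    node-run {T₁} {ms = ms} {p} {S} {rest} ok q dd l c≡ ris dec room S< B =
      run-seq {nodeStart} {childLoop ⍮ nodeEnd} (run-map {nodeStart} (λ s₁ I → run-seq {childLoop} {nodeEnd} (run-map {childLoop} ending
        (children-run ms ok (HeadInv-start ok q l dd) ris dec refl room I)))
        (start-run q l c≡ B))
      where
      ending : ∀ s₂ → Finished T₁ _ (outcomes ms) p [] (length (cells ms [])) S rest s₂ → Run nodeEnd s₂ (cost nodeEnd) _
      ending s₂ f = run-map {nodeEnd} (λ s₃ b → T₂ , h₁ , dn₁ , a , absorbed , decoded , longer , b)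
        (end-run (HeadInv.at (proj₂ (proj₂ (proj₂ (Absorb-inv ok
          (HeadInv-start ok q (trans (length-map _ ms) l) dd) ris absorbed))))) fits₁ S< state)
        where open Finished f renaming (T₁ to T₂)

    -- The loop counts positions and knows nothing of subtrees. Induction on the tree becomes
    -- possible in continuation-passing style: if the loop can go on from position `p` with `t` on
    -- the stack, then it can run from `p + count t`. The bound on `length S` keeps the stack no
    -- higher than the number of scanned positions.
    tree-run : ∀ t {T D p S rest s l Q} → OK fs R T → Wf T D t → length T + count t ≤ M → length S + (p + count t) ≤ N →
      Holds cur p (flat t) → Between T (p + count t) S rest s →
      (∀ {T′ flag u blk a s′} → Contract T t T′ (flag , u) a → Decodes (flag , u , blk) → suc (length blk) ≡ count t →
        Between T′ p ((p , bit flag , root u) ∷ S) (suc (root u) ∷ blk ++ rest) s′ → Run nodeLoop s′ l Q) →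
      Run nodeLoop s (time t + l) Q
    trees-run : ∀ ts {T D p S rest s l Q} → OK fs R T → All (Wf T D) ts → length T + count* ts ≤ M → length S + (p + count* ts) ≤ N →
      Holds cur p (flat* ts) → Between T (p + count* ts) S rest s →
      (∀ {T′ ms a s′} → Contract* T ts T′ (outcomes ms) a → All Decodes ms → length (cells ms []) ≡ count* ts →
        Between T′ p (frames p ms ++ S) (cells ms rest) s′ → Run nodeLoop s′ l Q) →
      Run nodeLoop s (time* ts + l) Q
    tree-run (tree x e ts) {T} {D} {p} {S} {rest} {s} {l} {Q} ok (wf q len dd ws) room height (c≡ , cs≡) B continue =
      run-weaken {nodeLoop} (≤-reflexive (sym (+-assoc (time* ts) (nodeTime (length ts)) l)))
        (trees-run ts {p = suc p} {S} {rest} ok ws (≤-trans (+-monoʳ-≤ (length T) (n≤1+n _)) room)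
          (≤-trans (≤-reflexive (cong (length S +_) (sym (+-suc p _)))) height) cs≡
          (subst (λ i → Between T i S rest s) (+-suc p (count* ts)) B) after)
      where
      S< : length S < n
      S< = ≤-trans (≤-trans (s≤s (m≤m+n (length S) (p + count* ts)))
        (≤-trans (≤-reflexive (trans (sym (+-suc (length S) _)) (cong (length S +_) (sym (+-suc p _))))) height)) N≤n
      after : ∀ {T₁ ms a s₁} → Contract* T ts T₁ (outcomes ms) a → All Decodes ms → length (cells ms []) ≡ count* ts →
        Between T₁ (suc p) (frames (suc p) ms ++ S) (cells ms rest) s₁ → Run nodeLoop s₁ (nodeTime (length ts) + l) Q
      after {T₁} {ms} {a} {s₁} cs dec lcells B₁ with ok₁ , ⊑₁ , ris ← Contract-inv* ok ws cs =
        while-yes-rule {lit 0} {var vPos} {nodeStep} _ _ (≤-trans (s≤s z≤n) (≤-reflexive (sym (pos≡ B₁))))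
          (run-weaken {nodeStep} (≤-reflexive (cong (λ k → cost nodeStart + (k * childTime + childExit + cost nodeEnd)) ms-length))
            (run-map {nodeStep} (λ { s₂ (T₂ , h , dn , a , abs , dn-ok , ldn , B₂) →
                continue {blk = dn} (contract cs abs) dn-ok (cong suc (trans ldn lcells)) B₂ })
              (node-run ok₁ (⊑₁ q) dd (trans ms-length len) c≡ ris dec room₁ S< B₁)))
        where
        ms-length : length ms ≡ length ts
        ms-length = trans (sym (length-map _ ms)) (Contract*-length cs)
        room₁ : length T₁ + count* (trees (outcomes ms)) ≤ M
        room₁ = ≤-trans (+-monoˡ-≤ _ (Analysis.Contract*-growth F fs R N K length (Analysis.Intern-length F fs R N K) cs)) (≤-trans
          (≤-reflexive (trans (+-assoc (length T) a _) (cong (length T +_) (trans (+-comm a _) (Analysis.Contract*-count F fs R N K cs)))))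
          (≤-trans (+-monoʳ-≤ (length T) (n≤1+n _)) room))
    trees-run [] {T} {p = p} {S} {rest} {s} ok [] room height cs≡ B continue =
      continue {ms = []} [] [] refl (subst (λ i → Between T i S rest s) (+-identityʳ p) B)
    trees-run (t ∷ ts) {T} {D} {p} {S} {rest} {s} {l} {Q} ok (w ∷ ws) room height cs≡ B continue =
      run-weaken {nodeLoop} (≤-reflexive (sym (+-assoc (time* ts) (time t) l)))
        (trees-run ts {p = p + count t} {S} {rest} ok ws (≤-trans (+-monoʳ-≤ (length T) (m≤n+m _ (count t))) room)
          (≤-trans (≤-reflexive (cong (length S +_) (+-assoc p (count t) _))) height)
          (subst (λ i → Holds cur (p + i) (flat* ts)) (length-flat t) (proj₂ (Holds-++⁻ (flat t) cs≡)))
          (subst (λ i → Between T i S rest s) (sym (+-assoc p (count t) _)) B) after)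
      where
      after : ∀ {T₁ ms a s₁} → Contract* T ts T₁ (outcomes ms) a → All Decodes ms → length (cells ms []) ≡ count* ts →
        Between T₁ (p + count t) (frames (p + count t) ms ++ S) (cells ms rest) s₁ → Run nodeLoop s₁ (time t + l) Q
      after {T₁} {ms} {a} {s₁} cs dec lcells B₁ with ok₁ , ⊑₁ , ris ← Contract-inv* ok ws cs =
        tree-run t ok₁ (Wf-mono ⊑₁ ≤-refl w) room₁ height₁ (proj₁ (Holds-++⁻ (flat t) cs≡)) B₁ finish
        where
        room₁ : length T₁ + count t ≤ M
        room₁ = ≤-trans (+-monoˡ-≤ (count t) (≤-trans (Analysis.Contract*-growth F fs R N K length (Analysis.Intern-length F fs R N K) cs)
          (+-monoʳ-≤ (length T) (≤-trans (m≤n+m a _) (≤-reflexive (Analysis.Contract*-count F fs R N K cs))))))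
          (≤-trans (≤-reflexive (trans (+-assoc (length T) _ _) (cong (length T +_) (+-comm _ (count t))))) room)
        length-frames≤cells : ∀ ms → length ms ≤ length (cells ms [])
        length-frames≤cells []       = z≤n
        length-frames≤cells ((_ , _ , blk) ∷ ms) =
          s≤s (≤-trans (length-frames≤cells ms) (≤-trans (m≤n+m _ (length blk)) (≤-reflexive (sym (length-++ blk)))))
        height₁ : length (frames (p + count t) ms ++ S) + (p + count t) ≤ N
        height₁ = ≤-trans (+-monoˡ-≤ _ (≤-trans (≤-reflexive (frames-length _ ms S))
          (+-monoˡ-≤ (length S) (≤-trans (length-frames≤cells ms) (≤-reflexive lcells)))))
          (≤-trans (≤-reflexive (rearrange (count* ts) (length S) p (count t))) height)
          where
          rearrange : ∀ a b c d → a + b + (c + d) ≡ b + (c + (d + a))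
          rearrange = solve-∀
        finish : ∀ {T′ flag u blk a′ s′} → Contract T₁ t T′ (flag , u) a′ → Decodes (flag , u , blk) → suc (length blk) ≡ count t →
          Between T′ p ((p , bit flag , root u) ∷ frames (p + count t) ms ++ S) (suc (root u) ∷ blk ++ cells ms rest) s′ → Run nodeLoop s′ l Q
        finish {T′} {flag} {u} {blk} {s′ = s′} c d lblk B₂ = continue {ms = (flag , u , blk) ∷ ms} (c ∷ cs) (d ∷ dec)
          (trans (cells-length (flag , u , blk) ms) (cong₂ _+_ (trans (cong (λ z → suc (length z)) (++-identityʳ blk)) lblk) lcells))
          (subst (λ i → Between T′ p ((p , bit flag , root u) ∷ frames (p + i) ms ++ S) (suc (root u) ∷ blk ++ cells ms rest) s′) (sym lblk) B₂)

  -- Compaction of the sequence and a full round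

  module RoundLoop where
    open Evolution F fs R n 1≤R 0<n hiding (K)

    record Constants (T : Table) (N : ℕ) (s : Store) : Set where
      field
        size≡  : vars s vSize ≡ n
        rank≡  : vars s vRank ≡ R
        count≡ : vars s vCount ≡ N
        table  : TableIn T s
    open Constants

    record Compacting (T : Table) (N p : ℕ) (done todo : List ℕ) (s : Store) : Set where
      field
        consts  : Constants T N s
        pos≡    : vars s vPos ≡ p
        new≡    : vars s vNew ≡ length done
        todo≡   : Holds (arrays s aNew) p todo
        done≡   : Holds (arrays s aCur) 0 done
        total≡  : p + length todo ≡ N
        -- The write position never overtakes the scan and so stays below `b`.
        enough  : length done ≤ p
    open Compacting

    ≤n⇒<b : ∀ {v} → v ≤ n → v < b
    ≤n⇒<b v≤ = small<b 1 (≤-trans v≤ (≤-trans (≤-reflexive (sym (*-identityˡ n))) (m≤m+n _ 15))) (s≤s z≤n)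

    compact-wp : ∀ {T N p done z todo s} → N ≤ n → Compacting T N p done (z ∷ todo) s →
      wp compactStep s (Compacting T N (suc p) (done ++ decode (z ∷ [])) todo)
    compact-wp {T} {N} {p} {done} {z} {todo} {s} N≤n C =
      tt , (λ pos → tt , new+1<b , pos+1<b , kept z z-value pos) , (λ le → pos+1<b , dropped z z-value le)
      where
      Next : Store → Set
      Next = Compacting T N (suc p) (done ++ decode (z ∷ [])) todo
      z-value : arrays s aNew (vars s vPos) ≡ z
      z-value = trans (cong (arrays s aNew) (pos≡ C)) (proj₁ (todo≡ C))
      p<N : suc p ≤ N
      p<N = ≤-trans (s≤s (m≤m+n p (length todo))) (≤-reflexive (trans (sym (+-suc p _)) (total≡ C)))
      new+1<b : vars s vNew + 1 < b
      new+1<b = ≤n⇒<b (≤-trans (≤-reflexive (trans (cong (_+ 1) (new≡ C)) (+-comm _ 1))) (≤-trans (s≤s (enough C)) (≤-trans p<N N≤n)))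
      pos+1<b : vars s vPos + 1 < b
      pos+1<b = ≤n⇒<b (≤-trans (≤-reflexive (trans (cong (_+ 1) (pos≡ C)) (+-comm _ 1))) (≤-trans p<N N≤n))
      h = arrays s aNew (vars s vPos)
      s₁ s₂ : Store
      s₁ = setVar vHash h s
      s₂ = setVar vNew (vars s vNew + 1) (setCell aCur (vars s vNew) (h ∸ 1) s₁)
      kept : ∀ z → h ≡ z → 0 < h → Compacting T N (suc p) (done ++ decode (z ∷ [])) todo (setVar vPos (vars s vPos + 1) s₂)
      kept zero    eq pos = contradiction (≤-trans pos (≤-reflexive eq)) λ ()
      kept (suc x) eq pos = record
        { consts = record { size≡ = size≡ (consts C) ; rank≡ = rank≡ (consts C) ; count≡ = count≡ (consts C) ; table = table (consts C) }
        ; pos≡   = trans (cong (_+ 1) (pos≡ C)) (+-comm p 1)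
        ; new≡   = trans (cong (_+ 1) (new≡ C)) (sym (length-++ done))
        ; todo≡  = proj₂ (todo≡ C)
        ; done≡  = subst (λ v → Holds (arrays s aCur [ vars s vNew ↦ v ]) 0 (done ++ x ∷ [])) (sym (cong (_∸ 1) eq))
                     (Holds-snoc done (sym (new≡ C)) (done≡ C))
        ; total≡ = trans (sym (+-suc p _)) (total≡ C)
        ; enough = ≤-trans (≤-reflexive (trans (length-++ done) (+-comm _ 1))) (s≤s (enough C))
        }
      dropped : ∀ z → h ≡ z → h ≤ 0 → Compacting T N (suc p) (done ++ decode (z ∷ [])) todo (setVar vPos (vars s vPos + 1) s₁)
      dropped (suc x) eq le = contradiction (≤-trans (≤-reflexive (sym eq)) le) λ ()
      dropped zero    eq le = record
        { consts = record { size≡ = size≡ (consts C) ; rank≡ = rank≡ (consts C) ; count≡ = count≡ (consts C) ; table = table (consts C) }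
        ; pos≡   = trans (cong (_+ 1) (pos≡ C)) (+-comm p 1)
        ; new≡   = trans (new≡ C) (cong length (sym (++-identityʳ done)))
        ; todo≡  = proj₂ (todo≡ C)
        ; done≡  = subst (Holds (arrays s aCur) 0) (sym (++-identityʳ done)) (done≡ C)
        ; total≡ = trans (sym (+-suc p _)) (total≡ C)
        ; enough = ≤-trans (≤-reflexive (cong length (++-identityʳ done))) (m≤n⇒m≤1+n (enough C))
        }

    compact-run : ∀ todo {T N p done s} → N ≤ n → Compacting T N p done todo s →
      Run compactLoop s (length todo * compactTime + compactExit) (Compacting T N N (done ++ decode todo) [])
    compact-run [] {T} {N} {p} {done} {s} N≤n C =
      while-no-rule {var vPos} {var vCount} {compactStep} _ _
        (λ lt → <-irrefl (trans (trans (pos≡ C) (trans (sym (+-identityʳ p)) (total≡ C))) (sym (count≡ (consts C)))) lt)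
        (subst₂ (λ q ds → Compacting T N q ds [] s) (trans (sym (+-identityʳ p)) (total≡ C)) (sym (++-identityʳ done)) C)
    compact-run (z ∷ todo) {T} {N} {p} {done} {s} N≤n C =
      run-weaken (≤-reflexive (sym (+-assoc compactTime (length todo * compactTime) compactExit)))
        (while-yes-rule {var vPos} {var vCount} {compactStep} _ _ in-range
          (run-map (λ s′ C′ → run-map (λ s″ → subst (λ ds → Compacting T N N ds [] s″) reassociate) (compact-run todo N≤n C′))
            (wp-sound compactStep s (Compacting T N (suc p) (done ++ decode (z ∷ [])) todo) _ (compact-wp {T} {N} {p} {done} {z} {todo} {s} N≤n C))))
      where
      in-range : vars s vPos < vars s vCount
      in-range = subst₂ _<_ (sym (pos≡ C)) (sym (count≡ (consts C)))
        (≤-trans (s≤s (m≤m+n p (length todo))) (≤-reflexive (trans (sym (+-suc p _)) (total≡ C))))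
      reassociate : (done ++ decode (z ∷ [])) ++ decode todo ≡ done ++ decode (z ∷ todo)
      reassociate = trans (++-assoc done (decode (z ∷ [])) (decode todo)) (cong (done ++_) (sym (decode-++ (z ∷ []) todo)))

    record Ready (T : Table) (t : Rose) (s : Store) : Set where
      field
        consts : Constants T (count t) s
        cur≡   : Holds (arrays s aCur) 0 (flat t)

    module OneRound (T : Table) (t : Rose) (D : ℕ) (s₀ : Store) (ok : OK fs R T) (shape : Wf T D t) (room : length T + count t ≤ 2 * n)
      (t≤n : count t ≤ n) (ready : Ready T t s₀) where

      private
        N = count t

      1≤count : ∀ t → 1 ≤ count t
      1≤count (tree _ _ _) = s≤s z≤n

      open Contraction fs R N K

      private
        Between = Round.Between N (1≤count t) t≤n (arrays s₀ aCur)
        time = Round.time N (1≤count t) t≤n (arrays s₀ aCur)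

      Contracted : Store → Set
      Contracted s = Σ Table λ T′ → Σ (Bool × Rose) λ r → ∃ λ a → Σ (List ℕ) λ blk →
        Contract T t T′ r a × decode (suc (root (proj₂ r)) ∷ blk) ≡ flat (proj₂ r) × suc (length blk) ≡ N ×
        Between T′ 0 ((0 , bit (proj₁ r) , root (proj₂ r)) ∷ []) (suc (root (proj₂ r)) ∷ blk) s

      contract-run : ∀ {s} → Between T N [] [] s → Run nodeLoop s (time t + nodeExit) Contracted
      contract-run {s} B = Round.tree-run N (1≤count t) t≤n (arrays s₀ aCur) t {p = 0} {S = []} {rest = []} ok shape room ≤-refl (Ready.cur≡ ready) B
        λ {T′} {flag} {u} {blk} {a} c dec len B′ → while-no-rule {lit 0} {var vPos} {nodeStep} _ _
          (λ pos → contradiction (≤-trans pos (≤-reflexive (Round.Between.pos≡ B′))) λ ())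
          (T′ , (flag , u) , a , blk , c , decoded u dec , len , subst (λ xs → Between T′ 0 _ (suc (root u) ∷ xs) _) (++-identityʳ blk) B′)
        where
        decoded : ∀ {flag blk} u → Round.Decodes N (1≤count t) t≤n (arrays s₀ aCur) (flag , u , blk) → decode (suc (root u) ∷ blk) ≡ flat u
        decoded (tree x e us) eq = cong (x ∷_) eq

      begin-wp : wp (set vPos (var vCount) ⍮ set vSp (lit 0)) s₀ (Between T N [] [])
      begin-wp = tt , tt , record
        { frame = record { size≡ = size≡ (Ready.consts ready) ; rank≡ = rank≡ (Ready.consts ready)
                         ; count≡ = count≡ (Ready.consts ready) ; cur≡ = refl ; table = table (Ready.consts ready) }
        ; pos≡ = count≡ (Ready.consts ready) ; sp≡ = refl ; stack = tt ; new = tt }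

      middle-wp : ∀ {T′ S zs s} → length zs ≡ N → Between T′ 0 S zs s →
        wp (set vPos (lit 0) ⍮ set vNew (lit 0)) s (Compacting T′ N 0 [] zs)
      middle-wp len B = tt , tt , record
        { consts = record { size≡ = Round.Frame.size≡ (Round.Between.frame B) ; rank≡ = Round.Frame.rank≡ (Round.Between.frame B)
                          ; count≡ = Round.Frame.count≡ (Round.Between.frame B) ; table = Round.Frame.table (Round.Between.frame B) }
        ; pos≡ = refl ; new≡ = refl ; todo≡ = Round.Between.new B ; done≡ = tt ; total≡ = len ; enough = z≤n }

      Outcome : Store → Set
      Outcome s = Σ Table λ T′ → Σ (Bool × Rose) λ r → ∃ λ a → Contract T t T′ r a × Ready T′ (proj₂ r) s

      count-wp : ∀ {T′ r a zs s} → Contract T t T′ r a → decode zs ≡ flat (proj₂ r) → Compacting T′ N N (decode zs) [] s →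
        wp (set vCount (var vNew)) s Outcome
      count-wp {T′} {r} {a} {zs} {s} c dec C = tt , T′ , r , a , c , record
        { consts = record { size≡ = size≡ (consts C) ; rank≡ = rank≡ (consts C)
                          ; count≡ = trans (new≡ C) (trans (cong length dec) (length-flat (proj₂ r))) ; table = table (consts C) }
        ; cur≡ = subst (Holds (arrays s aCur) 0) dec (done≡ C) }

      roundTime : ℕ
      roundTime = beginTime + (time t + nodeExit + (middleTime + (N * compactTime + compactExit + endTime)))

      round-run : Run roundStep s₀ roundTime Outcome
      round-run = run-seq (run-map (λ s₁ B → run-seq (run-map (λ s₂ → after-nodes s₂) (contract-run B)))
        (wp-sound (set vPos (var vCount) ⍮ set vSp (lit 0)) s₀ (Between T N [] []) _ begin-wp))
        where
        after-nodes : ∀ s₂ → Contracted s₂ → Run ((set vPos (lit 0) ⍮ set vNew (lit 0)) ⍮ compactLoop ⍮ set vCount (var vNew)) s₂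
          (middleTime + (N * compactTime + compactExit + endTime)) Outcome
        after-nodes s₂ (T′ , r , a , blk , c , dec , len , B) =
          run-seq (run-map (λ s₃ C → run-seq (run-map (λ s₄ C′ → wp-sound (set vCount (var vNew)) s₄ Outcome _ (count-wp {T′} {r} {a} {zs} {s₄} c dec C′))
              (run-weaken (≤-reflexive (cong (λ k → k * compactTime + compactExit) len)) (compact-run zs {done = []} t≤n C))))
            (wp-sound (set vPos (lit 0) ⍮ set vNew (lit 0)) s₂ (Compacting T′ N 0 [] zs) _ (middle-wp {T′} {_} {zs} {s₂} len B)))
          where
          zs : List ℕ
          zs = suc (root (proj₂ r)) ∷ blk

  -- Reading the labels of the tree

  module Initialise where
    open Spelling F

    pairs : List (Symbol F) → List ℕ
    pairs = concatMap (λ f → code f ∷ rank F f ∷ [])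

    record Init (T : Table) (p : ℕ) (gs : List (Symbol F)) (xs : List ℕ) (s : Store) : Set where
      field
        size≡  : vars s vSize ≡ n
        pos≡   : vars s vPos ≡ p
        ranks≡ : maxRank (vars s vRank) gs ≡ R
        table  : TableIn T s
        input≡ : Holds (arrays s aIn) (1 + 2 * p) (pairs gs)
        cur≡   : Holds (arrays s aCur) 0 xs

    -- Between reading the label f and storing the number of its entry.
    record Loaded (T : Table) (p : ℕ) (f : Symbol F) (gs : List (Symbol F)) (xs : List ℕ) (s : Store) : Set where
      field
        size≡  : vars s vSize ≡ n
        pos≡   : vars s vPos ≡ p
        ranks≡ : maxRank (vars s vRank ⊔ rank F f) gs ≡ R
        code≡  : vars s vCode ≡ code f
        arity≡ : vars s vArity ≡ rank F f
        table  : TableIn T s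
        input≡ : Holds (arrays s aIn) (1 + 2 * suc p) (pairs gs)
        cur≡   : Holds (arrays s aCur) 0 xs

    record Stored (T : Table) (x : ℕ) (p : ℕ) (gs : List (Symbol F)) (xs : List ℕ) (s : Store) : Set where
      field
        size≡  : vars s vSize ≡ n
        pos≡   : vars s vPos ≡ p
        x≡     : vars s vX ≡ x
        ranks≡ : maxRank (vars s vRank) gs ≡ R
        table  : TableIn T s
        input≡ : Holds (arrays s aIn) (1 + 2 * suc p) (pairs gs)
        cur≡   : Holds (arrays s aCur) 0 xs

    -- All entries are still single terminals, hence of weight 1 and never heavy. Equal labels share
    -- an entry, so there are at most as many entries as nodes read.
    record Assigning (gs : List (Symbol F)) (T : Table) (xs : List ℕ) : Set where
      field
        ok       : OK fs R T
        assigned : Assigned T gs xs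
        sparse   : ∀ m → 0 < m → heavy m T ≡ 0
        small    : length T ≤ length xs

    bounded-by-n : ∀ {v} → v ≤ n → v < b
    bounded-by-n v≤ = small<b 1 (≤-trans v≤ (≤-trans (≤-reflexive (sym (*-identityˡ n))) (m≤m+n _ 15))) (s≤s z≤n)

    record Looked (T : Table) (p : ℕ) (f : Symbol F) (gs : List (Symbol F)) (xs : List ℕ) (s : Store) : Set where
      field
        loaded  : Loaded T p f gs xs s
        located : Located T (term f) (vars s vHash)
        rank≡   : maxRank (vars s vRank) gs ≡ R

    read-wp : ∀ {T p f gs xs s} → Init T p (f ∷ gs) xs s → wp readStep s (Loaded T p f gs xs)
    read-wp {T} {p} {f} {gs} {xs} {s} I with c≡ , r≡ , rest ← Init.input≡ I = tt , tt , record
      { size≡ = Init.size≡ I ; pos≡ = Init.pos≡ I ; ranks≡ = Init.ranks≡ I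
      ; code≡ = trans (cong (λ q → arrays s aIn (1 + 2 * q)) (Init.pos≡ I)) c≡
      ; arity≡ = trans (cong (λ q → arrays s aIn (2 + 2 * q)) (Init.pos≡ I)) r≡
      ; table = Init.table I ; input≡ = subst (λ o → Holds (arrays s aIn) o (pairs gs)) (double p) rest ; cur≡ = Init.cur≡ I }
      where
      double : ∀ p → 2 + (1 + 2 * p) ≡ 1 + 2 * suc p
      double = solve-∀

    Ranked : Table → ℕ → Symbol F → List (Symbol F) → List ℕ → Store → Set
    Ranked T p f gs xs s = Loaded T p f gs xs s × maxRank (vars s vRank) gs ≡ R

    rank-wp : ∀ {T p f gs xs s} → Loaded T p f gs xs s → wp rankStep s (Ranked T p f gs xs)
    rank-wp {T} {p} {f} {gs} {xs} {s} L =
      (λ lt → tt , record { size≡ = size≡ ; pos≡ = pos≡ ; code≡ = code≡ ; arity≡ = arity≡ ; table = table ; input≡ = input≡ ; cur≡ = cur≡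
                          ; ranks≡ = trans (cong (λ ρ → maxRank ρ gs) (raised lt)) ranks≡ } ,
                   trans (cong (λ ρ → maxRank ρ gs) (trans arity≡ (sym (m≤n⇒m⊔n≡n (<⇒≤ (≤-trans lt (≤-reflexive arity≡))))))) ranks≡) ,
      (λ le → L , trans (cong (λ ρ → maxRank ρ gs) (sym (m≥n⇒m⊔n≡m (≤-trans (≤-reflexive (sym arity≡)) le)))) ranks≡)
      where
      open Loaded L
      raised : vars s vRank < vars s vArity → vars s vArity ⊔ rank F f ≡ vars s vRank ⊔ rank F f
      raised lt = trans (cong (_⊔ rank F f) arity≡) (trans (⊔-idem (rank F f)) (sym (m≤n⇒m⊔n≡n (<⇒≤ (≤-trans lt (≤-reflexive arity≡))))))

    find-wp : ∀ {T p f gs xs s} → f ∈ fs → Ranked T p f gs xs s → wp findTerm s (Looked T p f gs xs)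
    find-wp {T} {f = f} {s = s} f∈ (L , ρ≡) = tt , record
      { loaded = record { size≡ = size≡ ; pos≡ = pos≡ ; ranks≡ = ranks≡ ; code≡ = code≡ ; arity≡ = arity≡ ; table = table ; input≡ = input≡ ; cur≡ = cur≡ }
      ; located = subst (λ k → Located T (term f) (arrays s aTerm k)) (sym code≡) (Represents.terms table f∈)
      ; rank≡ = ρ≡ }
      where open Loaded L

    NowStored : Table → List (Symbol F) → ℕ → Symbol F → List (Symbol F) → List ℕ → Store → Set
    NowStored T done p f gs xs s = Σ Table λ T′ → ∃ λ x →
      Stored T′ x p gs xs s × OK fs R T′ × T ⊑ T′ × At T′ x (leafEntry f) × (∀ m → 0 < m → heavy m T′ ≡ 0) × length T′ ≤ suc (length xs)

    term-wp : ∀ {done T p f gs xs s} → f ∈ fs → rank F f ≤ R → length xs < n → Assigning done T xs →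
      Looked T p f gs xs s → wp termStep s (NowStored T done p f gs xs)
    term-wp {done} {T} {p} {f} {gs} {xs} {s} f∈ r≤ xs< A L = (λ pos → tt , hit pos located) , (λ none → new none located)
      where
      open Looked L
      open Loaded loaded hiding (ranks≡)
      open Assigning A
      hit : 0 < vars s vHash → Located T (term f) (vars s vHash) → NowStored T done p f gs xs (setVar vX (vars s vHash ∸ 1) s)
      hit pos loc with a , e , eq , q , ρ≡ ← Located-positive loc pos with refl ← OK-leaf ok q ρ≡ = T , a ,
        record { size≡ = size≡ ; pos≡ = pos≡ ; x≡ = eq ; ranks≡ = rank≡ ; table = table ; input≡ = input≡ ; cur≡ = cur≡ } ,
        ok , (λ q → q) , q , sparse , m≤n⇒m≤1+n small
      room : length T < n
      room = ≤-trans (s≤s small) xs<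
      q+<base : ∀ m → m ≤ 5 → vars s vOut + m < base
      q+<base m m≤5 = ≤-trans (s≤s (≤-trans (+-mono-≤ (≤-trans (≤-reflexive (Represents.q≡ table))
          (+-monoʳ-≤ 2 (≤-trans (encodeTable-length T) (*-monoʳ-≤ 5 (<⇒≤ room))))) m≤5)
          (≤-reflexive (rearrange n))))
        (≤-trans (≤-reflexive (sym (+-suc (5 * n) 7))) (+-mono-≤ (*-monoˡ-≤ n {5} {16} (≤ᵇ⇒≤ 5 16 tt)) (≤ᵇ⇒≤ 8 16 tt)))
        where
        rearrange : ∀ n → 2 + 5 * n + 5 ≡ 5 * n + 7
        rearrange = solve-∀
      nid+1<b : vars s vNid + 1 < b
      nid+1<b = bounded-by-n (≤-trans (≤-reflexive (trans (cong (_+ 1) (Represents.nid≡ table)) (+-comm _ 1))) room)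
      new : vars s vHash ≤ 0 → Located T (term f) (vars s vHash) → wp newTerm s (NowStored T done p f gs xs)
      new none loc = subst (_< base) (+-identityʳ _) (q+<base 0 z≤n) , tt , q+<base 1 (s≤s z≤n) , tt , q+<base 2 (s≤s (s≤s z≤n)) , tt ,
        nid+1<b , tt , tt , tt , nid+1<b , <-≤-trans (q+<base 3 (s≤s (s≤s (s≤s z≤n)))) base≤b ,
        T ++ leafEntry f ∷ [] , length T ,
        record { size≡ = size≡ ; pos≡ = pos≡ ; x≡ = Represents.nid≡ table ; ranks≡ = rank≡
               ; table = represents-term f∈ arity≡ code≡ (Located-zero loc none) table ; input≡ = input≡ ; cur≡ = cur≡ } ,
        snoc ok (term f∈) (Located-zero loc none) r≤ , At-++ , At-last T ,
        (λ m 0<m → trans (heavy-snoc m T (leafEntry f)) (cong₂ _+_ (sparse m 0<m) (light m 0<m))) ,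
        ≤-trans (≤-reflexive (trans (length-++ T) (+-comm _ 1))) (s≤s small)
        where
        light : ∀ m → 0 < m → bit (m <ᵇ 1) ≡ 0
        light (suc m) _ = refl

    assign-wp : ∀ {T done p f gs xs s} → p ≡ length xs → length xs < n → NowStored T done p f gs xs s → Assigning done T xs →
      wp assignStep s (λ s′ → Σ Table λ T′ → ∃ λ x → Init T′ (suc p) gs (xs ++ x ∷ []) s′ × Assigning (done ++ f ∷ []) T′ (xs ++ x ∷ []))
    assign-wp {T} {done} {p} {f} {gs} {xs} {s} p≡ xs< (T′ , x , S , ok , ⊑₀ , q , sparse , small) A =
      tt , bounded-by-n (≤-trans (≤-reflexive (trans (cong (_+ 1) (trans (Stored.pos≡ S) p≡)) (+-comm _ 1))) xs<) , T′ , x ,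
      record { size≡ = Stored.size≡ S ; pos≡ = trans (cong (_+ 1) (Stored.pos≡ S)) (+-comm p 1) ; ranks≡ = Stored.ranks≡ S
             ; table = Stored.table S ; input≡ = Stored.input≡ S
             ; cur≡ = subst (λ v → Holds (arrays s aCur [ vars s vPos ↦ v ]) 0 (xs ++ x ∷ [])) (sym (Stored.x≡ S))
                 (Holds-snoc xs (sym (trans (Stored.pos≡ S) p≡)) (Stored.cur≡ S)) } ,
      record { ok = ok ; assigned = Assigned-snoc (Assigned-mono ⊑₀ (Assigning.assigned A)) q ; sparse = sparse
             ; small = ≤-trans small (≤-reflexive (trans (+-comm 1 _) (sym (length-++ xs)))) }

    InitStepped : List (Symbol F) → ℕ → Symbol F → List (Symbol F) → List ℕ → Store → Set
    InitStepped done p f gs xs s = Σ Table λ T′ → ∃ λ x → Init T′ (suc p) gs (xs ++ x ∷ []) s × Assigning (done ++ f ∷ []) T′ (xs ++ x ∷ [])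

    init-step-run : ∀ {T done p f gs xs s} → f ∈ fs → rank F f ≤ R → p ≡ length xs → length xs < n → Assigning done T xs →
      Init T p (f ∷ gs) xs s → Run initStep s (cost initStep) (InitStepped done p f gs xs)
    init-step-run {T} {done} {p} {f} {gs} {xs} {s} f∈ r≤ p≡ xs< A I =
      run-seq (run-map (λ s₁ L → run-seq (run-map (λ s₂ K → run-seq (run-map (λ s₃ H → run-seq (run-map (λ s₄ S →
        wp-sound assignStep s₄ (InitStepped done p f gs xs) _ (assign-wp {T} {done} {p} {f} {gs} {xs} {s₄} p≡ xs< S A))
        (wp-sound termStep s₃ (NowStored T done p f gs xs) _ (term-wp {done} {T} {p} {f} {gs} {xs} {s₃} f∈ r≤ xs< A H))))
        (wp-sound findTerm s₂ (Looked T p f gs xs) _ (find-wp {T} {p} {f} {gs} {xs} {s₂} f∈ K))))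
        (wp-sound rankStep s₁ (Ranked T p f gs xs) _ (rank-wp {T} {p} {f} {gs} {xs} {s₁} L))))
        (wp-sound readStep s (Loaded T p f gs xs) _ (read-wp {T} {p} {f} {gs} {xs} {s} I)))

    init-run : ∀ gs {T done p xs s} → (∀ {f} → f ∈ gs → f ∈ fs × rank F f ≤ R) → p ≡ length xs → p + length gs ≡ n →
      Assigning done T xs → Init T p gs xs s →
      Run initLoop s (length gs * initTime + initExit)
        (λ s′ → Σ Table λ T′ → Σ (List ℕ) λ ys → Init T′ n [] ys s′ × Assigning (done ++ gs) T′ ys)
    init-run [] {T} {done} {p} {xs} {s} _ p≡ total A I =
      while-no-rule {var vPos} {var vSize} {initStep} _ _
        (λ lt → <-irrefl (trans (Init.pos≡ I) (trans (trans (sym (+-identityʳ p)) total) (sym (Init.size≡ I)))) lt)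
        (T , xs , subst (λ q → Init T q [] xs s) (trans (sym (+-identityʳ p)) total) I ,
         subst (λ ds → Assigning ds T xs) (sym (++-identityʳ done)) A)
    init-run (f ∷ gs) {T} {done} {p} {xs} {s} known p≡ total A I =
      run-weaken (≤-reflexive (sym (+-assoc initTime (length gs * initTime) initExit)))
        (while-yes-rule {var vPos} {var vSize} {initStep} _ _ in-range
          (run-map after (init-step-run (proj₁ (known (here refl))) (proj₂ (known (here refl))) p≡ xs< A I)))
      where
      p< : p < n
      p< = ≤-trans (s≤s (m≤m+n p (length gs))) (≤-reflexive (trans (sym (+-suc p _)) total))
      xs< : length xs < n
      xs< = subst (_< n) p≡ p<
      in-range : vars s vPos < vars s vSize
      in-range = subst₂ _<_ (sym (Init.pos≡ I)) (sym (Init.size≡ I)) p<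
      after : ∀ s′ → InitStepped done p f gs xs s′ → Run initLoop s′ (length gs * initTime + initExit)
        (λ s″ → Σ Table λ T′ → Σ (List ℕ) λ ys → Init T′ n [] ys s″ × Assigning (done ++ f ∷ gs) T′ ys)
      after s′ (T′ , x , I′ , A′) = run-map (λ { s″ (T″ , ys , I″ , A″) → T″ , ys , I″ , subst (λ ds → Assigning ds T″ ys) (++-assoc done (f ∷ []) gs) A″ })
        (init-run gs (λ g∈ → known (there g∈)) (trans (cong suc p≡) (trans (+-comm 1 _) (sym (length-++ xs))))
          (trans (sym (+-suc p _)) total) A′ I′)

  -- The whole program and its running time

  module Execution (u : Tree F) (labels≡ : labels u ≡ fs) (size≡n : size u ≡ n) (max≡R : Spelling.maxRank F 2 fs ≡ R) where
    open RoundLoop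
    open Initialise
    open Spelling F
    open Evolution F fs R n 1≤R 0<n hiding (K)

    input : List ℕ
    input = n ∷ pairs fs

    fs-length : length fs ≡ n
    fs-length = trans (cong length (sym labels≡)) size≡n

    input-length : length input ≡ 1 + 2 * n
    input-length = cong suc (trans (pairs-length fs) (cong (2 *_) fs-length))
      where
      pairs-length : ∀ gs → length (pairs gs) ≡ 2 * length gs
      pairs-length []       = refl
      pairs-length (f ∷ gs) = trans (cong (2 +_) (pairs-length gs)) (sym (*-suc 2 (length gs)))

    -- The memory beyond the input is zero, and 0 means absent. So the hash tables are empty from
    -- the beginning, although clearing one of cubic size would take too long.
    record Copying (done todo : List ℕ) (s : Store) : Set where
      field
        size≡  : vars s vSize ≡ n
        pos≡   : vars s vPos ≡ length done
        todo≡  : Holds (io s) (length done) todo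
        done≡  : Holds (arrays s aIn) 0 done
        nid≡   : vars s vNid ≡ 0
        terms≡ : ∀ i → arrays s aTerm i ≡ 0
        comps≡ : ∀ i → arrays s aComp i ≡ 0

    copy-wp : ∀ {done x todo s} → length done < 1 + 2 * n → Copying done (x ∷ todo) s → wp copyStep s (Copying (done ++ x ∷ []) todo)
    copy-wp {done} {x} {todo} {s} done< C =
      ≤-trans (s≤s (≤-reflexive (Copying.pos≡ C))) (≤-trans done< (≤-trans (≤-reflexive (+-comm 1 (2 * n))) (+-mono-≤ (*-monoˡ-≤ n (s≤s (s≤s (z≤n {14})))) (s≤s z≤n)))) ,
      tt ,
      small<b 2 (≤-trans (≤-reflexive (trans (cong (_+ 1) (Copying.pos≡ C)) (+-comm _ 1))) (≤-trans done< (≤-trans (≤-reflexive (+-comm 1 (2 * n))) (+-monoʳ-≤ (2 * n) (s≤s z≤n))))) (s≤s (s≤s z≤n)) ,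
      record
      { size≡  = Copying.size≡ C
      ; pos≡   = trans (cong (_+ 1) (Copying.pos≡ C)) (sym (length-++ done))
      ; todo≡  = subst (λ o → Holds (io s) o todo) (trans (+-comm 1 _) (sym (length-++ done))) (proj₂ (Copying.todo≡ C))
      ; done≡  = subst (λ v → Holds (arrays s aIn [ vars s vPos ↦ v ]) 0 (done ++ x ∷ []))
                   (sym (trans (cong (io s) (Copying.pos≡ C)) (proj₁ (Copying.todo≡ C))))
                   (Holds-snoc done (sym (Copying.pos≡ C)) (Copying.done≡ C))
      ; nid≡   = Copying.nid≡ C
      ; terms≡ = Copying.terms≡ C
      ; comps≡ = Copying.comps≡ C
      }

    copy-run : ∀ todo {done s} → done ++ todo ≡ input → Copying done todo s →
      Run copyLoop s (length todo * copyTime + copyExit) (Copying input [])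
    copy-run [] {done} {s} eq C = while-no-rule {var vPos} {lit 1 ⊞ lit 2 ⊠ var vSize} {copyStep} _ _
      (λ lt → <-irrefl (trans (Copying.pos≡ C) (trans (cong length eq′) (trans input-length (cong (λ k → 1 + 2 * k) (sym (Copying.size≡ C)))))) lt)
      (subst (λ ds → Copying ds [] s) eq′ C)
      where
      eq′ : done ≡ input
      eq′ = trans (sym (++-identityʳ done)) eq
    copy-run (x ∷ todo) {done} {s} eq C = run-weaken (≤-reflexive (sym (+-assoc copyTime (length todo * copyTime) copyExit)))
      (while-yes-rule {var vPos} {lit 1 ⊞ lit 2 ⊠ var vSize} {copyStep} _ _
        (subst₂ _<_ (sym (Copying.pos≡ C)) (cong (λ k → 1 + 2 * k) (sym (Copying.size≡ C))) done<)
        (run-map (λ s′ C′ → copy-run todo (trans (++-assoc done (x ∷ []) todo) eq) C′)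
          (wp-sound copyStep s (Copying (done ++ x ∷ []) todo) _ (copy-wp {done} {x} {todo} {s} done< C))))
      where
      done< : length done < 1 + 2 * n
      done< = ≤-trans (≤-trans (s≤s (m≤m+n _ (length todo))) (≤-reflexive (trans (sym (+-suc _ _)) (sym (length-++ done)))))
        (≤-reflexive (trans (cong length eq) input-length))

    module _ {T₀ : Table} {t₀ : Rose} where

      Reduced : Store → Set
      Reduced s = Σ Table λ T → ∃₂ λ x e → Evolved T₀ t₀ T (tree x e []) × Ready T (tree x e []) s

      module _ {T : Table} {t : Rose} {s : Store} (ev : Evolved T₀ t₀ T t) (t≤n : count t ≤ n) (ready : Ready T t s) where

        open Evolved ev using (ok; D; shape; room)
        private
          1≤count = OneRound.1≤count T t D s ok shape room t≤n ready
          roundTime = OneRound.roundTime T t D s ok shape room t≤n ready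
          time = Round.time (count t) (1≤count t) t≤n (arrays s aCur)
          time* = Round.time* (count t) (1≤count t) t≤n (arrays s aCur)

        -- The extra `childTime` is the pass in which the parent of the node deals with it; every
        -- node is charged for one such pass.
        time-bound  : ∀ v → time v + childTime ≤ nodeCost * count v
        time-bound* : ∀ vs → time* vs + length vs * childTime ≤ nodeCost * count* vs
        time-bound (tree x e vs) = ≤-trans (≤-reflexive (rearrange (time* vs) (testCost (lit 0) (var vPos)) (cost nodeStart) (length vs) childTime childExit (cost nodeEnd)))
          (≤-trans (+-monoʳ-≤ nodeCost (time-bound* vs)) (≤-reflexive (sym (*-suc nodeCost (count* vs)))))
          where
          rearrange : ∀ z a b k c e d → z + (a + suc (b + (k * c + e + d))) + c ≡ a + suc (b + (0 * c + e + d)) + c + (z + k * c)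
          rearrange = solve-∀
        time-bound* []       = ≤-trans (z≤n {0}) (≤-reflexive (sym (*-zeroʳ nodeCost)))
        time-bound* (v ∷ vs) = ≤-trans (≤-reflexive (rearrange (time* vs) (time v) childTime (length vs * childTime)))
          (≤-trans (+-mono-≤ (time-bound v) (time-bound* vs)) (≤-reflexive (sym (*-distribˡ-+ nodeCost (count v) (count* vs)))))
          where
          rearrange : ∀ a b c d → a + b + (c + d) ≡ b + c + (a + d)
          rearrange = solve-∀

        round-bound : testCost (lit 1) (var vCount) + suc roundTime ≤ roundCost * count t
        round-bound = ≤-trans (≤-reflexive (rearrange (testCost (lit 1) (var vCount)) beginTime (time t) nodeExit middleTime (count t * compactTime) compactExit endTime))
          (≤-trans (+-mono-≤ (+-mono-≤ (m≤m*n (testCost (lit 1) (var vCount) + 1 + (beginTime + nodeExit + middleTime + compactExit + endTime)) (count t) {{>-nonZero (1≤count t)}})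
            (≤-trans (m≤m+n (time t) childTime) (time-bound t))) (≤-reflexive (*-comm (count t) compactTime)))
          (≤-reflexive (collect (testCost (lit 1) (var vCount)) fixedCost nodeCost compactTime (count t))))
          where
          rearrange : ∀ t b z e m k x f → t + suc (b + (z + e + (m + (k + x + f)))) ≡ t + 1 + (b + e + m + x + f) + z + k
          rearrange = solve-∀
          collect : ∀ t f v c N → (t + 1 + f) * N + v * N + c * N ≡ (t + suc (f + v + c)) * N
          collect = solve-∀

        one-round : 1 < count t → ∀ {l Q} →
          (∀ s′ → OneRound.Outcome T t D s ok shape room t≤n ready s′ → Run roundLoop s′ l Q) → Run roundLoop s (roundCost * count t + l) Q
        one-round 1< {l} next = run-weaken (+-monoˡ-≤ l round-bound)
          (while-yes-rule {lit 1} {var vCount} {roundStep} _ _ (subst (1 <_) (sym (Constants.count≡ (Ready.consts ready))) 1<)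
            (run-map next (OneRound.round-run T t D s ok shape room t≤n ready)))

      -- The potential is `8 * roundCost * count t`. A round takes at most
      -- `roundCost * N ≤ 8 * roundCost * a` steps and removes `a` clusters, so the potential pays
      -- for it and the total is linear. `k` is a bound for the recursion on the number of clusters.
      rounds-run : ∀ k {T t s} → count t ≤ k → Evolved T₀ t₀ T t → count t ≤ n → Ready T t s →
        Run roundLoop s (8 * roundCost * count t + roundExit) Reduced
      rounds-run zero    {t = tree x e ts} () ev t≤n ready
      rounds-run (suc k) {T} {t} {s} t≤k ev t≤n ready with 2 ≤? count t
      ... | no ≰₂ = run-weaken (m≤n+m _ _) (while-no-rule {lit 1} {var vCount} {roundStep} _ _
              (λ lt → ≰₂ (subst (1 <_) (Constants.count≡ (Ready.consts ready)) lt)) (single t ≰₂ ev ready))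
        where
        single : ∀ t → ¬ 2 ≤ count t → Evolved T₀ t₀ T t → Ready T t s → Reduced s
        single (tree x e [])               _ ev ready = T , x , e , ev , ready
        single (tree x e (tree _ _ _ ∷ _)) ≰₂ _  _     = contradiction (s≤s (s≤s z≤n)) ≰₂
      ... | yes 2≤ = run-weaken amortised (one-round ev t≤n ready 2≤ next)
        where
        N = count t
        amortised : roundCost * N + (8 * roundCost * N ∸ roundCost * N + roundExit) ≤ 8 * roundCost * N + roundExit
        amortised = ≤-trans (≤-reflexive (sym (+-assoc (roundCost * N) _ roundExit))) (+-monoˡ-≤ roundExit
          (≤-reflexive (m+[n∸m]≡n (*-monoˡ-≤ N (m≤m+n roundCost (7 * roundCost))))))
        next : ∀ s′ → OneRound.Outcome T t (Evolved.D ev) s (Evolved.ok ev) (Evolved.shape ev) (Evolved.room ev) t≤n ready s′ →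
          Run roundLoop s′ (8 * roundCost * N ∸ roundCost * N + roundExit) Reduced
        next s′ (T′ , r , a , c , ready′) with ev′ , N≤8a , counts ← evolve ev 2≤ c =
          run-weaken (+-monoˡ-≤ roundExit enough) (rounds-run k (s≤s⁻¹ (≤-trans shrink t≤k)) ev′ (≤-trans (<⇒≤ shrink) t≤n) ready′)
          where
          N′ = count (proj₂ r)
          positive : ∀ a → N ≤ 8 * a → 0 < a
          positive zero    N≤0 = contradiction (≤-trans 2≤ N≤0) λ ()
          positive (suc _) _   = s≤s z≤n
          shrink : N′ < N
          shrink = ≤-trans (≤-trans (≤-reflexive (+-comm 1 N′)) (+-monoʳ-≤ N′ (positive a N≤8a))) (≤-reflexive counts)
          enough : 8 * roundCost * N′ ≤ 8 * roundCost * N ∸ roundCost * N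
          enough = ≤-trans (≤-reflexive (sym (m+n∸n≡m (8 * roundCost * N′) (roundCost * N))))
            (∸-monoˡ-≤ (roundCost * N) (≤-trans (+-monoʳ-≤ (8 * roundCost * N′) (*-monoʳ-≤ roundCost N≤8a))
              (≤-reflexive (trans (rearrange roundCost N′ a) (cong (8 * roundCost *_) counts)))))
            where
            rearrange : ∀ c x y → 8 * c * x + c * (8 * y) ≡ 8 * c * (x + y)
            rearrange = solve-∀

    Compression : Table → ℕ → Set
    Compression T x = Σ Table λ T₀ → Σ Rose λ t₀ → ∃ λ e → Spells T₀ t₀ u × Evolved T₀ t₀ T (tree x e [])

    Printed : Store → Set
    Printed s = Σ Table λ T → ∃ λ x → Compression T x × Holds (io s) 0 (length T ∷ x ∷ encodeTable T)

    s₀ : Store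
    s₀ = ⟪ (λ _ → 0) , (λ _ _ → 0) , contents input ⟫

    contents-holds : ∀ xs {f o} → (∀ i → f (o + i) ≡ contents xs i) → Holds f o xs
    contents-holds []       eq = tt
    contents-holds (x ∷ xs) {f} {o} eq = trans (cong f (sym (+-identityʳ o))) (eq 0) ,
      contents-holds xs λ i → trans (cong f (sym (+-suc o i))) (eq (suc i))

    size-run : Run (readIO vSize (lit 0)) s₀ (cost (readIO vSize (lit 0))) (Copying [] input)
    size-run = wp-sound (readIO vSize (lit 0)) s₀ (Copying [] input) _ (≤-trans (s≤s z≤n) (m≤n+m 16 (16 * n)) , record
      { size≡ = refl ; pos≡ = refl ; todo≡ = contents-holds input (λ _ → refl) ; done≡ = tt ; nid≡ = refl
      ; terms≡ = λ _ → refl ; comps≡ = λ _ → refl })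

    start-init-run : ∀ {s} → Copying input [] s → Run startStep s (cost startStep) (Init [] 0 fs [])
    start-init-run {s} C = wp-sound startStep s (Init [] 0 fs []) _ (tt , tt , tt , record
      { size≡ = Copying.size≡ C ; pos≡ = refl ; ranks≡ = max≡R
      ; table = subst (λ v → Represents [] v 2 _ _ _ _ _) (sym (Copying.nid≡ C)) (represents-empty (Copying.terms≡ C) (Copying.comps≡ C))
      ; input≡ = proj₂ (Copying.done≡ C) ; cur≡ = tt })

    Initialised : Store → Set
    Initialised s = Σ Table λ T₀ → Σ Rose λ t₀ → Spells T₀ t₀ u × Evolved T₀ t₀ T₀ t₀ × count t₀ ≡ n × Ready T₀ t₀ s

    count-run : ∀ {T₀ xs s} → Init T₀ n [] xs s → Assigning fs T₀ xs →
      Run (set vCount (var vSize)) s (cost (set vCount (var vSize))) Initialised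
    count-run {T₀} {xs} {s} I A with t₀ , flat≡ , sp ← spell u (subst (λ gs → Assigned T₀ gs xs) (sym labels≡) (Assigning.assigned A)) =
      wp-sound (set vCount (var vSize)) s Initialised _ (tt , T₀ , t₀ , sp , evolved₀ , count≡n , record
        { consts = record { size≡ = Init.size≡ I ; rank≡ = Init.ranks≡ I ; count≡ = trans (Init.size≡ I) (sym count≡n) ; table = Init.table I }
        ; cur≡ = subst (Holds (arrays s aCur) 0) (sym flat≡) (Init.cur≡ I) })
      where
      length≡n : length xs ≡ n
      length≡n = trans (sym (Assigned-length (Assigning.assigned A))) fs-length
      count≡n : count t₀ ≡ n
      count≡n = trans (sym (length-flat t₀)) (trans (cong length flat≡) length≡n)
      evolved₀ : Evolved T₀ t₀ T₀ t₀
      evolved₀ = record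
        { ok = Assigning.ok A ; D = 1 ; j = 0 ; shape = Spells-wf sp ; D≤ = m≤m+n 1 (R * 0)
        ; rounds = *-monoʳ-≤ 1 (≤-reflexive count≡n)
        ; weight = trans (Spells-weight sp) count≡n
        ; room = +-mono-≤ (≤-trans (Assigning.small A) (≤-reflexive length≡n)) (≤-trans (≤-reflexive count≡n) (m≤m+n n 0))
        ; sparse = λ m 0<m → inj₁ (Assigning.sparse A m 0<m)
        ; ext = λ q → q ; steps = ε }

    finish-run : ∀ {T₀ t₀ s} → Spells T₀ t₀ u → Reduced {T₀} {t₀} s → Run print s (cost print) Printed
    finish-run {T₀} {t₀} {s} sp (T , x , e , ev , ready) =
      wp-sound print s Printed _ (≤-trans (s≤s z≤n) (m≤n+m 16 (16 * n)) , tt , ≤-trans (s≤s (s≤s z≤n)) (m≤n+m 16 (16 * n)) , tt ,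
        T , x , (T₀ , t₀ , e , sp , ev) ,
        Represents.nid≡ tab , proj₁ (Ready.cur≡ ready) ,
        Holds-below (encodeTable T) (s≤s (s≤s z≤n)) (Holds-below (encodeTable T) (s≤s z≤n) (Represents.out tab)))
      where
      tab = Constants.table (Ready.consts ready)

    main-run : Run main s₀ (mainTime (length input) n) Printed
    main-run = run-seq (run-map (λ _ C → run-seq (run-map (λ _ C′ → run-seq (run-map (λ _ I → run-seq (run-map after-init
      (run-weaken (≤-reflexive (cong (λ l → l * initTime + initExit) fs-length)) (init-run fs known refl fs-length assigning I)))) (start-init-run C′))) (copy-run input refl C))) size-run)
      where
      assigning : Assigning [] [] []
      assigning = record { ok = [] ; assigned = [] ; sparse = λ _ _ → refl ; small = z≤n }
      known : ∀ {f} → f ∈ fs → f ∈ fs × rank F f ≤ R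
      known f∈ = f∈ , subst (_ ≤_) max≡R (All.lookup (proj₂ (maxRank-≥ 2 fs)) f∈)
      after-rounds : ∀ s → Initialised s → Run (roundLoop ⍮ print) s (8 * roundCost * n + roundExit + cost print) Printed
      after-rounds s (T₀ , t₀ , sp , ev , eq , ready) =
        subst (λ k → Run (roundLoop ⍮ print) s (8 * roundCost * k + roundExit + cost print) Printed) eq
          (run-seq (run-map (λ _ → finish-run sp) (rounds-run (count t₀) ≤-refl ev (≤-reflexive eq) ready)))
      after-init : ∀ s → (Σ Table λ T₀ → Σ (List ℕ) λ ys → Init T₀ n [] ys s × Assigning fs T₀ ys) →
        Run (set vCount (var vSize) ⍮ roundLoop ⍮ print) s (cost (set vCount (var vSize)) + (8 * roundCost * n + roundExit + cost print)) Printed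
      after-init s (T₀ , ys , I , A) = run-seq (run-map after-rounds (count-run I A))

setBase program : Program
-- Register 40 is still 0, so the first instruction loads the size of the tree from cell 0.
setBase = load 40 40 ⨾ const 42 16 ⨾ arith 40 mul 40 42 ⨾ arith 40 add 40 42
program = setBase ⨾ compile main

abstract
  -- 520 serves the size, as obtained in `entries-bound`, and also the depth, where 12 is enough.
  -- The remaining summands serve the time, 4 being that of `setBase`.
  bigC : ℕ
  bigC = 520 + (4 + mainCost)

  520≤C : 520 ≤ bigC
  520≤C = m≤m+n 520 (4 + mainCost)

  time≤C : 4 + mainCost ≤ bigC
  time≤C = m≤n+m (4 + mainCost) 520

Holds-lookup : ∀ {f o} xs → Holds f o xs → ∀ i → f (o + toℕ i) ≡ List.lookup xs i
Holds-lookup {f} {o} (x ∷ xs) (h , hs) zero    = trans (cong f (+-identityʳ o)) h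
Holds-lookup {f} {o} (x ∷ xs) (h , hs) (suc i) = trans (cong f (+-suc o (toℕ i))) (Holds-lookup xs hs i)

contents-beyond : ∀ xs i → length xs ≤ i → contents xs i ≡ 0
contents-beyond []       i       _        = refl
contents-beyond (x ∷ xs) (suc i) (s≤s le) = contents-beyond xs i le

contents-< : ∀ {B} xs → 0 < B → All (_< B) xs → ∀ i → contents xs i < B
contents-< []       0<B []       i       = 0<B
contents-< (x ∷ xs) 0<B (p ∷ ps) zero    = p
contents-< (x ∷ xs) 0<B (p ∷ ps) (suc i) = contents-< xs 0<B ps i

-- b bounds the variables and arrays, W the registers and addresses.
module WordSize (n R : ℕ) (2≤n : 2 ≤ n) (R≤n : R ≤ n) (k : ℕ) where

  b W : ℕ
  -- Codes are at most `n ^ k`. The other quantities are the base, at most `32 n ≤ n ^ 6`, and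
  -- `2 K ≤ 16 n ^ 2 ≤ n ^ 6`, which has to be strictly below `b`.
  b = n ^ (k + 7)
  -- Addresses are below `16 b ^ 16 + 16` plus the base, hence below `18 b ^ 16`, and
  -- `18 ≤ 32 ≤ n ^ 5`.
  W = n ^ ((k + 7) * 16 + 5)

  private
    instance
      n-nonZero : NonZero n
      n-nonZero = >-nonZero (≤-trans (s≤s z≤n) 2≤n)

  32≤n⁵ : 32 ≤ n ^ 5
  32≤n⁵ = ^-monoˡ-≤ 5 2≤n

  n⁶≤b : n ^ 6 ≤ b
  n⁶≤b = ^-monoʳ-≤ n (≤-trans (n≤1+n 6) (m≤n+m 7 k))

  n⁷≤b : n ^ 7 ≤ b
  n⁷≤b = ^-monoʳ-≤ n (m≤n+m 7 k)

  32n≤n⁶ : 32 * n ≤ n ^ 6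
  32n≤n⁶ = ≤-trans (*-monoˡ-≤ n 32≤n⁵) (≤-reflexive (*-comm (n ^ 5) n))

  n^-< : ∀ j → n ^ j < n ^ suc j
  n^-< j = ^-monoʳ-< n 2≤n (n<1+n j)

  32≤b : 32 ≤ b
  32≤b = ≤-trans (m≤m*n 32 n) (≤-trans 32n≤n⁶ n⁶≤b)

  base≤b : 16 * n + 16 ≤ b
  base≤b = ≤-trans (+-monoʳ-≤ (16 * n) (m≤m*n 16 n)) (≤-trans (≤-reflexive (sym (*-distribʳ-+ n 16 16))) (≤-trans 32n≤n⁶ n⁶≤b))

  2K<b : 2 * ((8 + 4 * R) * n) < b
  2K<b = ≤-trans (s≤s (≤-trans (*-monoʳ-≤ 2 (*-monoˡ-≤ n (≤-trans (+-mono-≤ (*-monoʳ-≤ 4 2≤n) (*-monoʳ-≤ 4 R≤n)) (≤-reflexive (sym (*-distribʳ-+ n 4 4))))))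
    (≤-trans (≤-reflexive (rearrange n)) (≤-trans (*-monoˡ-≤ (n * n) (≤-trans (m≤m+n 16 0) sixteen)) (≤-reflexive (power n))))))
    (≤-trans (n^-< 6) n⁷≤b)
    where
    rearrange : ∀ n → 2 * (8 * n * n) ≡ 16 * (n * n)
    rearrange = solve-∀
    sixteen : 16 ≤ n ^ 4
    sixteen = ^-monoˡ-≤ 4 2≤n
    power : ∀ n → n ^ 4 * (n * n) ≡ n ^ 6
    power n = trans (cong (λ z → n ^ 4 * (n * z)) (sym (*-identityʳ n))) (sym (^-distribˡ-+-* n 4 2))

  fits : 16 * b ^ 16 + 16 + (16 * n + 16) ≤ W
  fits = ≤-trans (+-mono-≤ (+-monoʳ-≤ (16 * V) (≤-trans (≤ᵇ⇒≤ 16 32 tt) (≤-trans 32≤b b≤V))) (≤-trans base≤b b≤V))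
    (≤-trans (≤-reflexive (collect V)) (≤-trans (*-monoʳ-≤ V (≤-trans (≤ᵇ⇒≤ 18 32 tt) 32≤n⁵))
      (≤-reflexive (trans (cong (_* n ^ 5) (^-*-assoc n (k + 7) 16)) (sym (^-distribˡ-+-* n ((k + 7) * 16) 5))))))
    where
    V = b ^ 16
    b≤V : b ≤ V
    b≤V = ≤-trans (≤-reflexive (sym (*-identityʳ b))) (^-monoʳ-≤ b {{m^n≢0 n (k + 7)}} {1} {16} (s≤s z≤n))
    collect : ∀ v → 16 * v + v + v ≡ v * 18
    collect = solve-∀

module Compressor (F : RankedAlphabet) (r : ℕ) (u : Tree F) (2≤r : 2 ≤ r) (2≤n : 2 ≤ size u)
  (ranks≤r : All (λ f → rank F f ≤ r) (labels u)) (code : Symbol F → ℕ)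
  (code-injective : ∀ {f g} → f ∈ labels u → g ∈ labels u → code f ≡ code g → f ≡ g)
  (W b : ℕ) (code<b : ∀ {f} → f ∈ labels u → code f < b) (32≤b : 32 ≤ b)
  (fits : 16 * b ^ 16 + 16 + (16 * size u + 16) ≤ W) (base≤b : 16 * size u + 16 ≤ b)
  (2K<b : 2 * ((8 + 4 * Spelling.maxRank F 2 (labels u)) * size u) < b) where

  open Spelling F

  n R : ℕ
  n = size u
  R = maxRank 2 (labels u)

  private
    instance
      n-nonZero : NonZero n
      n-nonZero = >-nonZero (≤-trans (s≤s z≤n) 2≤n)

  0<n : 0 < n
  0<n = ≤-trans (s≤s z≤n) 2≤n

  2≤R : 2 ≤ R
  2≤R = proj₁ (maxRank-≥ 2 (labels u))

  R≤n : R ≤ n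
  R≤n = maxRank-≤ 2 (labels u) 2≤n (rank≤size u)

  R≤r : R ≤ r
  R≤r = maxRank-≤ 2 (labels u) 2≤r ranks≤r

  R≤2n : R ≤ 2 * n
  R≤2n = ≤-trans R≤n (m≤m+n n _)

  open Clusters F
  setting : Setting F
  setting = record
    { fs = labels u ; code = code ; code-injective = code-injective ; W = W ; b = b ; n = n ; R = R
    ; 1≤R = ≤-trans (s≤s z≤n) 2≤R ; 0<n = 0<n ; 32≤b = 32≤b ; fits = fits ; base≤b = base≤b ; R≤2n = R≤2n ; 2K<b = 2K<b }

  base M : ℕ
  base = 16 * n + 16
  M = 2 * n

  open Rounds.Execution F setting u refl refl refl
  open Machine W base b 32≤b fits
  open Representation F (labels u) code code-injective M using (encodeTable; encodeTable-length)
  open Evolution F (labels u) R n (≤-trans (s≤s z≤n) 2≤R) 0<n hiding (K)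

  input-< : All (_< b) input
  input-< = n<b ∷ pairs-< (labels u) (λ f∈ → f∈) (rank≤size u)
    where
    n<b : n < b
    n<b = ≤-trans (≤-trans (≤-trans (≤-reflexive (+-comm 1 n)) (+-mono-≤ (m≤m+n n (15 * n)) (s≤s (z≤n {15})))) ≤-refl) base≤b
    pairs-< : ∀ gs → (∀ {f} → f ∈ gs → f ∈ labels u) → All (λ f → rank F f ≤ n) gs → All (_< b) (concatMap (λ f → code f ∷ rank F f ∷ []) gs)
    pairs-< []       _   []       = []
    pairs-< (f ∷ gs) sub (p ∷ ps) =
      code<b (sub (here refl)) ∷ ≤-<-trans p n<b ∷ pairs-< gs (λ f∈ → sub (there f∈)) ps

  ρ₁ ρ₂ ρ₃ : ℕ → ℕ
  ρ₁ = (λ _ → 0) [ 40 ↦ n ]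
  ρ₂ = ρ₁ [ 42 ↦ 16 ]
  ρ₃ = ρ₂ [ 40 ↦ n * 16 ]

  σ₀ : State
  σ₀ = ⟨ ρ₃ [ 40 ↦ n * 16 + 16 ] , contents input ⟩

  base-comm : n * 16 + 16 ≡ base
  base-comm = cong (_+ 16) (*-comm n 16)

  base<W : base < W
  base<W = ≤-trans (+-monoˡ-≤ base {1} {16 * b ^ 16 + 16} (≤-trans (s≤s z≤n) (m≤n+m 16 (16 * b ^ 16)))) fits

  set-base : Exec W setBase (initialState input) 4 σ₀
  set-base = load (b<W (All.head input-<)) ⨾ const 16<W ⨾
    arith (≤-<-trans (m≤m+n (n * 16) 16) (subst (_< W) (sym base-comm) base<W)) ⨾ arith (subst (_< W) (sym base-comm) base<W)

  initial-simulates : Simulates s₀ σ₀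
  initial-simulates = record
    { vars≈   = λ x x<40 → trans (update-other ρ₃ 40 (n * 16 + 16) (<⇒≢ x<40)) (trans (update-other ρ₂ 40 (n * 16) (<⇒≢ x<40))
                  (trans (update-other ρ₁ 42 16 (<⇒≢ (≤-trans x<40 (≤ᵇ⇒≤ 40 42 tt)))) (update-other (λ _ → 0) 40 n (<⇒≢ x<40))))
    ; base≈   = base-comm
    ; zero≈   = refl
    ; arrays≈ = λ c i _ → contents-beyond input (address c i) (≤-trans (≤-reflexive input-length)
                  (≤-trans input≤base (m≤n+m base (i * 16 + c))))
    ; io≈     = λ _ _ → refl
    ; bounded = record
      { vars<   = λ _ → 0<b
      ; arrays< = λ _ _ → 0<b
      ; io<     = contents-< input 0<b input-<
      }
    }
    where
    input≤base : 1 + 2 * n ≤ base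
    input≤base = ≤-trans (≤-reflexive (+-comm 1 (2 * n))) (+-mono-≤ (*-monoˡ-≤ n (≤ᵇ⇒≤ 2 16 tt)) (s≤s z≤n))

  module Output {T : Table} {x : ℕ} {T₀ : Table} {t₀ : Rose} {e : Entry} (sp : Spells T₀ t₀ u) (ev : Evolved T₀ t₀ T (tree x e [])) where
    open Evolved ev
    open Grammar F (labels u) R T ok
    open LightEntries F (labels u) R T ok using (few-light)

    x-at : At T x e
    x-at with wf p _ _ _ ← shape = p

    rank-zero : rk e ≡ 0
    rank-zero with wf _ l _ _ ← shape = sym l

    depth≤ : dp e ≤ D
    depth≤ with wf _ _ d _ ← shape = d

    A₀ : Fin (length T)
    A₀ = position x-at

    A₀-rank : arity A₀ ≡ 0
    A₀-rank = trans (cong rk (position-lookup x-at)) rank-zero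

    G : TSLP F
    G = grammar A₀ A₀-rank

    private
      ℓ a lr : ℕ
      ℓ = ⌊log₂ n ⌋
      a = ⌊log₂ (#labels u + r) ⌋
      lr = ⌊log₂ r ⌋

    length≤ : length T ≤ 2 * n
    length≤ = ≤-trans (m≤m+n (length T) 1) room

    heavy≤ : ∀ m → 0 < m → heavy m T * m ≤ 2 * ((8 + 4 * R) * n)
    heavy≤ m 0<m with sparse m 0<m
    ... | inj₁ eq = ≤-trans (≤-reflexive (cong (_* m) eq)) z≤n
    ... | inj₂ le = ≤-trans (*-monoˡ-≤ m (m≤m+n (heavy m T) 1)) le

    small : SmallGrammarFor bigC r u G
    small = record
      { cnf         = cnf A₀ A₀-rank
      ; produces    = produces A₀ A₀-rank (subst (λ y → At T y e) (sym (position-toℕ x-at)) x-at)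
                        (subst (λ y → T ⊢ tree y e [] ⟶* t₀) (sym (position-toℕ x-at)) steps) (Spells-mono ext sp)
      ; size-bound  = ≤-trans (*-monoˡ-≤ ℓ (grammar-size A₀ A₀-rank))
                        (≤-trans (entries-bound n (#labels u) R r 2≤n 2≤r R≤r (length T) (λ m → heavy m T) length≤ few-light heavy≤)
                          (*-monoˡ-≤ (n * a * r * lr) 520≤C))
      ; depth-bound = proj₁ derivation , ≤-trans (proj₂ derivation) (≤-trans (≤-reflexive (cong dp (position-lookup x-at)))
                        (≤-trans depth≤ (≤-trans (depth-of-rounds n (#labels u) R r 2≤n 2≤r R≤r D j D≤ (few-rounds j 1 n 2≤n ≤-refl rounds))
                          (*-monoˡ-≤ (r * ℓ) (≤-trans (≤ᵇ⇒≤ 12 520 tt) 520≤C)))))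
      ; rank-bound  = λ A → ≤-trans (OK-rank ok (At-lookup T A)) (≤-trans R≤r (m≤m+n r 1))
      }
      where
      derivation = derive A₀ A₀-rank (dp (entryOf A₀)) A₀ ≤-refl

    encoded : encodeGrammar code G (cnf A₀ A₀-rank) ≡ length T ∷ x ∷ encodeTable T
    encoded = trans (Encoding.encode-grammar A₀ A₀-rank code code-injective M) (cong (λ y → length T ∷ y ∷ encodeTable T) (position-toℕ x-at))

  time≤ : ∀ {l} → l ≤ mainTime (length input) n → 4 + l ≤ bigC * (r * n * ⌊log₂ n ⌋)
  time≤ {l} l≤ = ≤-trans (+-monoʳ-≤ 4 (≤-trans l≤ (≤-trans (≤-reflexive (cong (λ i → mainTime i n) input-length)) (mainTime≤ n 0<n))))
    (≤-trans (+-monoˡ-≤ (mainCost * n) (m≤m*n 4 n)) (≤-trans (≤-reflexive (sym (*-distribʳ-+ n 4 mainCost)))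
    (*-mono-≤ time≤C (≤-trans (m≤n*m n r {{>-nonZero (≤-trans (s≤s z≤n) 2≤r)}}) (m≤m*n (r * n) ⌊log₂ n ⌋ {{>-nonZero (2^≤⇒≤log {1} 2≤n)}})))))

  Compressed : Set
  Compressed = Σ (TSLP F) λ G → Σ (SmallGrammarFor bigC r u G) λ small →
    ComputesWithin W (bigC * (r * n * ⌊log₂ n ⌋)) program (encodeTree code u) (encodeGrammar code G (SmallGrammarFor.cnf small))

  compressed : (Σ ℕ λ l → Σ State λ σ′ → Σ Store λ s′ →
    l ≤ mainTime (length input) n × Exec W (compile main) σ₀ l σ′ × Simulates s′ σ′ × Printed s′) → Compressed
  compressed (l , σ′ , s′ , l≤ , E , S , T , x , (T₀ , t₀ , e , sp , ev) , holds) =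
    G , small , 4 + l , σ′ , time≤ l≤ , (set-base ⨾ E) , subst (HoldsOutput σ′) (sym encoded) output
    where
    open Output sp ev
    out : List ℕ
    out = length T ∷ x ∷ encodeTable T
    out-length : length out ≤ base
    out-length = ≤-trans (s≤s (s≤s (≤-trans (encodeTable-length T) (*-monoʳ-≤ 5 length≤)))) (≤-trans (≤-reflexive (rearrange n))
      (+-mono-≤ (*-monoˡ-≤ n (≤ᵇ⇒≤ 10 16 tt)) (≤ᵇ⇒≤ 2 16 tt)))
      where
      rearrange : ∀ n → 2 + 5 * (2 * n) ≡ 10 * n + 2
      rearrange = solve-∀
    output : HoldsOutput σ′ out
    output i = trans (Simulates.io≈ S (toℕ i) (≤-trans (toℕ<n i) out-length)) (Holds-lookup out holds i)

  result : Compressed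
  result = compressed (Run.execute main-run initial-simulates)

compress : (F : RankedAlphabet) (r : ℕ) (t : Tree F) → 2 ≤ r → 2 ≤ size t → All (λ f → rank F f ≤ r) (labels t) →
  (k : ℕ) (code : Symbol F → ℕ) → LabelCode k t code →
  Σ (TSLP F) λ G → Σ (SmallGrammarFor bigC r t G) λ small →
    ComputesWithin (size t ^ ((k + 7) * 16 + 5)) (bigC * (r * size t * ⌊log₂ size t ⌋)) program
      (encodeTree code t) (encodeGrammar code G (SmallGrammarFor.cnf small))
compress F r t 2≤r 2≤n ranks≤r k code lc =
  Compressor.result F r t 2≤r 2≤n ranks≤r code (LabelCode.injective lc) W b
    (λ f∈ → ≤-<-trans (LabelCode.bounded lc f∈) (^-monoʳ-< (size t) 2≤n (m<m+n k (s≤s z≤n)))) 32≤b fits base≤b 2K<b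
  where open WordSize (size t) (Spelling.maxRank F 2 (labels t)) 2≤n (Spelling.maxRank-≤ F 2 (labels t) 2≤n (Spelling.rank≤size F t)) k

mainTheorem10 : Σ ℕ λ C →
    ((F : RankedAlphabet) (r : ℕ) (t : Tree F) →
    2 ≤ r → 2 ≤ size t → All (λ f → rank F f ≤ r) (labels t) →
    Σ (TSLP F) λ G → SmallGrammarFor C r t G)
    ×
    (Σ Program λ P →
    (k : ℕ) → Σ ℕ λ w →
    (F : RankedAlphabet) (r : ℕ) (t : Tree F) →
    2 ≤ r → 2 ≤ size t → All (λ f → rank F f ≤ r) (labels t) →
    (code : Symbol F → ℕ) → LabelCode k t code →
    Σ (TSLP F) λ G → Σ (SmallGrammarFor C r t G) λ small →
    ComputesWithin (size t ^ w) (C * (r * size t * ⌊log₂ size t ⌋)) P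
    (encodeTree code t)
    (encodeGrammar code G (SmallGrammarFor.cnf small)))
mainTheorem10 = bigC , exists , program , λ k → (k + 7) * 16 + 5 , λ F r t 2≤r 2≤n ranks≤r code lc →
  compress F r t 2≤r 2≤n ranks≤r k code lc
  where
  exists : (F : RankedAlphabet) (r : ℕ) (t : Tree F) → 2 ≤ r → 2 ≤ size t → All (λ f → rank F f ≤ r) (labels t) →
    Σ (TSLP F) λ G → SmallGrammarFor bigC r t G
  -- Existence alone comes without a code. Numbering the labels by their first occurrence gives
  -- numbers below `size t`, so `k = 1` will do.
  exists F r t 2≤r 2≤n ranks≤r = let G , small , _ = compress F r t 2≤r 2≤n ranks≤r 1 (Positions.indexOf F (labels t)) lc in G , small
    where
    lc : LabelCode 1 t (Positions.indexOf F (labels t))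
    lc = record
      { injective = Positions.indexOf-injective F
      ; bounded   = λ f∈ → ≤-trans (<⇒≤ (Positions.indexOf-< F f∈)) (≤-reflexive (sym (*-identityʳ (size t))))
      }
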